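{- Let $l\ge 2$. For any double-wedge pattern $\tau\in S_{2l}$ avoiding $132$, $$I_\tau(x)=I_{12\dots(2l)}(x)=\frac{R_l(x^2)}{1-x\,R_l(x^2)},$$ where for a pattern $\rho$, $I_\rho(x)=\sum_{n\ge 0}I_\rho(n)x^n$ and $I_\rho(n)$ is the number of involutions in $S_n$ avoiding both $132$ and $\rho$.
   Context: $S_n$ is the set of permutations of $\{1,\dots,n\}$, written in one-line notation. A permutation $\alpha\in S_n$ contains a pattern $\tau\in S_k$ if there are $1\le i_1<\dots<i_k\le n$ such that $(\alpha_{i_1},\dots,\alpha_{i_k})$ is order-isomorphic to $\tau$; otherwise it avoids $\tau$. An involution is a permutation equal to its own inverse; the empty permutation is counted for $n=0$. A permutation $\sigma\in S_m$ ($m\ge1$) is a wedge pattern if it can be written as a concatenation $\sigma=(\tau^1,\rho^1,\dots,\tau^r,\rho^r)$ such that each $\tau^i$ is nonempty, $(\tau^1,\tau^2,\dots,\tau^r)=(s+1,s+2,\dots,m)$ for some $s\ge 0$, and $(\rho^1,\dots,\rho^r)$ is a layered permutation of $1,\dots,s$ with layers $\rho^1,\dots,\rho^r$; that is, each $\rho^i$ is a (possibly empty) increasing sequence of consecutive integers and every entry of $\rho^i$ is larger than every entry of $\rho^{i'}$ whenever $i<i'$. For example $645783912$ and $456378129$ are wedge patterns. For a sequence $\sigma$, $\sigma+l$ denotes the sequence obtained by adding $l$ to every entry. A permutation $\tau\in S_{2l}$ is a double-wedge pattern if there is a wedge pattern $\sigma\in S_{l-1}$ such that $\tau=(\sigma^{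 -1}+l,\,2l,\,\sigma,\,l)$ or $\tau=(\sigma+l,\,2l,\,\sigma^{ -1},\,l)$. $U_r$ is the Chebyshev polynomial of the second kind, $U_r(\cos\theta)=\sin((r+1)\theta)/\sin\theta$, and for $k\ge1$, $R_k(x)=\dfrac{2t\,U_{k-1}(t)}{U_k(t)}$ with $t=\dfrac{1}{2\sqrt{x}}$ (a rational function of $x$). -}

module Defs where

open import Algebra.Bundles using (CommutativeRing; RawRing)
open import Algebra.Definitions using (Involutive)
open import Data.Fin as Fin using (Fin; toℕ)
open import Data.Fin.Patterns using (1F; 2F)
open import Data.Fin.Permutation using (Permutation′; _⟨$⟩ʳ_; flip; transpose)
import Data.Fin.Properties as Fin
open import Data.Integer as ℤ using (ℤ; 0ℤ; 1ℤ)
import Data.Integer.Properties as ℤ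
open import Data.List using (List; []; _∷_; _++_; allFin; applyUpTo; concat; concatMap; filter; length; map; tabulate)
open import Data.List.Relation.Binary.Permutation.Propositional using (_↭_)
open import Data.List.Relation.Unary.All using (All)
open import Data.List.Relation.Unary.AllPairs using (AllPairs)
open import Data.Nat as ℕ using (ℕ; zero; suc)
import Data.Nat.Properties as ℕ
open import Data.Product using (_×_; _,_; ∃; ∃-syntax; Σ-syntax; proj₁; proj₂)
open import Data.Sum using (_⊎_; [_,_])
open import Function using (_∘_; _⇔_; mk⇔; module Equivalence)
open import Level using (0ℓ)
open import Relation.Binary.PropositionalEquality using (_≡_; _≢_; _≗_; refl; sym; trans; cong; cong₂)
open import Relation.Nullary using (Dec; yes; no; ¬_; ¬?; _×-dec_; contradiction)
open import Relation.Nullary.Decidable using (map′; _→-dec_)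
open import Relation.Unary using (Decidable)

-- α contains τ when composing α with some strictly increasing choice of
-- positions ι gives a word order-isomorphic to τ.
Increasing : ∀ {k n} → (Fin k → Fin n) → Set
Increasing ι = ∀ a b → a Fin.< b → ι a Fin.< ι b

OrderIsomorphic : ∀ {k m n} → (Fin k → Fin m) → (Fin k → Fin n) → Set
OrderIsomorphic u v = ∀ a b → u a Fin.< u b ⇔ v a Fin.< v b

Occurrence : ∀ {n k} → (Fin n → Fin n) → (Fin k → Fin k) → (Fin k → Fin n) → Set
Occurrence α τ ι = Increasing ι × OrderIsomorphic (α ∘ ι) τ

Contains : ∀ {n k} → (Fin n → Fin n) → (Fin k → Fin k) → Set
Contains α τ = ∃ (Occurrence α τ)

Avoids : ∀ {n k} → (Fin n → Fin n) → (Fin k → Fin k) → Set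
Avoids α τ = ¬ Contains α τ

-- The pattern 132 (indices and values in Fin 3 are shifted down by one).
p132 : Permutation′ 3
p132 = transpose 1F 2F

-- A self-inverse map on Fin n is automatically a permutation.
AvoidingInvolution : ∀ {k n} → Permutation′ k → (Fin n → Fin n) → Set
AvoidingInvolution ρ α =
  Involutive _≡_ α × Avoids α (p132 ⟨$⟩ʳ_) × Avoids α (ρ ⟨$⟩ʳ_)

occurrence? : ∀ {n k} (α : Fin n → Fin n) (τ : Fin k → Fin k) → Decidable (Occurrence α τ)
occurrence? α τ ι =
  Fin.all? (λ a → Fin.all? λ b → (a Fin.<? b) →-dec (ι a Fin.<? ι b))
  ×-dec
  Fin.all? (λ a → Fin.all? λ b →
    map′ (λ (f , g) → mk⇔ f g) (λ e → Equivalence.to e , Equivalence.from e)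
      (((α (ι a) Fin.<? α (ι b)) →-dec (τ a Fin.<? τ b))
       ×-dec
       ((τ a Fin.<? τ b) →-dec (α (ι a) Fin.<? α (ι b)))))

occurrence-resp : ∀ {n k} (α : Fin n → Fin n) (τ : Fin k → Fin k) {ι κ : Fin k → Fin n} →
                  ι ≗ κ → Occurrence α τ ι → Occurrence α τ κ
occurrence-resp α τ {ι} {κ} eq (inc , iso) = inc′ , iso′
  where
  inc′ : Increasing κ
  inc′ a b a<b rewrite sym (eq a) | sym (eq b) = inc a b a<b
  iso′ : OrderIsomorphic (α ∘ κ) τ
  iso′ a b rewrite sym (eq a) | sym (eq b) = iso a b

contains? : ∀ {n k} (α : Fin n → Fin n) (τ : Fin k → Fin k) → Dec (Contains α τ)
contains? {n} {k} α τ =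
  map′ (λ (i , occ) → Fin.finToFun i , occ)
       (λ (ι , occ) → Fin.funToFin ι ,
          occurrence-resp α τ (sym ∘ Fin.finToFun-funToFin ι) occ)
       (Fin.any? (occurrence? α τ ∘ Fin.finToFun {n} {k}))

avoidingInvolution? : ∀ {k} (ρ : Permutation′ k) {n} → Decidable (AvoidingInvolution {k} {n} ρ)
avoidingInvolution? ρ α =
  Fin.all? (λ i → α (α i) Fin.≟ i)
  ×-dec ¬? (contains? α (p132 ⟨$⟩ʳ_))
  ×-dec ¬? (contains? α (ρ ⟨$⟩ʳ_))

-- finToFun runs through every map Fin n → Fin n exactly once (up to _≗_).
endomaps : ∀ n → List (Fin n → Fin n)
endomaps n = map Fin.finToFun (allFin (n ℕ.^ n))

I : ∀ {k} → Permutation′ k → ℕ → ℕ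
I ρ n = length (filter (avoidingInvolution? ρ) (endomaps n))

oneLine : ∀ {n} → Permutation′ n → List ℕ
oneLine π = tabulate (λ i → suc (toℕ (π ⟨$⟩ʳ i)))

-- a + 1, a + 2, …, a + k
interval : ℕ → ℕ → List ℕ
interval a k = applyUpTo (λ i → a ℕ.+ suc i) k

IsInterval : List ℕ → Set
IsInterval w = ∃[ a ] w ≡ interval a (length w)

_AllAbove_ : List ℕ → List ℕ → Set
u AllAbove v = All (λ x → All (λ y → y ℕ.< x) v) u

-- Layers may be empty.
LayeredWithLayers : ℕ → List (List ℕ) → Set
LayeredWithLayers s ρs =
  concat ρs ↭ interval 0 s × All IsInterval ρs × AllPairs _AllAbove_ ρs

-- The list of pairs is (τ¹ , ρ¹) , … , (τʳ , ρʳ).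
record Wedge {m : ℕ} (σ : Permutation′ m) : Set where
  field
    m≥1        : 1 ℕ.≤ m
    s          : ℕ
    blocks     : List (List ℕ × List ℕ)
    decomposes : oneLine σ ≡ concatMap (λ (τ , ρ) → τ ++ ρ) blocks
    τ-nonempty : All (λ (τ , _) → τ ≢ []) blocks
    τ-entries  : concat (map proj₁ blocks) ≡ interval s (m ℕ.∸ s)
    ρ-layered  : LayeredWithLayers s (map proj₂ blocks)

_⊹_ : List ℕ → ℕ → List ℕ
w ⊹ l = map (ℕ._+ l) w

DoubleWedge : (l : ℕ) → Permutation′ (2 ℕ.* l) → Set
DoubleWedge l τ =
  Σ[ σ ∈ Permutation′ (l ℕ.∸ 1) ] Wedge σ ×
    ( oneLine τ ≡ (oneLine (flip σ) ⊹ l) ++ (2 ℕ.* l ∷ []) ++ oneLine σ ++ (l ∷ [])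
    ⊎ oneLine τ ≡ (oneLine σ ⊹ l) ++ (2 ℕ.* l ∷ []) ++ oneLine (flip σ) ++ (l ∷ []))

Series : Set
Series = ℕ → ℤ

-- Cauchy product: (f ∗ g) n = Σ_{i ≤ n} f i · g (n - i), peeling off i = 0.
_∗_ : Series → Series → Series
(f ∗ g) zero    = f 0 ℤ.* g 0
(f ∗ g) (suc n) = f 0 ℤ.* g (suc n) ℤ.+ ((f ∘ suc) ∗ g) n

∗-cong : ∀ {f f′ g g′} → f ≗ f′ → g ≗ g′ → f ∗ g ≗ f′ ∗ g′
∗-cong p q zero    = cong₂ ℤ._*_ (p 0) (q 0)
∗-cong p q (suc n) = cong₂ ℤ._+_ (cong₂ ℤ._*_ (p 0) (q (suc n))) (∗-cong (p ∘ suc) q n)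

∗-shiftˡ : ∀ f g → f 0 ≡ 0ℤ → ∀ n → (f ∗ g) (suc n) ≡ ((f ∘ suc) ∗ g) n
∗-shiftˡ f g f₀ n rewrite f₀ | ℤ.*-zeroˡ (g (suc n)) = ℤ.+-identityˡ _

∗-shiftʳ : ∀ f g → g 0 ≡ 0ℤ → ∀ n → (f ∗ g) (suc n) ≡ (f ∗ (g ∘ suc)) n
∗-shiftʳ f g g₀ zero    rewrite g₀ | ℤ.*-zeroʳ (f 1) = ℤ.+-identityʳ _
∗-shiftʳ f g g₀ (suc n) = cong (λ z → f 0 ℤ.* g (suc (suc n)) ℤ.+ z) (∗-shiftʳ (f ∘ suc) g g₀ n)

NonZeroSeries : Series → Set
NonZeroSeries f = ∃[ n ] f n ≢ 0ℤ

∗-nonZero : ∀ f g m n → f m ≢ 0ℤ → g n ≢ 0ℤ → NonZeroSeries (f ∗ g)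
∗-nonZero f g m n fm gn with f 0 ℤ.≟ 0ℤ | g 0 ℤ.≟ 0ℤ
∗-nonZero f g m       n       fm gn | no f₀  | no g₀  =
  0 , λ eq → [ f₀ , g₀ ] (ℤ.i*j≡0⇒i≡0∨j≡0 (f 0) eq)
∗-nonZero f g zero    n       fm gn | yes f₀ | _      = contradiction f₀ fm
∗-nonZero f g (suc m) n       fm gn | yes f₀ | _      =
  let k , p = ∗-nonZero (f ∘ suc) g m n fm gn
  in suc k , p ∘ trans (sym (∗-shiftˡ f g f₀ k))
∗-nonZero f g m       zero    fm gn | no _   | yes g₀ = contradiction g₀ gn
∗-nonZero f g m       (suc n) fm gn | no _   | yes g₀ =
  let k , p = ∗-nonZero f (g ∘ suc) m n fm gn
  in suc k , p ∘ trans (sym (∗-shiftʳ f g g₀ k))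

-- Polynomials over ℤ, coefficients listed from the constant term upwards;
-- trailing zeros are allowed, so they are compared through coeff.
Poly : Set
Poly = List ℤ

coeff : Poly → Series
coeff []      _       = 0ℤ
coeff (a ∷ p) zero    = a
coeff (a ∷ p) (suc n) = coeff p n

infixl 6 _+ₚ_
infixl 7 _*ₚ_

_+ₚ_ : Poly → Poly → Poly
[]      +ₚ q       = q
(a ∷ p) +ₚ []      = a ∷ p
(a ∷ p) +ₚ (b ∷ q) = a ℤ.+ b ∷ p +ₚ q

-ₚ_ : Poly → Poly
-ₚ p = map ℤ.-_ p

_*ₚ_ : Poly → Poly → Poly
[]      *ₚ q = []
(a ∷ p) *ₚ q = map (a ℤ.*_) q +ₚ (0ℤ ∷ p *ₚ q)

coeff-+ : ∀ p q n → coeff (p +ₚ q) n ≡ coeff p n ℤ.+ coeff q n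
coeff-+ []      q       n       = sym (ℤ.+-identityˡ _)
coeff-+ (a ∷ p) []      n       = sym (ℤ.+-identityʳ _)
coeff-+ (a ∷ p) (b ∷ q) zero    = refl
coeff-+ (a ∷ p) (b ∷ q) (suc n) = coeff-+ p q n

coeff-scale : ∀ a q n → coeff (map (a ℤ.*_) q) n ≡ a ℤ.* coeff q n
coeff-scale a []      n       = sym (ℤ.*-zeroʳ a)
coeff-scale a (b ∷ q) zero    = refl
coeff-scale a (b ∷ q) (suc n) = coeff-scale a q n

∗-zeroˡ : ∀ g n → ((λ _ → 0ℤ) ∗ g) n ≡ 0ℤ
∗-zeroˡ g zero    = refl
∗-zeroˡ g (suc n) = trans (∗-shiftˡ (λ _ → 0ℤ) g refl n) (∗-zeroˡ g n)

coeff-* : ∀ p q → coeff (p *ₚ q) ≗ coeff p ∗ coeff q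
coeff-* []      q n       = sym (∗-zeroˡ (coeff q) n)
coeff-* (a ∷ p) q zero    =
  trans (coeff-+ (map (a ℤ.*_) q) _ 0)
        (trans (ℤ.+-identityʳ _) (coeff-scale a q 0))
coeff-* (a ∷ p) q (suc n) =
  trans (coeff-+ (map (a ℤ.*_) q) _ (suc n))
        (cong₂ ℤ._+_ (coeff-scale a q (suc n)) (coeff-* p q n))

NonZeroPoly : Poly → Set
NonZeroPoly p = NonZeroSeries (coeff p)

nonZeroPoly? : Decidable NonZeroPoly
nonZeroPoly? []      = no λ (_ , c) → c refl
nonZeroPoly? (a ∷ p) with a ℤ.≟ 0ℤ
... | no  a≢0 = yes (0 , a≢0)
... | yes a≡0 = map′ (λ (n , c) → suc n , c)
                     (λ { (zero , c) → contradiction a≡0 c ; (suc n , c) → n , c })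
                     (nonZeroPoly? p)

*ₚ-nonZero : ∀ p q → NonZeroPoly p → NonZeroPoly q → NonZeroPoly (p *ₚ q)
*ₚ-nonZero p q (i , pᵢ≢0) (j , qⱼ≢0) =
  let n , c = ∗-nonZero (coeff p) (coeff q) i j pᵢ≢0 qⱼ≢0
  in n , c ∘ trans (sym (coeff-* p q n))

-- The field of fractions of ℤ[x], i.e. ℚ(x).
record RatFun : Set where
  constructor _/ₚ_[_]
  field
    num     : Poly
    den     : Poly
    den-nz  : NonZeroPoly den

open RatFun public

infix  4 _≈ʳ_
infixl 6 _+ʳ_ _-ʳ_
infixl 7 _*ʳ_ _/ʳ_
infix  8 -ʳ_
infix  9 _⁻¹ʳ

_≈ʳ_ : RatFun → RatFun → Set
p ≈ʳ q = coeff (num p *ₚ den q) ≗ coeff (num q *ₚ den p)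

fromPoly : Poly → RatFun
fromPoly p = p /ₚ (1ℤ ∷ []) [ 0 , (λ ()) ]

0ʳ 1ʳ X : RatFun
0ʳ = fromPoly []
1ʳ = fromPoly (1ℤ ∷ [])
X  = fromPoly (0ℤ ∷ 1ℤ ∷ [])

_+ʳ_ : RatFun → RatFun → RatFun
p +ʳ q = (num p *ₚ den q +ₚ num q *ₚ den p) /ₚ (den p *ₚ den q)
         [ *ₚ-nonZero (den p) (den q) (den-nz p) (den-nz q) ]

_*ʳ_ : RatFun → RatFun → RatFun
p *ʳ q = (num p *ₚ num q) /ₚ (den p *ₚ den q)
         [ *ₚ-nonZero (den p) (den q) (den-nz p) (den-nz q) ]

-ʳ_ : RatFun → RatFun
-ʳ p = (-ₚ num p) /ₚ den p [ den-nz p ]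

_-ʳ_ : RatFun → RatFun → RatFun
p -ʳ q = p +ʳ (-ʳ q)

-- Totalised by 0⁻¹ = 0. An identity stating that a series with nonzero constant
-- term expands a nested quotient p /ʳ q cannot hold through this convention,
-- since a zero denominator would make the quotient 0.
_⁻¹ʳ : RatFun → RatFun
p ⁻¹ʳ with nonZeroPoly? (num p)
... | yes nz = den p /ₚ num p [ nz ]
... | no  _  = 0ʳ

_/ʳ_ : RatFun → RatFun → RatFun
p /ʳ q = p *ʳ q ⁻¹ʳ

ratFunRawRing : RawRing 0ℓ 0ℓ
ratFunRawRing = record
  { Carrier = RatFun ; _≈_ = _≈ʳ_ ; _+_ = _+ʳ_ ; _*_ = _*ʳ_ ; -_ = -ʳ_ ; 0# = 0ʳ ; 1# = 1ʳ }

-- F is the power series expansion of r at 0: den r · F = num r in ℤ[[x]].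
_IsExpansionOf_ : Series → RatFun → Set
F IsExpansionOf r = coeff (den r) ∗ F ≗ coeff (num r)

genFun : (ℕ → ℕ) → Series
genFun a n = ℤ.+ a n

-- The value at t of U_r; U-sin below shows that this is the polynomial with
-- U_r(cos θ) · sin θ = sin ((r + 1) θ).
module Chebyshev {c ℓ} (K : RawRing c ℓ) where
  open RawRing K

  U : ℕ → Carrier → Carrier
  U zero          t = 1#
  U (suc zero)    t = (1# + 1#) * t
  U (suc (suc r)) t = (1# + 1#) * t * U (suc r) t + - U r t

-- sin (n θ) and cos (n θ), computed by the addition formulas from
-- cosθ and sinθ subject to cos² θ + sin² θ = 1.
module _ {c ℓ} (K : CommutativeRing c ℓ) where
  open CommutativeRing K renaming (refl to ≈-refl; sym to ≈-sym; trans to ≈-trans)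
  open Chebyshev rawRing
  open import Relation.Binary.Reasoning.Setoid setoid

  module MultipleAngle (cosθ sinθ : Carrier) where
    cos[_θ] sin[_θ] : ℕ → Carrier
    cos[ zero  θ] = 1#
    cos[ suc n θ] = cosθ * cos[ n θ] + - (sinθ * sin[ n θ])
    sin[ zero  θ] = 0#
    sin[ suc n θ] = sin[ n θ] * cosθ + cos[ n θ] * sinθ

  private
    open import Algebra.Properties.Ring ring using (-‿distribˡ-*; -‿distribʳ-*)
    open import Algebra.Solver.Ring.NaturalCoefficients.Default commutativeSemiring
      using (solve; _:=_; _:+_; _:*_; con)

    regroup : ∀ c s C S N →
      (S * c + C * s) * c + (c * C + s * N) * s + c * c * (S + N)
      ≈ (1# + 1#) * c * (S * c + C * s) + (c * c + s * s) * N
    regroup = solve 5 (λ c s C S N →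
      (S :* c :+ C :* s) :* c :+ (c :* C :+ s :* N) :* s :+ c :* c :* (S :+ N)
      := (con 1 :+ con 1) :* c :* (S :* c :+ C :* s) :+ (c :* c :+ s :* s) :* N) ≈-refl

  U-sin : ∀ cosθ sinθ → cosθ * cosθ + sinθ * sinθ ≈ 1# →
          let open MultipleAngle cosθ sinθ in
          ∀ r → U r cosθ * sinθ ≈ sin[ suc r θ]
  U-sin c s pyth = go
    where
    open MultipleAngle c s

    step : ∀ n → sin[ suc (suc n) θ] ≈ (1# + 1#) * c * sin[ suc n θ] + - sin[ n θ]
    step n = begin
      Y * c + (c * C + - (s * S)) * s                    ≈⟨ +-congˡ (*-congʳ (+-congˡ (-‿distribʳ-* s S))) ⟩
      Y * c + (c * C + s * - S) * s                      ≈⟨ +-identityʳ _ ⟨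
      Y * c + (c * C + s * - S) * s + 0#                 ≈⟨ +-congˡ (zeroʳ (c * c)) ⟨
      Y * c + (c * C + s * - S) * s + c * c * 0#         ≈⟨ +-congˡ (*-congˡ (-‿inverseʳ S)) ⟨
      Y * c + (c * C + s * - S) * s + c * c * (S + - S)  ≈⟨ regroup c s C S (- S) ⟩
      (1# + 1#) * c * Y + (c * c + s * s) * - S          ≈⟨ +-congˡ (*-congʳ pyth) ⟩
      (1# + 1#) * c * Y + 1# * - S                       ≈⟨ +-congˡ (*-identityˡ _) ⟩
      (1# + 1#) * c * Y + - S                            ∎
      where
      S = sin[ n θ]
      C = cos[ n θ]
      Y = S * c + C * s

    distribute : ∀ w u v → (w * u + - v) * s ≈ w * (u * s) + - (v * s)
    distribute w u v = begin
      (w * u + - v) * s        ≈⟨ distribʳ s (w * u) (- v) ⟩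
      w * u * s + - v * s      ≈⟨ +-cong (*-assoc w u s) (≈-sym (-‿distribˡ-* v s)) ⟩
      w * (u * s) + - (v * s)  ∎

    first : sin[ 1 θ] ≈ 1# * s
    first = begin
      0# * c + 1# * s  ≈⟨ +-congʳ (zeroˡ c) ⟩
      0# + 1# * s      ≈⟨ +-identityˡ _ ⟩
      1# * s           ∎

    go : ∀ r → U r c * s ≈ sin[ suc r θ]
    go zero          = ≈-sym first
    go (suc zero)    = begin
      (1# + 1#) * c * s                     ≈⟨ *-congˡ (≈-trans first (*-identityˡ s)) ⟨
      (1# + 1#) * c * sin[ 1 θ]             ≈⟨ +-identityʳ _ ⟨
      (1# + 1#) * c * sin[ 1 θ] + 0#        ≈⟨ +-congˡ (≈-trans (≈-sym (+-identityˡ _)) (-‿inverseʳ 0#)) ⟨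
      (1# + 1#) * c * sin[ 1 θ] + - 0#      ≈⟨ step 0 ⟨
      sin[ 2 θ]                             ∎
    go (suc (suc r)) = begin
      ((1# + 1#) * c * U (suc r) c + - U r c) * s            ≈⟨ distribute _ _ _ ⟩
      (1# + 1#) * c * (U (suc r) c * s) + - (U r c * s)      ≈⟨ +-cong (*-congˡ (go (suc r))) (-‿cong (go r)) ⟩
      (1# + 1#) * c * sin[ suc (suc r) θ] + - sin[ suc r θ]  ≈⟨ step (suc r) ⟨
      sin[ suc (suc (suc r)) θ]                              ∎

open Chebyshev ratFunRawRing using (U)

SquareRoot : RatFun → Set
SquareRoot x = Σ[ s ∈ RatFun ] s *ʳ s ≈ʳ x

2ʳ : RatFun
2ʳ = 1ʳ +ʳ 1ʳ

-- R_k(x) for k ≥ 1, at an argument x with a given square root √x; the value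
-- does not depend on the choice of root, since U_{k-1} and U_k have opposite
-- parity and so √x and -√x give the same quotient.
R : ℕ → (x : RatFun) → SquareRoot x → RatFun
R k x (√x , _) = (2ʳ *ʳ t *ʳ U (k ℕ.∸ 1) t) /ʳ U k t
  where
  t : RatFun
  t = 1ʳ /ʳ (2ʳ *ʳ √x)

X² : RatFun
X² = X *ʳ X

√X² : SquareRoot X²
√X² = X , λ _ → refl

module Submission where

-- A 132-avoiding permutation splits around its largest entry as (L ⊕ 1) ⊖ R, so these
-- permutations are binary trees; a 132-avoiding involution of length n is empty, or ends
-- with n, or has the form γ, n, β, γ⁻¹, j with γ a tree and β a smaller involution of the
-- same kind. Containment is taken between permutations regarded as sets of points with a
-- position order and a value order. Wedge patterns and their inverses are generated from
-- the empty pattern by p ↦ p ⊕ 1 and (p , q) ↦ (p ⊕ 1) ⊖ (q ⊕ 1), and for all of these of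
-- size k the trees avoiding them have the same generating function R_k, because the
-- addition formula
--   R_{j+p+1} (1 - x R_j - x R_p) = 1 - x R_j R_p
-- solves the recurrence coming from the tree decomposition. A double-wedge pattern
-- (K ⊕ 1) ⊖ (K⁻¹ ⊕ 1) occurs in γ, n, β, γ⁻¹, j exactly if K occurs in γ or the pattern
-- itself occurs in β. Hence I_τ = 1 + x I_τ + x² R_{l-1}(x²) I_τ, that is
-- I_τ (1 - x R_l(x²)) = R_l(x²). For 12…k the same decomposition gives
-- I_k = 1 + x I_{k-1} + x² R_{k-1}(x²) I_k, and the addition formula shows by induction
-- on l that I_{2l} satisfies the same equation as I_τ.

open import Algebra.Bundles using (CommutativeRing)
open import Algebra.Definitions using (Involutive)
import Algebra.Solver.Ring
open import Algebra.Solver.Ring.AlmostCommutativeRing using (fromCommutativeRing; _-Raw-AlmostCommutative⟶_)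
open import Data.Empty using (⊥; ⊥-elim)
open import Data.Fin as Fin using (Fin)
open import Data.Fin.Patterns using (0F; 1F; 2F)
open import Data.Fin.Permutation as Perm using (Permutation′; id; _⟨$⟩ʳ_; _⟨$⟩ˡ_; inverseˡ; inverseʳ)
import Data.Fin.Properties as Fin
open import Data.Integer as ℤ using (ℤ; 0ℤ; 1ℤ)
import Data.Integer.Properties as ℤ
import Data.Integer.Tactic.RingSolver as ℤ-Solver
open import Data.List using (List; []; _∷_; _++_; _∷ʳ_; map; filter; length; lookup; allFin; tabulate; applyUpTo; concat; concatMap; cartesianProductWith; initLast; _∷ʳ′_)
open import Data.List.Membership.Propositional using (_∈_)
open import Data.List.Membership.Propositional.Properties using (∈-map⁺; ∈-map⁻; ∈-++⁺ˡ; ∈-++⁺ʳ; ∈-++⁻; ∈-cartesianProductWith⁺; ∈-cartesianProductWith⁻; ∈-allFin; ∈-filter⁺; ∈-filter⁻; ∈-lookup; ∈-tabulate⁻; ∈-applyUpTo⁻)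
open import Data.List.Properties using (++-assoc; ++-identityʳ; applyUpTo-∷ʳ; length-applyUpTo; length-tabulate; length-++; map-tabulate)
open import Data.List.Relation.Binary.Permutation.Propositional.Properties using (∈-resp-↭)
open import Data.List.Relation.Unary.All as All using (All; []; _∷_)
open import Data.List.Relation.Unary.AllPairs as AllPairs using (AllPairs; []; _∷_)
import Data.List.Relation.Unary.AllPairs.Properties as AllPairs
open import Data.List.Relation.Unary.Any as Any using (here; there)
open import Data.List.Relation.Unary.Any.Properties using (lookup-index)
open import Data.List.Relation.Unary.Unique.Propositional using (Unique)
import Data.List.Relation.Unary.Unique.Propositional.Properties as Unique
open import Data.Maybe as Maybe using (Maybe)
open import Data.Nat as ℕ using (ℕ; zero; suc; _+_; _*_; _≤_; _<_; z≤n; s≤s)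
import Data.Nat.Properties as ℕ
import Data.Nat.Tactic.RingSolver as ℕ-Solver
open import Data.Product using (_×_; _,_; ∃; proj₁; proj₂)
open import Data.Sum as Sum using (_⊎_; inj₁; inj₂; [_,_])
open import Data.Unit using (⊤; tt)
open import Defs
open import Function using (_∘_; mk⇔; module Equivalence)
open import Level using (0ℓ)
open import Relation.Binary.Definitions using (tri<; tri≈; tri>; Asymmetric)
open import Relation.Binary.PropositionalEquality using (_≡_; _≢_; _≗_; refl; sym; trans; cong; cong₂; subst; subst₂; module ≡-Reasoning)
open import Relation.Nullary using (Dec; yes; no; ¬_; ¬?; contradiction; _×-dec_; _⊎-dec_)
open import Relation.Nullary.Decidable using (map′; dec⇒maybe)
open import Relation.Unary using (Decidable)
open import Algebra.Properties.AbelianGroup ℤ.+-0-abelianGroup using (∙-cancelʳ)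

-- Permutations as biposets

-- Two notions of sameness are kept apart. Patterns matter only up to mutual containment `≈ᴮ`, so
-- that wedge words, permutations and pattern terms can replace one another. The objects being
-- counted need genuine isomorphisms `≅`, because each involution must belong to exactly one tree.
--
-- What makes containment computable is that `K ⊕ 𝟙` has a point that is both last and largest. Such
-- a pattern cannot be spread over a skew sum, so every containment in a tree reduces to
-- containments in its subtrees.
--
-- The increasing pattern of length 2l does not fit the double-wedge scheme: it loses a point
-- whenever the involution ends with its largest entry. Its series therefore obey a recurrence that
-- links consecutive lengths, and the claimed closed form sits at the even indices.
--
-- Divisions never occur: equations between series are polynomial identities modulo the recurrences,
-- and a denominator is removed by cancelling a nonzero factor.

Rel₀ : Set → Set₁
Rel₀ A = A → A → Set

module _ {A B : Set} where
  _◁_ _▷_ : Rel₀ A → Rel₀ B → Rel₀ (A ⊎ B)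
  (R ◁ S) (inj₁ a) (inj₁ b) = R a b
  (R ◁ S) (inj₁ a) (inj₂ b) = ⊤
  (R ◁ S) (inj₂ a) (inj₁ b) = ⊥
  (R ◁ S) (inj₂ a) (inj₂ b) = S a b
  (R ▷ S) (inj₁ a) (inj₁ b) = R a b
  (R ▷ S) (inj₁ a) (inj₂ b) = ⊥
  (R ▷ S) (inj₂ a) (inj₁ b) = ⊤
  (R ▷ S) (inj₂ a) (inj₂ b) = S a b

  module _ {R : Rel₀ A} {S : Rel₀ B} where
    ◁-left : ∀ x {a} → (R ◁ S) x (inj₁ a) → ∃ λ a′ → x ≡ inj₁ a′
    ◁-left (inj₁ a′) _ = a′ , refl

    ▷-right : ∀ x {b} → (R ▷ S) x (inj₂ b) → ∃ λ b′ → x ≡ inj₂ b′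
    ▷-right (inj₂ b′) _ = b′ , refl

-- A permutation up to relabelling: its points, compared by position and by value.
record Biposet : Set₁ where
  field
    Carrier : Set
    Pos Val : Rel₀ Carrier

open Biposet

infixl 6 _⊕_ _⊖_
infix  8 _ᵀ
infix  4 _≼_ _≈ᴮ_ _≅_

𝟘 𝟙 : Biposet
𝟘 = record { Carrier = ⊥ ; Pos = λ _ _ → ⊥ ; Val = λ _ _ → ⊥ }
𝟙 = record { Carrier = ⊤ ; Pos = λ _ _ → ⊥ ; Val = λ _ _ → ⊥ }

_⊕_ _⊖_ : Biposet → Biposet → Biposet
A ⊕ B = record { Carrier = Carrier A ⊎ Carrier B ; Pos = Pos A ◁ Pos B ; Val = Val A ◁ Val B }
A ⊖ B = record { Carrier = Carrier A ⊎ Carrier B ; Pos = Pos A ◁ Pos B ; Val = Val A ▷ Val B }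

_ᵀ : Biposet → Biposet
A ᵀ = record { Carrier = Carrier A ; Pos = Val A ; Val = Pos A }

-- Preservation alone is asked for. Between linear orders it forces injectivity and reflection, so
-- on plots of injective maps this is ordinary containment (`≼⇒contains`).
record _≼_ (X Y : Biposet) : Set where
  field
    fun   : Carrier X → Carrier Y
    mono₁ : ∀ x y → Pos X x y → Pos Y (fun x) (fun y)
    mono₂ : ∀ x y → Val X x y → Val Y (fun x) (fun y)

open _≼_

≼-refl : ∀ {X} → X ≼ X
≼-refl = record { fun = λ x → x ; mono₁ = λ _ _ p → p ; mono₂ = λ _ _ p → p }

≼-trans : ∀ {X Y Z} → X ≼ Y → Y ≼ Z → X ≼ Z
≼-trans f g = record
  { fun   = fun g ∘ fun f
  ; mono₁ = λ x y p → mono₁ g _ _ (mono₁ f x y p)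
  ; mono₂ = λ x y p → mono₂ g _ _ (mono₂ f x y p)
  }

ᵀ-mono : ∀ {X Y} → X ≼ Y → X ᵀ ≼ Y ᵀ
ᵀ-mono f = record { fun = fun f ; mono₁ = mono₂ f ; mono₂ = mono₁ f }

𝟘-least : ∀ {X} → 𝟘 ≼ X
𝟘-least = record { fun = λ () ; mono₁ = λ () ; mono₂ = λ () }

module _ {A A′ B B′ : Biposet} (f : A ≼ A′) (g : B ≼ B′) where
  ⊕-mono : A ⊕ B ≼ A′ ⊕ B′
  ⊕-mono = record { fun = Sum.map (fun f) (fun g) ; mono₁ = m₁ ; mono₂ = m₂ }
    where
    m₁ : ∀ x y → Pos (A ⊕ B) x y → Pos (A′ ⊕ B′) (Sum.map (fun f) (fun g) x) (Sum.map (fun f) (fun g) y)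
    m₁ (inj₁ x) (inj₁ y) p = mono₁ f x y p
    m₁ (inj₁ x) (inj₂ y) p = tt
    m₁ (inj₂ x) (inj₂ y) p = mono₁ g x y p
    m₂ : ∀ x y → Val (A ⊕ B) x y → Val (A′ ⊕ B′) (Sum.map (fun f) (fun g) x) (Sum.map (fun f) (fun g) y)
    m₂ (inj₁ x) (inj₁ y) p = mono₂ f x y p
    m₂ (inj₁ x) (inj₂ y) p = tt
    m₂ (inj₂ x) (inj₂ y) p = mono₂ g x y p

  ⊖-mono : A ⊖ B ≼ A′ ⊖ B′
  ⊖-mono = record { fun = Sum.map (fun f) (fun g) ; mono₁ = m₁ ; mono₂ = m₂ }
    where
    m₁ : ∀ x y → Pos (A ⊖ B) x y → Pos (A′ ⊖ B′) (Sum.map (fun f) (fun g) x) (Sum.map (fun f) (fun g) y)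
    m₁ (inj₁ x) (inj₁ y) p = mono₁ f x y p
    m₁ (inj₁ x) (inj₂ y) p = tt
    m₁ (inj₂ x) (inj₂ y) p = mono₁ g x y p
    m₂ : ∀ x y → Val (A ⊖ B) x y → Val (A′ ⊖ B′) (Sum.map (fun f) (fun g) x) (Sum.map (fun f) (fun g) y)
    m₂ (inj₁ x) (inj₁ y) p = mono₂ f x y p
    m₂ (inj₂ x) (inj₁ y) p = tt
    m₂ (inj₂ x) (inj₂ y) p = mono₂ g x y p

-- Containment only depends on a pattern up to mutual containment.
_≈ᴮ_ : Biposet → Biposet → Set
X ≈ᴮ Y = X ≼ Y × Y ≼ X

≈ᴮ-refl : ∀ {X} → X ≈ᴮ X
≈ᴮ-refl = ≼-refl , ≼-refl

≈ᴮ-sym : ∀ {X Y} → X ≈ᴮ Y → Y ≈ᴮ X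
≈ᴮ-sym (f , g) = g , f

≈ᴮ-trans : ∀ {X Y Z} → X ≈ᴮ Y → Y ≈ᴮ Z → X ≈ᴮ Z
≈ᴮ-trans (f , g) (f′ , g′) = ≼-trans f f′ , ≼-trans g′ g

⊕-cong : ∀ {A A′ B B′} → A ≈ᴮ A′ → B ≈ᴮ B′ → A ⊕ B ≈ᴮ A′ ⊕ B′
⊕-cong (f , g) (f′ , g′) = ⊕-mono f f′ , ⊕-mono g g′

⊖-cong : ∀ {A A′ B B′} → A ≈ᴮ A′ → B ≈ᴮ B′ → A ⊖ B ≈ᴮ A′ ⊖ B′
⊖-cong (f , g) (f′ , g′) = ⊖-mono f f′ , ⊖-mono g g′

ᵀ-cong : ∀ {X Y} → X ≈ᴮ Y → X ᵀ ≈ᴮ Y ᵀ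
ᵀ-cong (f , g) = ᵀ-mono f , ᵀ-mono g

-- Models the inclusion of a summand: since both orders are reflected, a map that lands in the image
-- can be cut down to the summand (`factor`).
record Embedding (A Y : Biposet) : Set where
  field
    emb      : A ≼ Y
    inj      : ∀ {a b} → fun emb a ≡ fun emb b → a ≡ b
    reflect₁ : ∀ a b → Pos Y (fun emb a) (fun emb b) → Pos A a b
    reflect₂ : ∀ a b → Val Y (fun emb a) (fun emb b) → Val A a b

open Embedding

⊕-left : ∀ {A B} → Embedding A (A ⊕ B)
⊕-left = record
  { emb = record { fun = inj₁ ; mono₁ = λ _ _ p → p ; mono₂ = λ _ _ p → p }
  ; inj = λ { refl → refl } ; reflect₁ = λ _ _ p → p ; reflect₂ = λ _ _ p → p }

⊖-left : ∀ {A B} → Embedding A (A ⊖ B)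
⊖-left = record
  { emb = record { fun = inj₁ ; mono₁ = λ _ _ p → p ; mono₂ = λ _ _ p → p }
  ; inj = λ { refl → refl } ; reflect₁ = λ _ _ p → p ; reflect₂ = λ _ _ p → p }

⊖-right : ∀ {A B} → Embedding B (A ⊖ B)
⊖-right = record
  { emb = record { fun = inj₂ ; mono₁ = λ _ _ p → p ; mono₂ = λ _ _ p → p }
  ; inj = λ { refl → refl } ; reflect₁ = λ _ _ p → p ; reflect₂ = λ _ _ p → p }

Embedding-trans : ∀ {A B C} → Embedding A B → Embedding B C → Embedding A C
Embedding-trans i j = record
  { emb = ≼-trans (emb i) (emb j)
  ; inj = inj i ∘ inj j
  ; reflect₁ = λ a b p → reflect₁ i a b (reflect₁ j _ _ p)
  ; reflect₂ = λ a b p → reflect₂ i a b (reflect₂ j _ _ p) }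

Through : ∀ {X A Y} → X ≼ Y → Embedding A Y → Set
Through {X} {A} f i = (x : Carrier X) → ∃ λ (a : Carrier A) → fun f x ≡ fun (emb i) a

factor : ∀ {X A Y} (f : X ≼ Y) (i : Embedding A Y) → Through f i → X ≼ A
factor {X} {A} {Y} f i thr = record
  { fun   = proj₁ ∘ thr
  ; mono₁ = λ x y p → reflect₁ i _ _ (subst₂ (Pos Y) (proj₂ (thr x)) (proj₂ (thr y)) (mono₁ f x y p))
  ; mono₂ = λ x y p → reflect₂ i _ _ (subst₂ (Val Y) (proj₂ (thr x)) (proj₂ (thr y)) (mono₂ f x y p))
  }

◁∅-below : ∀ {A : Set} {R : Rel₀ A} (x y : A ⊎ ⊤) → (R ◁ λ _ _ → ⊥) x y → ∃ λ a → x ≡ inj₁ a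
◁∅-below (inj₁ a) y p = a , refl
◁∅-below (inj₂ _) (inj₁ _) ()
◁∅-below (inj₂ _) (inj₂ _) ()

-- The corner of `K ⊕ 𝟙` comes after every point of `K`, so no point of `K` can go to the final
-- point of `A ⊕ 𝟙`.
⊕𝟙-cancel : ∀ {K A} → K ⊕ 𝟙 ≼ A ⊕ 𝟙 → K ≼ A
⊕𝟙-cancel {A = A} f = factor (≼-trans (emb ⊕-left) f) ⊕-left
  (λ k → ◁∅-below {R = Pos A} (fun f (inj₁ k)) (fun f (inj₂ tt)) (mono₁ f (inj₁ k) (inj₂ tt) tt))

-- The image of the corner decides: if it lies in `A`, the points before it lie in `A` by position;
-- if it lies in `B`, the points below it lie in `B` by value.
⊕𝟙-indecomposable : ∀ {K A B} (f : K ⊕ 𝟙 ≼ A ⊖ B) → Through f ⊖-left ⊎ Through f ⊖-right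
⊕𝟙-indecomposable {A = A} {B} f with fun f (inj₂ tt) in eq
... | inj₁ a = inj₁ λ where
  (inj₁ k)  → ◁-left {R = Pos A} {Pos B} (fun f (inj₁ k))
    (subst (Pos (A ⊖ B) (fun f (inj₁ k))) eq (mono₁ f (inj₁ k) (inj₂ tt) tt))
  (inj₂ tt) → a , eq
... | inj₂ b = inj₂ λ where
  (inj₁ k)  → ▷-right {R = Val A} {Val B} (fun f (inj₁ k))
    (subst (Val (A ⊖ B) (fun f (inj₁ k))) eq (mono₂ f (inj₁ k) (inj₂ tt) tt))
  (inj₂ tt) → b , eq

⊕𝟙≼⊖ : ∀ {K A B} → K ⊕ 𝟙 ≼ A ⊖ B → K ⊕ 𝟙 ≼ A ⊎ K ⊕ 𝟙 ≼ B
⊕𝟙≼⊖ f = Sum.map (factor f ⊖-left) (factor f ⊖-right) (⊕𝟙-indecomposable f)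

module _ {K M : Biposet} where
  private
    twinᴮ : Biposet
    twinᴮ = (K ⊕ 𝟙) ⊖ (M ⊕ 𝟙)

  -- Each half is indecomposable and falls on one side. The first half on the right with the second
  -- on the left is excluded, because the corner of the first half comes earlier.
  twin≼⊖ : ∀ {A B} → twinᴮ ≼ A ⊖ B → twinᴮ ≼ A ⊎ twinᴮ ≼ B ⊎ (K ⊕ 𝟙 ≼ A × M ⊕ 𝟙 ≼ B)
  twin≼⊖ {A} {B} f
    with ⊕𝟙-indecomposable (≼-trans (emb ⊖-left) f) | ⊕𝟙-indecomposable (≼-trans (emb ⊖-right) f)
  ... | inj₁ l | inj₁ r = inj₁ (factor f ⊖-left [ l , r ])
  ... | inj₁ l | inj₂ r = inj₂ (inj₂ (factor (≼-trans (emb ⊖-left) f) ⊖-left l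
                                     , factor (≼-trans (emb ⊖-right) f) ⊖-right r))
  ... | inj₂ l | inj₂ r = inj₂ (inj₁ (factor f ⊖-right [ l , r ]))
  ... | inj₂ l | inj₁ r = ⊥-elim (subst₂ (Pos (A ⊖ B)) (proj₂ (l (inj₂ tt))) (proj₂ (r (inj₂ tt)))
                                   (mono₁ f (inj₁ (inj₂ tt)) (inj₂ (inj₂ tt)) tt))

  -- Every point of the pattern precedes its last point, except that point itself, which lies below
  -- the first corner in value. Hence none can go to a point that is both last and largest.
  twin≼⊕𝟙 : ∀ {A} → twinᴮ ≼ A ⊕ 𝟙 → twinᴮ ≼ A
  twin≼⊕𝟙 {A} f = factor f ⊕-left λ where
    (inj₁ x)         → ◁∅-below {R = Pos A} (fun f (inj₁ x)) (fun f (inj₂ (inj₂ tt)))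
      (mono₁ f (inj₁ x) (inj₂ (inj₂ tt)) tt)
    (inj₂ (inj₁ x))  → ◁∅-below {R = Pos A} (fun f (inj₂ (inj₁ x))) (fun f (inj₂ (inj₂ tt)))
      (mono₁ f (inj₂ (inj₁ x)) (inj₂ (inj₂ tt)) tt)
    (inj₂ (inj₂ tt)) → ◁∅-below {R = Val A} (fun f (inj₂ (inj₂ tt))) (fun f (inj₁ (inj₂ tt)))
      (mono₂ f (inj₂ (inj₂ tt)) (inj₁ (inj₂ tt)) tt)

-- Isomorphisms and uniqueness of decompositions

record _≅_ (X Y : Biposet) : Set where
  field
    to   : X ≼ Y
    from : Y ≼ X
    invˡ : ∀ x → fun from (fun to x) ≡ x
    invʳ : ∀ y → fun to (fun from y) ≡ y

open _≅_

≅-sym : ∀ {X Y} → X ≅ Y → Y ≅ X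
≅-sym f = record { to = from f ; from = to f ; invˡ = invʳ f ; invʳ = invˡ f }

≅-trans : ∀ {X Y Z} → X ≅ Y → Y ≅ Z → X ≅ Z
≅-trans f g = record
  { to = ≼-trans (to f) (to g) ; from = ≼-trans (from g) (from f)
  ; invˡ = λ x → trans (cong (fun (from f)) (invˡ g _)) (invˡ f x)
  ; invʳ = λ x → trans (cong (fun (to g)) (invʳ f _)) (invʳ g x) }

restrict : ∀ {X Y A B} (f : X ≅ Y) (i : Embedding A X) (j : Embedding B Y) →
           Through (≼-trans (emb i) (to f)) j → Through (≼-trans (emb j) (from f)) i → A ≅ B
restrict f i j u v = record
  { to = factor (≼-trans (emb i) (to f)) j u ; from = factor (≼-trans (emb j) (from f)) i v
  ; invˡ = λ a → inj i (trans (sym (proj₂ (v _)))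
             (trans (cong (fun (from f)) (sym (proj₂ (u a)))) (invˡ f _)))
  ; invʳ = λ b → inj j (trans (sym (proj₂ (u _)))
             (trans (cong (fun (to f)) (sym (proj₂ (v b)))) (invʳ f _)))
  }

⊖𝟘 : ∀ {X} → X ≅ X ⊖ 𝟘
⊖𝟘 = record
  { to = emb ⊖-left
  ; from = record { fun = λ { (inj₁ x) → x }
                  ; mono₁ = λ { (inj₁ _) (inj₁ _) p → p }
                  ; mono₂ = λ { (inj₁ _) (inj₁ _) p → p } }
  ; invˡ = λ _ → refl
  ; invʳ = λ { (inj₁ _) → refl } }

module _ {A B A′ B′ : Biposet} where
  private
    top-fixed : ∀ {A B A′ B′} (f : (A ⊕ 𝟙) ⊖ B ≅ (A′ ⊕ 𝟙) ⊖ B′) →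
                fun (to f) (inj₁ (inj₂ tt)) ≡ inj₁ (inj₂ tt)
    top-fixed {A} {B} {A′} {B′} f = go (fun (to f) (inj₁ (inj₂ tt))) refl
      where
      maximal : ∀ y → ¬ Val ((A ⊕ 𝟙) ⊖ B) (inj₁ (inj₂ tt)) y
      maximal (inj₁ (inj₁ _)) ()
      maximal (inj₁ (inj₂ _)) ()
      maximal (inj₂ _) ()
      not-below : ∀ y → fun (to f) (inj₁ (inj₂ tt)) ≡ y →
                  ¬ Val ((A′ ⊕ 𝟙) ⊖ B′) y (inj₁ (inj₂ tt))
      not-below y eq p = maximal (fun (from f) (inj₁ (inj₂ tt)))
        (subst (λ z → Val ((A ⊕ 𝟙) ⊖ B) z (fun (from f) (inj₁ (inj₂ tt))))
          (trans (cong (fun (from f)) (sym eq)) (invˡ f _))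
          (mono₂ (from f) y (inj₁ (inj₂ tt)) p))
      go : ∀ y → fun (to f) (inj₁ (inj₂ tt)) ≡ y → y ≡ inj₁ (inj₂ tt)
      go (inj₁ (inj₁ a))  eq = ⊥-elim (not-below _ eq tt)
      go (inj₁ (inj₂ tt)) eq = refl
      go (inj₂ b)         eq = ⊥-elim (not-below _ eq tt)

    before-top : ∀ {A B A′ B′} (f : (A ⊕ 𝟙) ⊖ B ≅ (A′ ⊕ 𝟙) ⊖ B′) a →
                 ∃ λ a′ → fun (to f) (inj₁ (inj₁ a)) ≡ inj₁ (inj₁ a′)
    before-top {A′ = A′} {B′} f a = go (fun (to f) (inj₁ (inj₁ a)))
      (subst (Pos ((A′ ⊕ 𝟙) ⊖ B′) (fun (to f) (inj₁ (inj₁ a)))) (top-fixed f)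
        (mono₁ (to f) (inj₁ (inj₁ a)) (inj₁ (inj₂ tt)) tt))
      where
      go : ∀ y → Pos ((A′ ⊕ 𝟙) ⊖ B′) y (inj₁ (inj₂ tt)) → ∃ λ a′ → y ≡ inj₁ (inj₁ a′)
      go (inj₁ (inj₁ a′)) _ = a′ , refl

    after-top : ∀ {A B A′ B′} (f : (A ⊕ 𝟙) ⊖ B ≅ (A′ ⊕ 𝟙) ⊖ B′) b →
                ∃ λ b′ → fun (to f) (inj₂ b) ≡ inj₂ b′
    after-top {A′ = A′} {B′} f b = go (fun (to f) (inj₂ b))
      (subst (λ z → Pos ((A′ ⊕ 𝟙) ⊖ B′) z (fun (to f) (inj₂ b))) (top-fixed f)
        (mono₁ (to f) (inj₁ (inj₂ tt)) (inj₂ b) tt))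
      where
      go : ∀ y → Pos ((A′ ⊕ 𝟙) ⊖ B′) (inj₁ (inj₂ tt)) y → ∃ λ b′ → y ≡ inj₂ b′
      go (inj₁ (inj₁ _)) ()
      go (inj₁ (inj₂ _)) ()
      go (inj₂ b′) _ = b′ , refl

  -- An isomorphism preserves the only point with nothing above it in value, and the two parts are
  -- the points before and after that one.
  ⊕𝟙⊖-cancel : (A ⊕ 𝟙) ⊖ B ≅ (A′ ⊕ 𝟙) ⊖ B′ → A ≅ A′ × B ≅ B′
  ⊕𝟙⊖-cancel f =
      restrict f (Embedding-trans ⊕-left ⊖-left) (Embedding-trans ⊕-left ⊖-left)
        (before-top f) (before-top (≅-sym f))
    , restrict f ⊖-right ⊖-right (after-top f) (after-top (≅-sym f))

⊕𝟙-≅-cancel : ∀ {A A′} → A ⊕ 𝟙 ≅ A′ ⊕ 𝟙 → A ≅ A′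
⊕𝟙-≅-cancel f = proj₁ (⊕𝟙⊖-cancel (≅-trans (≅-trans (≅-sym ⊖𝟘) f) ⊖𝟘))

module _ {A B A′ B′ : Biposet} where
  private
    last-fixed : ∀ {A B A′ B′} (f : A ⊖ (B ⊕ 𝟙) ≅ A′ ⊖ (B′ ⊕ 𝟙)) →
                 fun (to f) (inj₂ (inj₂ tt)) ≡ inj₂ (inj₂ tt)
    last-fixed {A} {B} {A′} {B′} f = go (fun (to f) (inj₂ (inj₂ tt))) refl
      where
      maximal : ∀ y → ¬ Pos (A ⊖ (B ⊕ 𝟙)) (inj₂ (inj₂ tt)) y
      maximal (inj₁ _) ()
      maximal (inj₂ (inj₁ _)) ()
      maximal (inj₂ (inj₂ _)) ()
      not-before : ∀ y → fun (to f) (inj₂ (inj₂ tt)) ≡ y →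
                   ¬ Pos (A′ ⊖ (B′ ⊕ 𝟙)) y (inj₂ (inj₂ tt))
      not-before y eq p = maximal (fun (from f) (inj₂ (inj₂ tt)))
        (subst (λ z → Pos (A ⊖ (B ⊕ 𝟙)) z (fun (from f) (inj₂ (inj₂ tt))))
          (trans (cong (fun (from f)) (sym eq)) (invˡ f _))
          (mono₁ (from f) y (inj₂ (inj₂ tt)) p))
      go : ∀ y → fun (to f) (inj₂ (inj₂ tt)) ≡ y → y ≡ inj₂ (inj₂ tt)
      go (inj₁ a)         eq = ⊥-elim (not-before _ eq tt)
      go (inj₂ (inj₁ b))  eq = ⊥-elim (not-before _ eq tt)
      go (inj₂ (inj₂ tt)) eq = refl

    above-last : ∀ {A B A′ B′} (f : A ⊖ (B ⊕ 𝟙) ≅ A′ ⊖ (B′ ⊕ 𝟙)) a →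
                 ∃ λ a′ → fun (to f) (inj₁ a) ≡ inj₁ a′
    above-last {A′ = A′} {B′} f a = go (fun (to f) (inj₁ a))
      (subst (λ z → Val (A′ ⊖ (B′ ⊕ 𝟙)) z (fun (to f) (inj₁ a))) (last-fixed f)
        (mono₂ (to f) (inj₂ (inj₂ tt)) (inj₁ a) tt))
      where
      go : ∀ y → Val (A′ ⊖ (B′ ⊕ 𝟙)) (inj₂ (inj₂ tt)) y → ∃ λ a′ → y ≡ inj₁ a′
      go (inj₁ a′) _ = a′ , refl
      go (inj₂ (inj₁ _)) ()
      go (inj₂ (inj₂ _)) ()

  -- The last point is preserved, and the left part consists of the points above it. Comparing left
  -- parts is enough for `inv-rigid`, since in an arc the right part mirrors a tree found in the
  -- left part.
  ⊖⊕𝟙-cancelˡ : A ⊖ (B ⊕ 𝟙) ≅ A′ ⊖ (B′ ⊕ 𝟙) → A ≅ A′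
  ⊖⊕𝟙-cancelˡ f = restrict f ⊖-left ⊖-left (above-last f) (above-last (≅-sym f))

-- Trees of 132-avoiding permutations and involutions

-- node L R stands for (L ⊕ 1) ⊖ R, the decomposition of a 132-avoiding
-- permutation around its largest entry.
data Tree : Set where
  leaf : Tree
  node : Tree → Tree → Tree

⟦_⟧ᵗ : Tree → Biposet
⟦ leaf ⟧ᵗ     = 𝟘
⟦ node L R ⟧ᵗ = (⟦ L ⟧ᵗ ⊕ 𝟙) ⊖ ⟦ R ⟧ᵗ

-- Twice the number of points, since in an involution the points of a tree
-- occur together with their mirror images.
weight : Tree → ℕ
weight leaf       = 0
weight (node L R) = 2 + (weight L + weight R)

-- A 132-avoiding involution ends with its largest entry, or sends its last
-- position to some p and splits as γ, n, β, γ⁻¹, p.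
data InvTree : Set where
  ε   : InvTree
  fix : InvTree → InvTree
  arc : Tree → InvTree → InvTree

⟦_⟧ⁱ : InvTree → Biposet
⟦ ε ⟧ⁱ       = 𝟘
⟦ fix b ⟧ⁱ   = ⟦ b ⟧ⁱ ⊕ 𝟙
⟦ arc g b ⟧ⁱ = ((⟦ g ⟧ᵗ ⊕ 𝟙) ⊖ ⟦ b ⟧ⁱ) ⊖ (⟦ g ⟧ᵗ ᵀ ⊕ 𝟙)

size : InvTree → ℕ
size ε         = 0
size (fix b)   = 1 + size b
size (arc g b) = 2 + (weight g + size b)

-- Reflection of the plot in the diagonal: γ is exchanged with γ⁻¹ and the largest entry with the
-- last one. It turns value order into position order (`mirror-Val`), so it is the involution
-- itself, acting on points.
mirror : ∀ t → Carrier ⟦ t ⟧ⁱ → Carrier ⟦ t ⟧ⁱ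
mirror (fix b)   (inj₁ x)                = inj₁ (mirror b x)
mirror (fix b)   (inj₂ tt)               = inj₂ tt
mirror (arc g b) (inj₁ (inj₁ (inj₁ x)))  = inj₂ (inj₁ x)
mirror (arc g b) (inj₁ (inj₁ (inj₂ tt))) = inj₂ (inj₂ tt)
mirror (arc g b) (inj₁ (inj₂ y))         = inj₁ (inj₂ (mirror b y))
mirror (arc g b) (inj₂ (inj₁ x))         = inj₁ (inj₁ (inj₁ x))
mirror (arc g b) (inj₂ (inj₂ tt))        = inj₁ (inj₁ (inj₂ tt))

mirror-involutive : ∀ t x → mirror t (mirror t x) ≡ x
mirror-involutive (fix b)   (inj₁ x)                = cong inj₁ (mirror-involutive b x)
mirror-involutive (fix b)   (inj₂ tt)               = refl
mirror-involutive (arc g b) (inj₁ (inj₁ (inj₁ x)))  = refl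
mirror-involutive (arc g b) (inj₁ (inj₁ (inj₂ tt))) = refl
mirror-involutive (arc g b) (inj₁ (inj₂ y))         = cong (inj₁ ∘ inj₂) (mirror-involutive b y)
mirror-involutive (arc g b) (inj₂ (inj₁ x))         = refl
mirror-involutive (arc g b) (inj₂ (inj₂ tt))        = refl

mirror-Val : ∀ t x y → Val ⟦ t ⟧ⁱ x y → Pos ⟦ t ⟧ⁱ (mirror t x) (mirror t y)
mirror-Val (fix b) (inj₁ x) (inj₁ y) p = mirror-Val b x y p
mirror-Val (fix b) (inj₁ x) (inj₂ y) p = tt
mirror-Val (arc g b) (inj₁ (inj₁ (inj₁ x))) (inj₁ (inj₁ (inj₁ y))) p = p
mirror-Val (arc g b) (inj₁ (inj₁ (inj₁ x))) (inj₁ (inj₁ (inj₂ y))) p = tt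
mirror-Val (arc g b) (inj₁ (inj₂ x)) (inj₁ (inj₁ (inj₁ y))) p = tt
mirror-Val (arc g b) (inj₁ (inj₂ x)) (inj₁ (inj₁ (inj₂ y))) p = tt
mirror-Val (arc g b) (inj₁ (inj₂ x)) (inj₁ (inj₂ y)) p = mirror-Val b x y p
mirror-Val (arc g b) (inj₂ (inj₁ x)) (inj₁ (inj₁ (inj₁ y))) p = tt
mirror-Val (arc g b) (inj₂ (inj₁ x)) (inj₁ (inj₁ (inj₂ y))) p = tt
mirror-Val (arc g b) (inj₂ (inj₁ x)) (inj₁ (inj₂ y)) p = tt
mirror-Val (arc g b) (inj₂ (inj₁ x)) (inj₂ (inj₁ y)) p = p
mirror-Val (arc g b) (inj₂ (inj₁ x)) (inj₂ (inj₂ y)) p = tt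
mirror-Val (arc g b) (inj₂ (inj₂ tt)) (inj₁ (inj₁ (inj₁ y))) p = tt
mirror-Val (arc g b) (inj₂ (inj₂ tt)) (inj₁ (inj₁ (inj₂ y))) p = tt
mirror-Val (arc g b) (inj₂ (inj₂ tt)) (inj₁ (inj₂ y)) p = tt
mirror-Val (arc g b) (inj₂ (inj₂ tt)) (inj₂ (inj₁ y)) ()
mirror-Val (arc g b) (inj₂ (inj₂ tt)) (inj₂ (inj₂ y)) ()

-- Linear orders and ranks of points

Connex : ∀ {A : Set} → Rel₀ A → Set
Connex R = ∀ x y → x ≡ y ⊎ R x y ⊎ R y x

module _ {A B : Set} {R : Rel₀ A} {S : Rel₀ B} (r : Connex R) (s : Connex S) where
  ◁-connex : Connex (R ◁ S)
  ◁-connex (inj₁ x) (inj₁ y) = Sum.map₁ (cong inj₁) (r x y)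
  ◁-connex (inj₁ x) (inj₂ y) = inj₂ (inj₁ tt)
  ◁-connex (inj₂ x) (inj₁ y) = inj₂ (inj₂ tt)
  ◁-connex (inj₂ x) (inj₂ y) = Sum.map₁ (cong inj₂) (s x y)

  ▷-connex : Connex (R ▷ S)
  ▷-connex (inj₁ x) (inj₁ y) = Sum.map₁ (cong inj₁) (r x y)
  ▷-connex (inj₁ x) (inj₂ y) = inj₂ (inj₂ tt)
  ▷-connex (inj₂ x) (inj₁ y) = inj₂ (inj₁ tt)
  ▷-connex (inj₂ x) (inj₂ y) = Sum.map₁ (cong inj₂) (s x y)

𝟙-connex : Connex (Pos 𝟙)
𝟙-connex tt tt = inj₁ refl

record Total (X : Biposet) : Set where
  field
    pos-connex : Connex (Pos X)
    val-connex : Connex (Val X)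

open Total

𝟘-total : Total 𝟘
𝟘-total = record { pos-connex = λ () ; val-connex = λ () }

𝟙-total : Total 𝟙
𝟙-total = record { pos-connex = 𝟙-connex ; val-connex = 𝟙-connex }

ᵀ-total : ∀ {A} → Total A → Total (A ᵀ)
ᵀ-total a = record { pos-connex = val-connex a ; val-connex = pos-connex a }

module _ {A B : Biposet} (a : Total A) (b : Total B) where
  ⊕-total : Total (A ⊕ B)
  ⊕-total = record
    { pos-connex = ◁-connex (pos-connex a) (pos-connex b)
    ; val-connex = ◁-connex (val-connex a) (val-connex b) }

  ⊖-total : Total (A ⊖ B)
  ⊖-total = record
    { pos-connex = ◁-connex (pos-connex a) (pos-connex b)
    ; val-connex = ▷-connex (val-connex a) (val-connex b) }

tree-total : ∀ t → Total ⟦ t ⟧ᵗ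
tree-total leaf       = 𝟘-total
tree-total (node L R) = ⊖-total (⊕-total (tree-total L) 𝟙-total) (tree-total R)

inv-total : ∀ t → Total ⟦ t ⟧ⁱ
inv-total ε         = 𝟘-total
inv-total (fix b)   = ⊕-total (inv-total b) 𝟙-total
inv-total (arc g b) =
  ⊖-total (⊖-total (⊕-total (tree-total g) 𝟙-total) (inv-total b))
          (⊕-total (ᵀ-total (tree-total g)) 𝟙-total)

-- Numbers the points in increasing order, which turns a tree into a map on `Fin n`. Injectivity
-- follows when `R` is connex.
record Ranking {A : Set} (R : Rel₀ A) (n : ℕ) : Set where
  field
    rank   : A → Fin n
    rank-< : ∀ x y → R x y → rank x Fin.< rank y
    onto   : ∀ i → ∃ λ x → rank x ≡ i

open Ranking

∅-ranking : ∀ {R : Rel₀ ⊥} → Ranking R 0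
∅-ranking = record { rank = λ () ; rank-< = λ () ; onto = λ () }

𝟙-ranking : Ranking (Pos 𝟙) 1
𝟙-ranking = record { rank = λ _ → Fin.zero ; rank-< = λ _ _ () ; onto = λ { Fin.zero → tt , refl } }

module _ {A B : Set} {R : Rel₀ A} {S : Rel₀ B} {m n : ℕ} where
  ◁-ranking : Ranking R m → Ranking S n → Ranking (R ◁ S) (m + n)
  ◁-ranking r s = record { rank = rk ; rank-< = rk-< ; onto = on }
    where
    rk : A ⊎ B → Fin (m + n)
    rk (inj₁ x) = rank r x Fin.↑ˡ n
    rk (inj₂ y) = m Fin.↑ʳ rank s y
    rk-< : ∀ x y → (R ◁ S) x y → rk x Fin.< rk y
    rk-< (inj₁ x) (inj₁ y) p =
      subst₂ _<_ (sym (Fin.toℕ-↑ˡ _ n)) (sym (Fin.toℕ-↑ˡ _ n)) (rank-< r x y p)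
    rk-< (inj₁ x) (inj₂ y) p =
      subst₂ _<_ (sym (Fin.toℕ-↑ˡ _ n)) (sym (Fin.toℕ-↑ʳ m _))
        (ℕ.<-≤-trans (Fin.toℕ<n (rank r x)) (ℕ.m≤m+n m _))
    rk-< (inj₂ x) (inj₂ y) p =
      subst₂ _<_ (sym (Fin.toℕ-↑ʳ m _)) (sym (Fin.toℕ-↑ʳ m _)) (ℕ.+-monoʳ-< m (rank-< s x y p))
    on : ∀ i → ∃ λ x → rk x ≡ i
    on i with Fin.splitAt m i in eq
    ... | inj₁ j = inj₁ (proj₁ (onto r j)) ,
          trans (cong (Fin._↑ˡ n) (proj₂ (onto r j))) (Fin.splitAt⁻¹-↑ˡ eq)
    ... | inj₂ j = inj₂ (proj₁ (onto s j)) ,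
          trans (cong (m Fin.↑ʳ_) (proj₂ (onto s j))) (Fin.splitAt⁻¹-↑ʳ eq)

▷-ranking : ∀ {A B : Set} {R : Rel₀ A} {S : Rel₀ B} {m n} →
            Ranking R m → Ranking S n → Ranking (R ▷ S) (n + m)
▷-ranking {A} {B} {R} {S} {m} {n} r s = record
  { rank   = rank sr ∘ Sum.swap
  ; rank-< = λ where
      (inj₁ x) (inj₁ y) p  → rank-< sr (inj₂ x) (inj₂ y) p
      (inj₂ x) (inj₁ y) p  → rank-< sr (inj₁ x) (inj₂ y) p
      (inj₂ x) (inj₂ y) p  → rank-< sr (inj₁ x) (inj₁ y) p
  ; onto   = on
  }
  where
  sr = ◁-ranking s r
  on : ∀ i → ∃ λ x → rank sr (Sum.swap x) ≡ i
  on i with onto sr i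
  ... | inj₁ x , eq = inj₂ x , eq
  ... | inj₂ y , eq = inj₁ y , eq

points : Tree → ℕ
points leaf       = 0
points (node L R) = points L + 1 + points R

weight≡2*points : ∀ t → weight t ≡ points t + points t
weight≡2*points leaf = refl
weight≡2*points (node L R) rewrite weight≡2*points L | weight≡2*points R = arith (points L) (points R)
  where
  arith : ∀ l r → 2 + (l + l + (r + r)) ≡ l + 1 + r + (l + 1 + r)
  arith = ℕ-Solver.solve-∀

pos-ranking : ∀ t → Ranking (Pos ⟦ t ⟧ᵗ) (points t)
pos-ranking leaf       = ∅-ranking
pos-ranking (node L R) = ◁-ranking (◁-ranking (pos-ranking L) 𝟙-ranking) (pos-ranking R)

-- Positions in γ⁻¹ are values of γ, so `inv-ranking` has to rank trees by value as well as by
-- position.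
val-ranking : ∀ t → Ranking (Val ⟦ t ⟧ᵗ) (points t)
val-ranking leaf       = ∅-ranking
val-ranking (node L R) = subst (Ranking _) (ℕ.+-comm (points R) _)
  (▷-ranking (◁-ranking (val-ranking L) 𝟙-ranking) (val-ranking R))

inv-ranking : ∀ t → Ranking (Pos ⟦ t ⟧ⁱ) (size t)
inv-ranking ε         = ∅-ranking
inv-ranking (fix b)   = subst (Ranking _) (ℕ.+-comm (size b) 1) (◁-ranking (inv-ranking b) 𝟙-ranking)
inv-ranking (arc g b) = subst (Ranking _) eq
  (◁-ranking (◁-ranking (◁-ranking (pos-ranking g) 𝟙-ranking) (inv-ranking b))
             (◁-ranking (val-ranking g) 𝟙-ranking))
  where
  arith : ∀ p s → p + 1 + s + (p + 1) ≡ 2 + (p + p + s)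
  arith = ℕ-Solver.solve-∀
  eq : points g + 1 + size b + (points g + 1) ≡ size (arc g b)
  eq = trans (arith (points g) (size b)) (cong (λ w → 2 + (w + size b)) (sym (weight≡2*points g)))

-- Avoidance of 132 and rigidity of trees

Av132 : Biposet → Set
Av132 X = ∀ a b c → Pos X a b → Pos X b c → Val X a c → Val X c b → ⊥

Av132-ᵀ : ∀ {X} → Av132 X → Av132 (X ᵀ)
Av132-ᵀ av a b c p q r s = av a c b r s p q

Av132-⊕𝟙 : ∀ {X} → Av132 X → Av132 (X ⊕ 𝟙)
Av132-⊕𝟙 av (inj₁ a) (inj₁ b) (inj₁ c) p q r s = av a b c p q r s
Av132-⊕𝟙 av a (inj₁ b) (inj₂ c) p q r ()
Av132-⊕𝟙 av a (inj₂ b) (inj₂ c) p q r ()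

Av132-⊖ : ∀ {X Y} → Av132 X → Av132 Y → Av132 (X ⊖ Y)
Av132-⊖ av av′ (inj₁ a) (inj₁ b) (inj₁ c) p q r s = av a b c p q r s
Av132-⊖ av av′ (inj₂ a) (inj₂ b) (inj₂ c) p q r s = av′ a b c p q r s

Av132-𝟘 : Av132 𝟘
Av132-𝟘 ()

tree-Av132 : ∀ t → Av132 ⟦ t ⟧ᵗ
tree-Av132 leaf       = Av132-𝟘
tree-Av132 (node L R) = Av132-⊖ (Av132-⊕𝟙 (tree-Av132 L)) (tree-Av132 R)

inv-Av132 : ∀ t → Av132 ⟦ t ⟧ⁱ
inv-Av132 ε         = Av132-𝟘
inv-Av132 (fix b)   = Av132-⊕𝟙 (inv-Av132 b)
inv-Av132 (arc g b) =
  Av132-⊖ (Av132-⊖ (Av132-⊕𝟙 (tree-Av132 g)) (inv-Av132 b)) (Av132-⊕𝟙 (Av132-ᵀ (tree-Av132 g)))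

tree-rigid : ∀ s t → ⟦ s ⟧ᵗ ≅ ⟦ t ⟧ᵗ → s ≡ t
tree-rigid leaf       leaf         f = refl
tree-rigid leaf       (node _ _)   f = ⊥-elim (fun (from f) (inj₁ (inj₂ tt)))
tree-rigid (node _ _) leaf         f = ⊥-elim (fun (to f) (inj₁ (inj₂ tt)))
tree-rigid (node L R) (node L′ R′) f =
  let g , h = ⊕𝟙⊖-cancel f in cong₂ node (tree-rigid L L′ g) (tree-rigid R R′ h)

-- The added point of `A ⊕ 𝟙` is last and largest at once, while on the other side the largest point
-- and the last point are different.
fix≇arc : ∀ {A B C D} → ¬ (A ⊕ 𝟙 ≅ ((B ⊕ 𝟙) ⊖ C) ⊖ (D ⊕ 𝟙))
fix≇arc {A} {B} {C} {D} f = contra (dominated max) (dominated last)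
  where
  Y = ((B ⊕ 𝟙) ⊖ C) ⊖ (D ⊕ 𝟙)
  max last corner : Carrier Y
  max    = inj₁ (inj₁ (inj₂ tt))
  last   = inj₂ (inj₂ tt)
  corner = fun (to f) (inj₂ tt)
  dominated : ∀ y → y ≡ corner ⊎ (Pos Y y corner × Val Y y corner)
  dominated y with fun (from f) y in eq
  ... | inj₁ a  = inj₂ (subst (λ z → Pos Y z corner) y≡ (mono₁ (to f) (inj₁ a) (inj₂ tt) tt)
                       , subst (λ z → Val Y z corner) y≡ (mono₂ (to f) (inj₁ a) (inj₂ tt) tt))
    where y≡ = trans (cong (fun (to f)) (sym eq)) (invʳ f y)
  ... | inj₂ tt = inj₁ (trans (sym (invʳ f y)) (cong (fun (to f)) eq))
  max-maximal : ∀ y → ¬ Val Y max y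
  max-maximal (inj₁ (inj₁ (inj₁ _))) ()
  max-maximal (inj₁ (inj₁ (inj₂ _))) ()
  max-maximal (inj₁ (inj₂ _)) ()
  max-maximal (inj₂ _) ()
  last-maximal : ∀ y → ¬ Pos Y last y
  last-maximal (inj₁ _) ()
  last-maximal (inj₂ (inj₁ _)) ()
  last-maximal (inj₂ (inj₂ _)) ()
  contra : max ≡ corner ⊎ (Pos Y max corner × Val Y max corner) →
           last ≡ corner ⊎ (Pos Y last corner × Val Y last corner) → ⊥
  contra (inj₂ (_ , v)) _ = max-maximal corner v
  contra (inj₁ _) (inj₂ (p , _)) = last-maximal corner p
  contra (inj₁ e) (inj₁ e′) with trans e (sym e′)
  ... | ()

inv-rigid : ∀ s t → ⟦ s ⟧ⁱ ≅ ⟦ t ⟧ⁱ → s ≡ t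
inv-rigid ε         ε           f = refl
inv-rigid ε         (fix _)     f = ⊥-elim (fun (from f) (inj₂ tt))
inv-rigid ε         (arc _ _)   f = ⊥-elim (fun (from f) (inj₂ (inj₂ tt)))
inv-rigid (fix _)   ε           f = ⊥-elim (fun (to f) (inj₂ tt))
inv-rigid (arc _ _) ε           f = ⊥-elim (fun (to f) (inj₂ (inj₂ tt)))
inv-rigid (fix b)   (fix b′)    f = cong fix (inv-rigid b b′ (⊕𝟙-≅-cancel f))
inv-rigid (fix b)   (arc g b′)  f = ⊥-elim (fix≇arc f)
inv-rigid (arc g b) (fix b′)    f = ⊥-elim (fix≇arc (≅-sym f))
inv-rigid (arc g b) (arc g′ b′) f =
  let h , k = ⊕𝟙⊖-cancel (⊖⊕𝟙-cancelˡ f) in cong₂ arc (tree-rigid g g′ h) (inv-rigid b b′ k)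

-- Decomposition of 132-avoiding involutions

Plot : (ℕ → ℕ) → Biposet
Plot f = record { Carrier = ℕ ; Pos = _<_ ; Val = λ i j → f i < f j }

FinPlot : ∀ {m n} → (Fin m → Fin n) → Biposet
FinPlot {m} f = record { Carrier = Fin m ; Pos = Fin._<_ ; Val = λ i j → f i Fin.< f j }

-- Charts a part of one fixed plot, so that subpermutations on intervals are treated in place,
-- without renumbering positions and values.
record Cover (X Y : Biposet) (P : Carrier Y → Set) : Set where
  field
    chart  : X ≼ Y
    inside : ∀ x → P (fun chart x)
    covers : ∀ y → P y → ∃ λ x → fun chart x ≡ y

open Cover

cover-resp : ∀ {X Y P Q} → (∀ y → P y → Q y) → (∀ y → Q y → P y) → Cover X Y P → Cover X Y Q
cover-resp p q c = record
  { chart = chart c ; inside = λ x → p _ (inside c x) ; covers = λ y Qy → covers c y (q y Qy) }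

cover-𝟘 : ∀ {Y P} → (∀ y → ¬ P y) → Cover 𝟘 Y P
cover-𝟘 ¬P = record { chart = 𝟘-least ; inside = λ () ; covers = λ y Py → contradiction Py (¬P y) }

module _ {Y : Biposet} {P : Carrier Y → Set} where
  cover-⊕𝟙 : ∀ {A} → Cover A Y P → ∀ m → (∀ i → P i → Pos Y i m × Val Y i m) →
             Cover (A ⊕ 𝟙) Y (λ i → P i ⊎ i ≡ m)
  cover-⊕𝟙 {A} c m below = record
    { chart = record { fun = f ; mono₁ = m₁ ; mono₂ = m₂ }
    ; inside = λ { (inj₁ a) → inj₁ (inside c a) ; (inj₂ _) → inj₂ refl }
    ; covers = λ where
        y (inj₁ Py)   → let a , eq = covers c y Py in inj₁ a , eq
        y (inj₂ refl) → inj₂ tt , refl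
    }
    where
    f : Carrier (A ⊕ 𝟙) → Carrier Y
    f (inj₁ a) = fun (chart c) a
    f (inj₂ _) = m
    m₁ : ∀ x y → Pos (A ⊕ 𝟙) x y → Pos Y (f x) (f y)
    m₁ (inj₁ a) (inj₁ b) p = mono₁ (chart c) a b p
    m₁ (inj₁ a) (inj₂ _) p = proj₁ (below _ (inside c a))
    m₂ : ∀ x y → Val (A ⊕ 𝟙) x y → Val Y (f x) (f y)
    m₂ (inj₁ a) (inj₁ b) p = mono₂ (chart c) a b p
    m₂ (inj₁ a) (inj₂ _) p = proj₂ (below _ (inside c a))

  cover-⊖ : ∀ {A B Q} → Cover A Y P → Cover B Y Q → (∀ i j → P i → Q j → Pos Y i j × Val Y j i) →
            Cover (A ⊖ B) Y (λ i → P i ⊎ Q i)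
  cover-⊖ {A} {B} c d above = record
    { chart = record { fun = f ; mono₁ = m₁ ; mono₂ = m₂ }
    ; inside = λ { (inj₁ a) → inj₁ (inside c a) ; (inj₂ b) → inj₂ (inside d b) }
    ; covers = λ where
        y (inj₁ Py) → let a , eq = covers c y Py in inj₁ a , eq
        y (inj₂ Qy) → let b , eq = covers d y Qy in inj₂ b , eq
    }
    where
    f : Carrier (A ⊖ B) → Carrier Y
    f (inj₁ a) = fun (chart c) a
    f (inj₂ b) = fun (chart d) b
    m₁ : ∀ x y → Pos (A ⊖ B) x y → Pos Y (f x) (f y)
    m₁ (inj₁ a) (inj₁ b) p = mono₁ (chart c) a b p
    m₁ (inj₁ a) (inj₂ b) p = proj₁ (above _ _ (inside c a) (inside d b))
    m₁ (inj₂ a) (inj₂ b) p = mono₁ (chart d) a b p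
    m₂ : ∀ x y → Val (A ⊖ B) x y → Val Y (f x) (f y)
    m₂ (inj₁ a) (inj₁ b) p = mono₂ (chart c) a b p
    m₂ (inj₂ a) (inj₁ b) p = proj₂ (above _ _ (inside c b) (inside d a))
    m₂ (inj₂ a) (inj₂ b) p = mono₂ (chart d) a b p

module _ {X Y : Biposet} (total : Total X)
         (asym₁ : Asymmetric (Pos Y)) (asym₂ : Asymmetric (Val Y)) where

  -- The inverse is monotone because `X` is total: an equal or reversed pair in `X` would be carried
  -- to a pair contradicting the asymmetry of `Y`.
  cover⇒≅ : ∀ {P} → (∀ y → P y) → Cover X Y P → X ≅ Y
  cover⇒≅ all c = record
    { to = chart c ; from = record { fun = g ; mono₁ = m₁ ; mono₂ = m₂ }
    ; invˡ = invˡ′ ; invʳ = gʳ }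
    where
    g : Carrier Y → Carrier X
    g y = proj₁ (covers c y (all y))
    gʳ : ∀ y → fun (chart c) (g y) ≡ y
    gʳ y = proj₂ (covers c y (all y))
    m₁ : ∀ x y → Pos Y x y → Pos X (g x) (g y)
    m₁ x y p with pos-connex total (g x) (g y)
    ... | inj₂ (inj₁ q) = q
    ... | inj₁ e = contradiction p (λ p → asym₁ p (subst₂ (Pos Y) x≡y (sym x≡y) p))
      where x≡y = trans (sym (gʳ x)) (trans (cong (fun (chart c)) e) (gʳ y))
    ... | inj₂ (inj₂ q) = ⊥-elim (asym₁ p (subst₂ (Pos Y) (gʳ y) (gʳ x) (mono₁ (chart c) _ _ q)))
    m₂ : ∀ x y → Val Y x y → Val X (g x) (g y)
    m₂ x y p with val-connex total (g x) (g y)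
    ... | inj₂ (inj₁ q) = q
    ... | inj₁ e = contradiction p (λ p → asym₂ p (subst₂ (Val Y) x≡y (sym x≡y) p))
      where x≡y = trans (sym (gʳ x)) (trans (cong (fun (chart c)) e) (gʳ y))
    ... | inj₂ (inj₂ q) = ⊥-elim (asym₂ p (subst₂ (Val Y) (gʳ y) (gʳ x) (mono₂ (chart c) _ _ q)))
    invˡ′ : ∀ x → g (fun (chart c) x) ≡ x
    invˡ′ x with pos-connex total (g (fun (chart c) x)) x
    ... | inj₁ e = e
    ... | inj₂ (inj₁ q) = ⊥-elim (asym₁ r r)
      where r = subst (λ z → Pos Y z (fun (chart c) x)) (gʳ (fun (chart c) x)) (mono₁ (chart c) _ _ q)
    ... | inj₂ (inj₂ q) = ⊥-elim (asym₁ r r)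
      where r = subst (Pos Y (fun (chart c) x)) (gʳ (fun (chart c) x)) (mono₁ (chart c) _ _ q)

FinPlot-≅ : ∀ {X n P} {α : Fin n → Fin n} → Total X → (∀ i → P i) → Cover X (FinPlot α) P → X ≅ FinPlot α
FinPlot-≅ total = cover⇒≅ total ℕ.<-asym ℕ.<-asym

_∈[_,_⟩ : ℕ → ℕ → ℕ → Set
i ∈[ x , y ⟩ = x ≤ i × i < y

argmax : (f : ℕ → ℕ) → ∀ x y → x < y → ∃ λ m → m ∈[ x , y ⟩ × (∀ i → i ∈[ x , y ⟩ → f i ≤ f m)
argmax f x (suc y) x<sy with ℕ.m≤n⇒m<n∨m≡n (ℕ.s≤s⁻¹ x<sy)
... | inj₂ refl = x , (ℕ.≤-refl , ℕ.n<1+n x) ,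
  λ i (x≤i , i<sx) → ℕ.≤-reflexive (cong f (ℕ.≤-antisym (ℕ.s≤s⁻¹ i<sx) x≤i))
... | inj₁ x<y with argmax f x y x<y
...   | m , (x≤m , m<y) , max with ℕ.≤-total (f y) (f m)
...     | inj₁ fy≤fm = m , (x≤m , ℕ.m<n⇒m<1+n m<y) , max′
  where
  max′ : ∀ i → i ∈[ x , suc y ⟩ → f i ≤ f m
  max′ i (x≤i , i<sy) with ℕ.m≤n⇒m<n∨m≡n (ℕ.s≤s⁻¹ i<sy)
  ... | inj₁ i<y  = max i (x≤i , i<y)
  ... | inj₂ refl = fy≤fm
...     | inj₂ fm≤fy = y , (ℕ.<⇒≤ x<y , ℕ.n<1+n y) , max′
  where
  max′ : ∀ i → i ∈[ x , suc y ⟩ → f i ≤ f y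
  max′ i (x≤i , i<sy) with ℕ.m≤n⇒m<n∨m≡n (ℕ.s≤s⁻¹ i<sy)
  ... | inj₁ i<y  = ℕ.≤-trans (max i (x≤i , i<y)) fm≤fy
  ... | inj₂ refl = ℕ.≤-refl

-- Applied to `α i < p`, it finds the position where β ends and γ⁻¹ begins.
threshold : ∀ {Q : ℕ → Set} → Decidable Q → ∀ a z → a ≤ z →
            (∀ i j → i < j → i ∈[ a , z ⟩ → j ∈[ a , z ⟩ → Q i → Q j) →
            ∃ λ q → a ≤ q × q ≤ z × (∀ i → i ∈[ a , q ⟩ → ¬ Q i) × (∀ i → i ∈[ q , z ⟩ → Q i)
threshold Q? a z a≤z mon with ℕ.m≤n⇒m<n∨m≡n a≤z
... | inj₂ refl = a , ℕ.≤-refl , ℕ.≤-refl ,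
  (λ i (a≤i , i<a) _ → ℕ.<⇒≱ i<a a≤i) , λ i (a≤i , i<a) → contradiction a≤i (ℕ.<⇒≱ i<a)
threshold Q? a (suc z) a≤sz mon | inj₁ a<sz with Q? z
... | no ¬Qz = suc z , a≤sz , ℕ.≤-refl , none , λ i (s≤i , i<s) → contradiction s≤i (ℕ.<⇒≱ i<s)
  where
  none : ∀ i → i ∈[ a , suc z ⟩ → ¬ _
  none i (a≤i , i<sz) Qi with ℕ.m≤n⇒m<n∨m≡n (ℕ.s≤s⁻¹ i<sz)
  ... | inj₁ i<z  = ¬Qz (mon i z i<z (a≤i , i<sz) (ℕ.s≤s⁻¹ a<sz , ℕ.n<1+n z) Qi)
  ... | inj₂ refl = ¬Qz Qi
... | yes Qz with threshold Q? a z (ℕ.s≤s⁻¹ a<sz)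
                    (λ i j i<j (a≤i , i<z) (a≤j , j<z) →
                      mon i j i<j (a≤i , ℕ.m<n⇒m<1+n i<z) (a≤j , ℕ.m<n⇒m<1+n j<z))
...   | q , a≤q , q≤z , below , above = q , a≤q , ℕ.m≤n⇒m≤1+n q≤z , below , above′
  where
  above′ : ∀ i → i ∈[ q , suc z ⟩ → _
  above′ i (q≤i , i<sz) with ℕ.m≤n⇒m<n∨m≡n (ℕ.s≤s⁻¹ i<sz)
  ... | inj₁ i<z  = above i (q≤i , i<z)
  ... | inj₂ refl = Qz

module Decomposition (f : ℕ → ℕ) (N : ℕ)
  (f-inj : ∀ i j → i < N → j < N → f i ≡ f j → i ≡ j)
  (av : ∀ i j k → i < j → j < k → k < N → f i < f k → f k < f j → ⊥) where

  -- Otherwise `i`, `m`, `j` would be an occurrence of 132.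
  above : ∀ i m j → i < m → m < j → j < N → f j < f m → f j < f i
  above i m j i<m m<j j<N fj<fm with ℕ.<-cmp (f j) (f i)
  ... | tri< lt _ _ = lt
  ... | tri≈ _ eq _ = contradiction (f-inj j i j<N (ℕ.<-trans (ℕ.<-trans i<m m<j) j<N) eq)
                                    (ℕ.>⇒≢ (ℕ.<-trans i<m m<j))
  ... | tri> _ _ gt = ⊥-elim (av i m j i<m m<j j<N gt fj<fm)

  tree : ∀ fuel x y → y ≤ x + fuel → y ≤ N → ∃ λ g → Cover ⟦ g ⟧ᵗ (Plot f) (_∈[ x , y ⟩)
  tree fuel x y y≤ y≤N with x ℕ.<? y
  ... | no x≮y = leaf , cover-𝟘 (λ i (x≤i , i<y) → x≮y (ℕ.≤-<-trans x≤i i<y))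
  tree zero x y y≤ y≤N | yes x<y =
    contradiction (subst (y ≤_) (ℕ.+-identityʳ x) y≤) (ℕ.<⇒≱ x<y)
  tree (suc fuel) x y y≤ y≤N | yes x<y with argmax f x y x<y
  ... | m , (x≤m , m<y) , max
      with tree fuel x m (ℕ.s≤s⁻¹ (ℕ.≤-trans m<y y≤′)) (ℕ.≤-trans (ℕ.<⇒≤ m<y) y≤N)
         | tree fuel (suc m) y (ℕ.≤-trans y≤′ (s≤s (ℕ.+-monoˡ-≤ fuel x≤m))) y≤N
    where y≤′ = ℕ.≤-trans y≤ (ℕ.≤-reflexive (ℕ.+-suc x fuel))
  ... | L , cL | R , cR = node L R , cover-resp into outof
          (cover-⊖ (cover-⊕𝟙 cL m (λ i (x≤i , i<m) → i<m , fi<fm i x≤i (ℕ.<-trans i<m m<y) (ℕ.<⇒≢ i<m))) cR skew)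
    where
    fi<fm : ∀ i → x ≤ i → i < y → i ≢ m → f i < f m
    fi<fm i x≤i i<y i≢m = ℕ.≤∧≢⇒< (max i (x≤i , i<y))
      (λ eq → i≢m (f-inj i m (ℕ.<-≤-trans i<y y≤N) (ℕ.<-≤-trans m<y y≤N) eq))
    fj<fm : ∀ j → j ∈[ suc m , y ⟩ → f j < f m
    fj<fm j (m<j , j<y) = fi<fm j (ℕ.≤-trans x≤m (ℕ.<⇒≤ m<j)) j<y (ℕ.>⇒≢ m<j)
    skew : ∀ i j → i ∈[ x , m ⟩ ⊎ i ≡ m → j ∈[ suc m , y ⟩ → i < j × f j < f i
    skew i j (inj₁ (x≤i , i<m)) j∈@(m<j , j<y) =
      ℕ.<-trans i<m m<j , above i m j i<m m<j (ℕ.<-≤-trans j<y y≤N) (fj<fm j j∈)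
    skew i j (inj₂ refl) j∈@(m<j , _) = m<j , fj<fm j j∈
    into : ∀ i → (i ∈[ x , m ⟩ ⊎ i ≡ m) ⊎ i ∈[ suc m , y ⟩ → i ∈[ x , y ⟩
    into i (inj₁ (inj₁ (x≤i , i<m))) = x≤i , ℕ.<-trans i<m m<y
    into i (inj₁ (inj₂ refl))        = x≤m , m<y
    into i (inj₂ (m<i , i<y))        = ℕ.≤-trans x≤m (ℕ.<⇒≤ m<i) , i<y
    outof : ∀ i → i ∈[ x , y ⟩ → (i ∈[ x , m ⟩ ⊎ i ≡ m) ⊎ i ∈[ suc m , y ⟩
    outof i (x≤i , i<y) with ℕ.<-cmp i m
    ... | tri< i<m _ _ = inj₁ (inj₁ (x≤i , i<m))
    ... | tri≈ _ eq _  = inj₁ (inj₂ eq)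
    ... | tri> _ _ m<i = inj₂ (m<i , i<y)

module InvDecomposition (α : ℕ → ℕ) (N : ℕ) (αα : ∀ i → i < N → α (α i) ≡ i)
  (av : ∀ i j k → i < j → j < k → k < N → α i < α k → α k < α j → ⊥) where

  α-inj : ∀ i j → i < N → j < N → α i ≡ α j → i ≡ j
  α-inj i j i<N j<N eq = trans (sym (αα i i<N)) (trans (cong α eq) (αα j j<N))

  open Decomposition α N α-inj av

  -- Makes the restriction to the interval an involution again, which is what the recursion into β
  -- rests on.
  Closed : ℕ → ℕ → Set
  Closed x y = ∀ i → i ∈[ x , y ⟩ → α i ∈[ x , y ⟩

  invTree : ∀ fuel x y → y ≤ x + fuel → y ≤ N → Closed x y →
            ∃ λ t → Cover ⟦ t ⟧ⁱ (Plot α) (_∈[ x , y ⟩)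
  invTree fuel x y y≤ y≤N cl with x ℕ.<? y
  ... | no x≮y = ε , cover-𝟘 (λ i (x≤i , i<y) → x≮y (ℕ.≤-<-trans x≤i i<y))
  invTree zero x y y≤ y≤N cl | yes x<y =
    contradiction (subst (y ≤_) (ℕ.+-identityʳ x) y≤) (ℕ.<⇒≱ x<y)
  invTree (suc fuel) x (suc z) y≤ y≤N cl | yes x<y = step (ℕ.m≤n⇒m<n∨m≡n (ℕ.s≤s⁻¹ p<y))
    where
    -- In a closed interval `z` is the last position and also the largest possible value; this value
    -- is attained at `p`.
    p = α z
    x≤z : x ≤ z
    x≤z = ℕ.s≤s⁻¹ x<y
    p<y : p < suc z
    p<y = proj₂ (cl z (x≤z , ℕ.n<1+n z))
    x≤p : x ≤ p
    x≤p = proj₁ (cl z (x≤z , ℕ.n<1+n z))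
    αp : α p ≡ z
    αp = αα z y≤N
    z≤ : z ≤ x + fuel
    z≤ = ℕ.s≤s⁻¹ (ℕ.≤-trans y≤ (ℕ.≤-reflexive (ℕ.+-suc x fuel)))
    <N : ∀ {i} → i < suc z → i < N
    <N i<y = ℕ.<-≤-trans i<y y≤N
    α≤z : ∀ i → i ∈[ x , suc z ⟩ → α i ≤ z
    α≤z i i∈ = ℕ.s≤s⁻¹ (proj₂ (cl i i∈))
    -- The largest value is attained only at p.
    α<z : ∀ i → i ∈[ x , suc z ⟩ → i ≢ p → α i < z
    α<z i i∈ i≢p = ℕ.≤∧≢⇒< (α≤z i i∈)
      (λ eq → i≢p (α-inj i p (<N (proj₂ i∈)) (<N p<y) (trans eq (sym αp))))

    step : p < z ⊎ p ≡ z → ∃ λ t → Cover ⟦ t ⟧ⁱ (Plot α) (_∈[ x , suc z ⟩)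
    step (inj₂ p≡z) = fix (proj₁ rest) , cover-resp into outof
        (cover-⊕𝟙 (proj₂ rest) z (λ i (x≤i , i<z) → i<z ,
          subst (α i <_) (sym p≡z) (α<z i (x≤i , ℕ.m<n⇒m<1+n i<z) (λ e → ℕ.<⇒≢ i<z (trans e p≡z)))))
      where
      rest = invTree fuel x z z≤ (ℕ.≤-trans (ℕ.n≤1+n z) y≤N) λ i (x≤i , i<z) →
        proj₁ (cl i (x≤i , ℕ.m<n⇒m<1+n i<z)) ,
        α<z i (x≤i , ℕ.m<n⇒m<1+n i<z) (λ e → ℕ.<⇒≢ i<z (trans e p≡z))
      into : ∀ i → i ∈[ x , z ⟩ ⊎ i ≡ z → i ∈[ x , suc z ⟩
      into i (inj₁ (x≤i , i<z)) = x≤i , ℕ.m<n⇒m<1+n i<z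
      into i (inj₂ refl)        = x≤z , ℕ.n<1+n z
      outof : ∀ i → i ∈[ x , suc z ⟩ → i ∈[ x , z ⟩ ⊎ i ≡ z
      outof i (x≤i , i<y) with ℕ.m≤n⇒m<n∨m≡n (ℕ.s≤s⁻¹ i<y)
      ... | inj₁ i<z = inj₁ (x≤i , i<z)
      ... | inj₂ e   = inj₂ e
    step (inj₁ p<z) = split (threshold (λ i → α i ℕ.<? p) (suc p) z p<z monotone)
      where
      in-v : ∀ i → i ∈[ suc p , z ⟩ → i ∈[ x , suc z ⟩
      in-v i (p<i , i<z) = ℕ.≤-trans x≤p (ℕ.<⇒≤ p<i) , ℕ.m<n⇒m<1+n i<z
      -- The largest value sits at `p`, so by avoidance of 132 the entries before `p` exceed those
      -- after it.
      left-above : ∀ i j → i ∈[ x , p ⟩ → j ∈[ suc p , suc z ⟩ → α j < α i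
      left-above i j (x≤i , i<p) (p<j , j<y) =
        above i p j i<p p<j (<N j<y)
          (subst (α j <_) (sym αp) (α<z j (ℕ.≤-trans x≤p (ℕ.<⇒≤ p<j) , j<y) (ℕ.>⇒≢ p<j)))
      p<α : ∀ i → i ∈[ x , p ⟩ → p < α i
      p<α i i∈ = left-above i z i∈ (p<z , ℕ.n<1+n z)
      -- `α i = p` would force `i = z`.
      p<α-v : ∀ i → i ∈[ suc p , z ⟩ → ¬ α i < p → p < α i
      p<α-v i i∈@(p<i , i<z) α≮p = ℕ.≤∧≢⇒< (ℕ.≮⇒≥ α≮p) λ e →
        ℕ.<⇒≢ i<z (trans (sym (αα i (<N (ℕ.m<n⇒m<1+n i<z)))) (trans (cong α (sym e)) αp))
      α-v<z : ∀ i → i ∈[ suc p , z ⟩ → α i < z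
      α-v<z i i∈@(p<i , _) = α<z i (in-v i i∈) (ℕ.>⇒≢ p<i)
      -- If `α i < p < α j`, then `left-above` at the positions `α i` and `α j` compares the values
      -- `i` and `j` there and yields `j < i`.
      monotone : ∀ i j → i < j → i ∈[ suc p , z ⟩ → j ∈[ suc p , z ⟩ → α i < p → α j < p
      monotone i j i<j i∈ j∈ αi<p with α j ℕ.<? p
      ... | yes lt = lt
      ... | no ≮p = contradiction
        (subst₂ _<_ (αα j (<N (proj₂ (in-v j j∈)))) (αα i (<N (proj₂ (in-v i i∈))))
          (left-above (α i) (α j) (proj₁ (cl i (in-v i i∈)) , αi<p)
            (p<α-v j j∈ ≮p , proj₂ (cl j (in-v j j∈)))))
        (ℕ.<⇒≯ i<j)

      split : (∃ λ q → suc p ≤ q × q ≤ z × (∀ i → i ∈[ suc p , q ⟩ → ¬ α i < p)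
                     × (∀ i → i ∈[ q , z ⟩ → α i < p)) →
              ∃ λ t → Cover ⟦ t ⟧ⁱ (Plot α) (_∈[ x , suc z ⟩)
      split (q , p<q , q≤z , mid , end) = arc (proj₁ γ) (proj₁ β) , cover-resp into outof
          (cover-⊖ (cover-⊖ (cover-⊕𝟙 (proj₂ γ) p left-top) (proj₂ β) left-mid)
                   (cover-⊕𝟙 mirrored z right-top) last)
        where
        mid∈ : ∀ i → i ∈[ suc p , q ⟩ → i ∈[ suc p , z ⟩
        mid∈ i (p<i , i<q) = p<i , ℕ.<-≤-trans i<q q≤z
        end∈ : ∀ i → i ∈[ q , z ⟩ → i ∈[ suc p , z ⟩
        end∈ i (q≤i , i<z) = ℕ.≤-trans p<q q≤i , i<z
        γ = tree (suc fuel) x p (ℕ.≤-trans (ℕ.<⇒≤ p<y) y≤) (ℕ.≤-trans (ℕ.<⇒≤ p<y) y≤N)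
        β = invTree fuel (suc p) q
              (ℕ.≤-trans q≤z (ℕ.≤-trans z≤ (ℕ.+-monoˡ-≤ fuel (ℕ.m≤n⇒m≤1+n x≤p))))
              (ℕ.≤-trans (ℕ.m≤n⇒m≤1+n q≤z) y≤N)
              closed
          where
          -- A value `α i` of at least `q` would be a position of the final run, where entries lie
          -- below `p`; but the entry there is `i`.
          closed : Closed (suc p) q
          closed i i∈ with α i ℕ.<? q
          ... | yes lt = p<α-v i (mid∈ i i∈) (mid i i∈) , lt
          ... | no ≮q = contradiction (subst (_< p) (αα i (<N (proj₂ (in-v i (mid∈ i i∈)))))
                          (end (α i) (ℕ.≮⇒≥ ≮q , α-v<z i (mid∈ i i∈))))
                          (ℕ.<⇒≯ (proj₁ i∈))
        cγ = proj₂ γ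
        α∈end : ∀ i → i ∈[ x , p ⟩ → α i ∈[ q , z ⟩
        α∈end i i∈@(x≤i , i<p) = q≤αi , αi<z
          where
          i∈′ : i ∈[ x , suc z ⟩
          i∈′ = x≤i , ℕ.<-trans i<p p<y
          αi<z = α<z i i∈′ (ℕ.<⇒≢ i<p)
          q≤αi : q ≤ α i
          q≤αi with q ℕ.≤? α i
          ... | yes le = le
          ... | no ≰ = contradiction (subst (_< p) (sym (αα i (<N (proj₂ i∈′)))) i<p)
                         (mid (α i) (p<α i i∈ , ℕ.≰⇒> ≰))
        -- `α` carries the positions of γ onto the final run [q, z), so following the chart of γ by
        -- `α` exchanges its two orders and charts γ⁻¹.
        mirrored : Cover (⟦ proj₁ γ ⟧ᵗ ᵀ) (Plot α) (_∈[ q , z ⟩)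
        mirrored = record
          { chart = record
              { fun = λ a → α (fun (chart cγ) a)
              ; mono₁ = mono₂ (chart cγ)
              ; mono₂ = λ a b r → subst₂ _<_ (sym (ααe a)) (sym (ααe b)) (mono₁ (chart cγ) a b r) }
          ; inside = λ a → α∈end _ (inside cγ a)
          ; covers = λ i i∈ →
              let a , eq = covers cγ (α i) (proj₁ (cl i (in-v i (end∈ i i∈))) , end i i∈)
              in a , trans (cong α eq) (αα i (<N (proj₂ (in-v i (end∈ i i∈))))) }
          where
          ααe : ∀ a → α (α (fun (chart cγ) a)) ≡ fun (chart cγ) a
          ααe a = αα _ (<N (ℕ.<-trans (proj₂ (inside cγ a)) p<y))
        left-top : ∀ i → i ∈[ x , p ⟩ → i < p × α i < α p
        left-top i (x≤i , i<p) = i<p , subst (α i <_) (sym αp)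
          (α<z i (x≤i , ℕ.<-trans i<p p<y) (ℕ.<⇒≢ i<p))
        left-mid : ∀ i j → i ∈[ x , p ⟩ ⊎ i ≡ p → j ∈[ suc p , q ⟩ → i < j × α j < α i
        left-mid i j (inj₁ i∈@(x≤i , i<p)) j∈@(p<j , j<q) =
          ℕ.<-trans i<p p<j , left-above i j i∈ (p<j , ℕ.<-≤-trans j<q (ℕ.m≤n⇒m≤1+n q≤z))
        left-mid i j (inj₂ refl) j∈@(p<j , _) =
          p<j , subst (α j <_) (sym αp) (α-v<z j (mid∈ j j∈))
        right-top : ∀ i → i ∈[ q , z ⟩ → i < z × α i < α z
        right-top i i∈@(_ , i<z) = i<z , end i i∈
        last : ∀ i j → (i ∈[ x , p ⟩ ⊎ i ≡ p) ⊎ i ∈[ suc p , q ⟩ → j ∈[ q , z ⟩ ⊎ j ≡ z →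
               i < j × α j < α i
        last i j i∈ j∈ = ℕ.<-≤-trans (i<q i∈) (q≤j j∈) , ℕ.≤-<-trans (αj≤p j∈) (p<αi i∈)
          where
          i<q : (i ∈[ x , p ⟩ ⊎ i ≡ p) ⊎ i ∈[ suc p , q ⟩ → i < q
          i<q (inj₁ (inj₁ (_ , i<p))) = ℕ.<-trans i<p p<q
          i<q (inj₁ (inj₂ refl))      = p<q
          i<q (inj₂ (_ , i<q))        = i<q
          q≤j : j ∈[ q , z ⟩ ⊎ j ≡ z → q ≤ j
          q≤j (inj₁ (q≤j , _)) = q≤j
          q≤j (inj₂ refl)      = q≤z
          αj≤p : j ∈[ q , z ⟩ ⊎ j ≡ z → α j ≤ p
          αj≤p (inj₁ j∈)   = ℕ.<⇒≤ (end j j∈)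
          αj≤p (inj₂ refl) = ℕ.≤-refl
          p<αi : (i ∈[ x , p ⟩ ⊎ i ≡ p) ⊎ i ∈[ suc p , q ⟩ → p < α i
          p<αi (inj₁ (inj₁ i∈))   = p<α i i∈
          p<αi (inj₁ (inj₂ refl)) = subst (p <_) (sym αp) p<z
          p<αi (inj₂ i∈)          = p<α-v i (mid∈ i i∈) (mid i i∈)
        into : ∀ i → ((i ∈[ x , p ⟩ ⊎ i ≡ p) ⊎ i ∈[ suc p , q ⟩) ⊎ (i ∈[ q , z ⟩ ⊎ i ≡ z) →
               i ∈[ x , suc z ⟩
        into i (inj₁ (inj₁ (inj₁ (x≤i , i<p)))) = x≤i , ℕ.<-trans i<p p<y
        into i (inj₁ (inj₁ (inj₂ refl)))        = x≤p , p<y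
        into i (inj₁ (inj₂ i∈))                 = in-v i (mid∈ i i∈)
        into i (inj₂ (inj₁ i∈))                 = in-v i (end∈ i i∈)
        into i (inj₂ (inj₂ refl))               = x≤z , ℕ.n<1+n z
        outof : ∀ i → i ∈[ x , suc z ⟩ →
                ((i ∈[ x , p ⟩ ⊎ i ≡ p) ⊎ i ∈[ suc p , q ⟩) ⊎ (i ∈[ q , z ⟩ ⊎ i ≡ z)
        outof i (x≤i , i<y) with ℕ.<-cmp i p | i ℕ.<? q | ℕ.m≤n⇒m<n∨m≡n (ℕ.s≤s⁻¹ i<y)
        ... | tri< i<p _ _ | _      | _        = inj₁ (inj₁ (inj₁ (x≤i , i<p)))
        ... | tri≈ _ e _   | _      | _        = inj₁ (inj₁ (inj₂ e))
        ... | tri> _ _ p<i | yes lt | _        = inj₁ (inj₂ (p<i , lt))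
        ... | tri> _ _ p<i | no ≮q  | inj₁ i<z = inj₂ (inj₁ (ℕ.≮⇒≥ ≮q , i<z))
        ... | tri> _ _ p<i | no ≮q  | inj₂ e   = inj₂ (inj₂ e)

-- Permutations of `Fin n` as biposets

module _ {k n} {τ : Fin k → Fin k} {α : Fin n → Fin n} where
  ≼⇒contains : (∀ a b → τ a ≡ τ b → a ≡ b) → FinPlot τ ≼ FinPlot α → Contains α τ
  ≼⇒contains τ-inj f = fun f , mono₁ f , λ a b → mk⇔ (reflect a b) (mono₂ f a b)
    where
    reflect : ∀ a b → α (fun f a) Fin.< α (fun f b) → τ a Fin.< τ b
    reflect a b lt with Fin.<-cmp (τ a) (τ b)
    ... | tri< τ< _ _ = τ<
    ... | tri≈ _ τ≡ _ = contradiction (cong (λ c → α (fun f c)) (τ-inj a b τ≡)) (Fin.<⇒≢ lt)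
    ... | tri> _ _ τ> = contradiction (mono₂ f b a τ>) (Fin.<-asym lt)

  contains⇒≼ : Contains α τ → FinPlot τ ≼ FinPlot α
  contains⇒≼ (ι , inc , iso) = record
    { fun = ι ; mono₁ = inc ; mono₂ = λ a b → Equivalence.from (iso a b) }

permutation-inj : ∀ {k} (π : Permutation′ k) a b → π ⟨$⟩ʳ a ≡ π ⟨$⟩ʳ b → a ≡ b
permutation-inj π a b eq = trans (sym (inverseˡ π)) (trans (cong (π ⟨$⟩ˡ_) eq) (inverseˡ π))

Av132⇒avoids : ∀ {n} {α : Fin n → Fin n} → Av132 (FinPlot α) → Avoids α (p132 ⟨$⟩ʳ_)
Av132⇒avoids av (ι , inc , iso) = av (ι 0F) (ι 1F) (ι 2F)
  (inc 0F 1F (s≤s z≤n)) (inc 1F 2F (s≤s (s≤s z≤n)))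
  (Equivalence.from (iso 0F 2F) (s≤s z≤n)) (Equivalence.from (iso 2F 1F) (s≤s (s≤s z≤n)))

avoids⇒Av132 : ∀ {n} {α : Fin n → Fin n} → Avoids α (p132 ⟨$⟩ʳ_) → Av132 (FinPlot α)
avoids⇒Av132 {n} {α} av i j k i<j j<k αi<αk αk<αj =
  av (≼⇒contains {τ = p132 ⟨$⟩ʳ_} {α} (permutation-inj p132) (record { fun = ι ; mono₁ = m₁ ; mono₂ = m₂ }))
  where
  ι : Fin 3 → Fin n
  ι 0F = i
  ι 1F = j
  ι 2F = k
  m₁ : ∀ a b → a Fin.< b → ι a Fin.< ι b
  m₁ 0F 1F _ = i<j
  m₁ 0F 2F _ = Fin.<-trans i<j j<k
  m₁ 1F 1F (s≤s ())
  m₁ 1F 2F _ = j<k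
  m₁ 2F 1F (s≤s ())
  m₁ 2F 2F (s≤s (s≤s ()))
  m₂ : ∀ a b → p132 ⟨$⟩ʳ a Fin.< p132 ⟨$⟩ʳ b → α (ι a) Fin.< α (ι b)
  m₂ 0F 1F _ = ℕ.<-trans αi<αk αk<αj
  m₂ 0F 2F _ = αi<αk
  m₂ 1F 1F (s≤s (s≤s ()))
  m₂ 1F 2F (s≤s ())
  m₂ 2F 1F _ = αk<αj
  m₂ 2F 2F (s≤s ())

≼-Av132 : ∀ {X Y} → X ≼ Y → Av132 Y → Av132 X
≼-Av132 f av a b c p q r s = av _ _ _ (mono₁ f _ _ p) (mono₁ f _ _ q) (mono₂ f _ _ r) (mono₂ f _ _ s)

module _ {n} (α : Fin n → Fin n) (αα : Involutive _≡_ α) (av : Av132 (FinPlot α)) where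
  private
    α̂ : ℕ → ℕ
    α̂ i with i ℕ.<? n
    ... | yes i<n = Fin.toℕ (α (Fin.fromℕ< i<n))
    ... | no  _   = i

    α̂-toℕ : ∀ i → α̂ (Fin.toℕ i) ≡ Fin.toℕ (α i)
    α̂-toℕ i with Fin.toℕ i ℕ.<? n
    ... | yes i<n = cong (Fin.toℕ ∘ α) (Fin.fromℕ<-toℕ i i<n)
    ... | no  i≮n = contradiction (Fin.toℕ<n i) i≮n

    from< : ∀ {i} → i < n → ∃ λ j → i ≡ Fin.toℕ {n} j
    from< i<n = Fin.fromℕ< i<n , sym (Fin.toℕ-fromℕ< i<n)

    α̂α̂ : ∀ i → i < n → α̂ (α̂ i) ≡ i
    α̂α̂ i i<n with from< i<n
    ... | j , refl = trans (cong α̂ (α̂-toℕ j)) (trans (α̂-toℕ (α j)) (cong Fin.toℕ (αα j)))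

    α̂-av : ∀ i j k → i < j → j < k → k < n → α̂ i < α̂ k → α̂ k < α̂ j → ⊥
    α̂-av i j k i<j j<k k<n p q
      with from< (ℕ.<-trans (ℕ.<-trans i<j j<k) k<n) | from< (ℕ.<-trans j<k k<n) | from< k<n
    ... | i′ , refl | j′ , refl | k′ , refl = av i′ j′ k′ i<j j<k
      (subst₂ _<_ (α̂-toℕ i′) (α̂-toℕ k′) p) (subst₂ _<_ (α̂-toℕ k′) (α̂-toℕ j′) q)

    toℕ-embedding : Embedding (FinPlot α) (Plot α̂)
    toℕ-embedding = record
      { emb = record { fun = Fin.toℕ ; mono₁ = λ _ _ p → p
                     ; mono₂ = λ i j → subst₂ _<_ (sym (α̂-toℕ i)) (sym (α̂-toℕ j)) }
      ; inj = Fin.toℕ-injective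
      ; reflect₁ = λ _ _ p → p
      ; reflect₂ = λ i j → subst₂ _<_ (α̂-toℕ i) (α̂-toℕ j) }

    closed : ∀ i → i ∈[ 0 , n ⟩ → α̂ i ∈[ 0 , n ⟩
    closed i (_ , i<n) with from< i<n
    ... | j , refl = z≤n , subst (_< n) (sym (α̂-toℕ j)) (Fin.toℕ<n (α j))

  involution⇒tree : ∃ λ t → ⟦ t ⟧ⁱ ≅ FinPlot α
  involution⇒tree
    with InvDecomposition.invTree α̂ n α̂α̂ α̂-av n 0 n ℕ.≤-refl ℕ.≤-refl closed
  ... | t , c = t , FinPlot-≅ {P = λ _ → ⊤} (inv-total t) (λ _ → tt) (record
    { chart = factor (chart c) toℕ-embedding (λ x → from< (proj₂ (inside c x)))
    ; inside = λ _ → tt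
    ; covers = λ i _ → let x , eq = covers c (Fin.toℕ i) (z≤n , Fin.toℕ<n i)
                       in x , Fin.toℕ-injective
                            (trans (sym (proj₂ (from< (proj₂ (inside c x))))) eq) })

module _ (t : InvTree) where
  private
    r = inv-ranking t
    unrank : Fin (size t) → Carrier ⟦ t ⟧ⁱ
    unrank i = proj₁ (onto r i)

    rank-unrank : ∀ i → rank r (unrank i) ≡ i
    rank-unrank i = proj₂ (onto r i)

    unrank-rank : ∀ x → unrank (rank r x) ≡ x
    unrank-rank x with pos-connex (inv-total t) (unrank (rank r x)) x
    ... | inj₁ e        = e
    ... | inj₂ (inj₁ p) = contradiction (cong Fin.toℕ (rank-unrank (rank r x))) (ℕ.<⇒≢ (rank-< r _ _ p))
    ... | inj₂ (inj₂ p) = contradiction (cong Fin.toℕ (sym (rank-unrank (rank r x)))) (ℕ.<⇒≢ (rank-< r _ _ p))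

  -- The value of a point is the position of its mirror image.
  involution : Fin (size t) → Fin (size t)
  involution i = rank r (mirror t (unrank i))

  involution-involutive : Involutive _≡_ involution
  involution-involutive i = trans
    (cong (rank r) (trans (cong (mirror t) (unrank-rank _)) (mirror-involutive t _)))
    (rank-unrank i)

  involution-≅ : ⟦ t ⟧ⁱ ≅ FinPlot involution
  involution-≅ = FinPlot-≅ {P = λ _ → ⊤} (inv-total t) (λ _ → tt) (record
    { chart = record { fun = rank r ; mono₁ = rank-< r
                   ; mono₂ = λ x y p → subst₂ (λ u v → rank r (mirror t u) Fin.< rank r (mirror t v))
                       (sym (unrank-rank x)) (sym (unrank-rank y)) (rank-< r _ _ (mirror-Val t x y p)) }
    ; inside = λ _ → tt
    ; covers = λ i _ → onto r i })

  size-unique : ∀ {n} {α : Fin n → Fin n} → ⟦ t ⟧ⁱ ≅ FinPlot α → size t ≡ n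
  size-unique f = ℕ.≤-antisym
    (Fin.injective⇒≤ {f = λ i → fun (to f) (unrank i)} λ {i} {j} eq →
      trans (sym (rank-unrank i)) (trans (cong (rank r)
        (trans (sym (invˡ f _)) (trans (cong (fun (from f)) eq) (invˡ f _)))) (rank-unrank j)))
    (Fin.injective⇒≤ {f = λ i → rank r (fun (from f) i)} λ {i} {j} eq →
      trans (sym (invʳ f i)) (trans (cong (fun (to f))
        (trans (sym (unrank-rank _)) (trans (cong unrank eq) (unrank-rank _)))) (invʳ f j)))

inflationary : ∀ {n} (h : Fin n → Fin n) → (∀ i j → i Fin.< j → h i Fin.< h j) → ∀ i → i Fin.≤ h i
inflationary {n} h h-mono i = go (Fin.toℕ i) i refl
  where
  go : ∀ k i → Fin.toℕ i ≡ k → k ≤ Fin.toℕ (h i)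
  go zero    i eq = z≤n
  go (suc k) i eq = ℕ.≤-<-trans (go k j (Fin.toℕ-fromℕ< k<n))
    (h-mono j i (ℕ.≤-reflexive (trans (cong suc (Fin.toℕ-fromℕ< k<n)) (sym eq))))
    where
    k<n : k < n
    k<n = ℕ.<-trans (ℕ.n<1+n k) (subst (_< n) eq (Fin.toℕ<n i))
    j = Fin.fromℕ< k<n

-- Both maps are inflationary, and applying `k` to `h i` returns to `i`, which bounds `h i` from
-- above.
mutually-inverse⇒id : ∀ {n} (h k : Fin n → Fin n) →
  (∀ i j → i Fin.< j → h i Fin.< h j) → (∀ i j → i Fin.< j → k i Fin.< k j) →
  (∀ i → k (h i) ≡ i) → ∀ i → h i ≡ i
mutually-inverse⇒id h k h-mono k-mono kh i = Fin.≤-antisym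
  (subst (h i Fin.≤_) (kh i) (inflationary k k-mono (h i)))
  (inflationary h h-mono i)

-- The isomorphism is the identity on positions, so `α` and `β` order values alike. Then `β ∘ α` and
-- `α ∘ β` are increasing and mutually inverse, hence the identity.
plot-determines : ∀ {n} {α β : Fin n → Fin n} → Involutive _≡_ α → Involutive _≡_ β →
                  FinPlot α ≅ FinPlot β → α ≗ β
plot-determines {n} {α} {β} αα ββ f i =
  trans (sym (ββ (α i))) (cong β (mutually-inverse⇒id (λ i → β (α i)) (λ i → α (β i))
    (λ i j i<j → α⇒β (α i) (α j) (subst₂ Fin._<_ (sym (αα i)) (sym (αα j)) i<j))
    (λ i j i<j → β⇒α (β i) (β j) (subst₂ Fin._<_ (sym (ββ i)) (sym (ββ j)) i<j))
    (λ i → trans (cong α (ββ (α i))) (αα i)) i))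
  where
  to-id : ∀ i → fun (to f) i ≡ i
  to-id = mutually-inverse⇒id (fun (to f)) (fun (from f)) (mono₁ (to f)) (mono₁ (from f)) (invˡ f)
  from-id : ∀ i → fun (from f) i ≡ i
  from-id = mutually-inverse⇒id (fun (from f)) (fun (to f)) (mono₁ (from f)) (mono₁ (to f)) (invʳ f)
  α⇒β : ∀ i j → α i Fin.< α j → β i Fin.< β j
  α⇒β i j p = subst₂ (λ u v → β u Fin.< β v) (to-id i) (to-id j) (mono₂ (to f) i j p)
  β⇒α : ∀ i j → β i Fin.< β j → α i Fin.< α j
  β⇒α i j p = subst₂ (λ u v → α u Fin.< α v) (from-id i) (from-id j) (mono₂ (from f) i j p)

-- Enumeration

-- Follows the recursion of `_∗_`, so that summing a multiplicative indicator over these lists gives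
-- a product of series (`total-conv`).
conv : ∀ {A B C : Set} → (A → B → C) → (ℕ → List A) → (ℕ → List B) → ℕ → List C
conv f as bs zero    = cartesianProductWith f (as 0) (bs 0)
conv f as bs (suc n) = cartesianProductWith f (as 0) (bs (suc n)) ++ conv f (as ∘ suc) bs n

module _ {A B C : Set} (f : A → B → C) where
  conv-cong : ∀ {as as′ bs bs′} n → (∀ i → i ≤ n → as i ≡ as′ i) → (∀ i → i ≤ n → bs i ≡ bs′ i) →
              conv f as bs n ≡ conv f as′ bs′ n
  conv-cong zero    p q = cong₂ (cartesianProductWith f) (p 0 z≤n) (q 0 z≤n)
  conv-cong (suc n) p q = cong₂ _++_
    (cong₂ (cartesianProductWith f) (p 0 z≤n) (q (suc n) ℕ.≤-refl))
    (conv-cong n (λ i i≤n → p (suc i) (s≤s i≤n)) (λ i i≤n → q i (ℕ.m≤n⇒m≤1+n i≤n)))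

  ∈-conv⁺ : ∀ as bs {a b} i j → a ∈ as i → b ∈ bs j → f a b ∈ conv f as bs (i + j)
  ∈-conv⁺ as bs zero    zero    a∈ b∈ = ∈-cartesianProductWith⁺ f a∈ b∈
  ∈-conv⁺ as bs zero    (suc j) a∈ b∈ = ∈-++⁺ˡ (∈-cartesianProductWith⁺ f a∈ b∈)
  ∈-conv⁺ as bs (suc i) j       a∈ b∈ =
    ∈-++⁺ʳ (cartesianProductWith f (as 0) (bs (suc (i + j)))) (∈-conv⁺ (as ∘ suc) bs i j a∈ b∈)

  ∈-conv⁻ : ∀ as bs n {c} → c ∈ conv f as bs n →
            ∃ λ i → ∃ λ j → ∃ λ a → ∃ λ b → a ∈ as i × b ∈ bs j × i + j ≡ n × c ≡ f a b
  ∈-conv⁻ as bs zero c∈ with ∈-cartesianProductWith⁻ f (as 0) (bs 0) c∈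
  ... | a , b , a∈ , b∈ , eq = 0 , 0 , a , b , a∈ , b∈ , refl , eq
  ∈-conv⁻ as bs (suc n) c∈ with ∈-++⁻ (cartesianProductWith f (as 0) (bs (suc n))) c∈
  ... | inj₁ c∈₁ with ∈-cartesianProductWith⁻ f (as 0) (bs (suc n)) c∈₁
  ...   | a , b , a∈ , b∈ , eq = 0 , suc n , a , b , a∈ , b∈ , refl , eq
  ∈-conv⁻ as bs (suc n) c∈ | inj₂ c∈₂ with ∈-conv⁻ (as ∘ suc) bs n c∈₂
  ...   | i , j , a , b , a∈ , b∈ , i+j≡n , eq = suc i , j , a , b , a∈ , b∈ , cong suc i+j≡n , eq

  unique-conv : (∀ {a a′ b b′} → f a b ≡ f a′ b′ → a ≡ a′ × b ≡ b′) →
    ∀ as bs n → (∀ i → Unique (as i)) → (∀ j → Unique (bs j)) →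
    (∀ {i i′ a} → a ∈ as i → a ∈ as i′ → i ≡ i′) → Unique (conv f as bs n)
  unique-conv f-inj as bs zero    ua ub disj = Unique.cartesianProductWith⁺ f f-inj (ua 0) (ub 0)
  unique-conv f-inj as bs (suc n) ua ub disj = Unique.++⁺
    (Unique.cartesianProductWith⁺ f f-inj (ua 0) (ub (suc n)))
    (unique-conv f-inj (as ∘ suc) bs n (ua ∘ suc) ub (λ p q → ℕ.suc-injective (disj p q)))
    (λ (v∈₁ , v∈₂) → apart v∈₁ v∈₂)
    where
    apart : ∀ {v} → v ∈ cartesianProductWith f (as 0) (bs (suc n)) → v ∈ conv f (as ∘ suc) bs n → ⊥
    apart v∈₁ v∈₂ with ∈-cartesianProductWith⁻ f (as 0) (bs (suc n)) v∈₁ | ∈-conv⁻ (as ∘ suc) bs n v∈₂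
    ... | a , b , a∈ , _ , refl | i , _ , a′ , b′ , a′∈ , _ , _ , eq with f-inj eq
    ...   | refl , refl with disj a∈ a′∈
    ...     | ()

-- The first argument bounds the recursion depth: any fuel above n gives all
-- trees of weight n.
treesWith : ℕ → ℕ → List Tree
treesWith zero       _             = []
treesWith (suc fuel) zero          = leaf ∷ []
treesWith (suc fuel) (suc zero)    = []
treesWith (suc fuel) (suc (suc n)) = conv node (treesWith fuel) (treesWith fuel) n

trees : ℕ → List Tree
trees n = treesWith (suc n) n

treesWith-stable : ∀ f f′ n → n < f → n < f′ → treesWith f n ≡ treesWith f′ n
treesWith-stable (suc f) (suc f′) zero          _ _ = refl
treesWith-stable (suc f) (suc f′) (suc zero)    _ _ = refl
treesWith-stable (suc f) (suc f′) (suc (suc n)) (s≤s p) (s≤s q) = conv-cong node n stable stable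
  where
  stable : ∀ i → i ≤ n → treesWith f i ≡ treesWith f′ i
  stable i i≤n = treesWith-stable f f′ i (ℕ.≤-<-trans i≤n (ℕ.<-trans (ℕ.n<1+n n) p))
                                         (ℕ.≤-<-trans i≤n (ℕ.<-trans (ℕ.n<1+n n) q))

trees-step : ∀ n → trees (2 + n) ≡ conv node trees trees n
trees-step n = conv-cong node n stable stable
  where
  stable : ∀ i → i ≤ n → treesWith (2 + n) i ≡ trees i
  stable i i≤n = treesWith-stable (2 + n) (suc i) i (s≤s (ℕ.m≤n⇒m≤1+n i≤n)) (ℕ.n<1+n i)

∈-treesWith⁻ : ∀ f n {t} → t ∈ treesWith f n → weight t ≡ n
∈-treesWith⁻ (suc f) zero (here refl) = refl
∈-treesWith⁻ (suc f) (suc (suc n)) t∈ with ∈-conv⁻ node (treesWith f) (treesWith f) n t∈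
... | i , j , L , R , L∈ , R∈ , refl , refl =
  cong₂ (λ a b → 2 + (a + b)) (∈-treesWith⁻ f i L∈) (∈-treesWith⁻ f j R∈)

∈-treesWith⁺ : ∀ f t → weight t < f → t ∈ treesWith f (weight t)
∈-treesWith⁺ (suc f) leaf       _       = here refl
∈-treesWith⁺ (suc f) (node L R) (s≤s p) = ∈-conv⁺ node (treesWith f) (treesWith f) (weight L) (weight R)
  (∈-treesWith⁺ f L (ℕ.≤-<-trans (ℕ.m≤m+n _ _) p′)) (∈-treesWith⁺ f R (ℕ.≤-<-trans (ℕ.m≤n+m _ _) p′))
  where
  p′ : weight L + weight R < f
  p′ = ℕ.<-trans (ℕ.n<1+n _) p

unique-treesWith : ∀ f n → Unique (treesWith f n)
unique-treesWith zero    n             = []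
unique-treesWith (suc f) zero          = [] ∷ []
unique-treesWith (suc f) (suc zero)    = []
unique-treesWith (suc f) (suc (suc n)) = unique-conv node (λ { refl → refl , refl }) _ _ n
  (unique-treesWith f) (unique-treesWith f)
  (λ p q → trans (sym (∈-treesWith⁻ f _ p)) (∈-treesWith⁻ f _ q))

invTreesWith : ℕ → ℕ → List InvTree
invTreesWith zero       _             = []
invTreesWith (suc fuel) zero          = ε ∷ []
invTreesWith (suc fuel) (suc zero)    = map fix (invTreesWith fuel 0)
invTreesWith (suc fuel) (suc (suc n)) =
  map fix (invTreesWith fuel (suc n)) ++ conv arc trees (invTreesWith fuel) n

invTrees : ℕ → List InvTree
invTrees n = invTreesWith (suc n) n

invTreesWith-stable : ∀ f f′ n → n < f → n < f′ → invTreesWith f n ≡ invTreesWith f′ n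
invTreesWith-stable (suc f) (suc f′) zero          _       _       = refl
invTreesWith-stable (suc f) (suc f′) (suc zero)    (s≤s p) (s≤s q) =
  cong (map fix) (invTreesWith-stable f f′ 0 p q)
invTreesWith-stable (suc f) (suc f′) (suc (suc n)) (s≤s p) (s≤s q) = cong₂ _++_
  (cong (map fix) (invTreesWith-stable f f′ (suc n) p q))
  (conv-cong arc n (λ _ _ → refl) (λ i i≤n →
    invTreesWith-stable f f′ i (ℕ.≤-<-trans i≤n (ℕ.<-trans (ℕ.n<1+n n) p))
                               (ℕ.≤-<-trans i≤n (ℕ.<-trans (ℕ.n<1+n n) q))))

invTrees-step : ∀ n → invTrees (2 + n) ≡ map fix (invTrees (suc n)) ++ conv arc trees invTrees n
invTrees-step n = cong (map fix (invTrees (suc n)) ++_) (conv-cong arc n (λ _ _ → refl)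
  (λ i i≤n → invTreesWith-stable (2 + n) (suc i) i (s≤s (ℕ.m≤n⇒m≤1+n i≤n)) (ℕ.n<1+n i)))

∈-invTreesWith⁻ : ∀ f n {t} → t ∈ invTreesWith f n → size t ≡ n
∈-invTreesWith⁻ (suc f) zero (here refl) = refl
∈-invTreesWith⁻ (suc f) (suc zero) t∈ with ∈-map⁻ fix t∈
... | b , b∈ , refl = cong suc (∈-invTreesWith⁻ f 0 b∈)
∈-invTreesWith⁻ (suc f) (suc (suc n)) t∈ with ∈-++⁻ (map fix (invTreesWith f (suc n))) t∈
... | inj₁ t∈₁ with ∈-map⁻ fix t∈₁
...   | b , b∈ , refl = cong suc (∈-invTreesWith⁻ f (suc n) b∈)
∈-invTreesWith⁻ (suc f) (suc (suc n)) t∈ | inj₂ t∈₂ with ∈-conv⁻ arc trees (invTreesWith f) n t∈₂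
...   | i , j , g , b , g∈ , b∈ , refl , refl =
  cong₂ (λ a b → 2 + (a + b)) (∈-treesWith⁻ (suc i) i g∈) (∈-invTreesWith⁻ f j b∈)

∈-invTreesWith⁺ : ∀ f t → size t < f → t ∈ invTreesWith f (size t)
∈-invTreesWith⁺ (suc f) ε _ = here refl
∈-invTreesWith⁺ (suc f) (fix b) (s≤s p) with size b | ∈-invTreesWith⁺ f b p
... | zero  | b∈ = ∈-map⁺ fix b∈
... | suc n | b∈ = ∈-++⁺ˡ (∈-map⁺ fix b∈)
∈-invTreesWith⁺ (suc f) (arc g b) (s≤s p) = ∈-++⁺ʳ (map fix (invTreesWith f (suc (weight g + size b))))
  (∈-conv⁺ arc trees (invTreesWith f) (weight g) (size b) (∈-treesWith⁺ _ g ℕ.≤-refl)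
    (∈-invTreesWith⁺ f b (ℕ.≤-<-trans (ℕ.m≤n+m _ _) (ℕ.<-trans (ℕ.n<1+n _) p))))

unique-invTreesWith : ∀ f n → Unique (invTreesWith f n)
unique-invTreesWith zero    n             = []
unique-invTreesWith (suc f) zero          = [] ∷ []
unique-invTreesWith (suc f) (suc zero)    = Unique.map⁺ (λ { refl → refl }) (unique-invTreesWith f 0)
unique-invTreesWith (suc f) (suc (suc n)) = Unique.++⁺
  (Unique.map⁺ (λ { refl → refl }) (unique-invTreesWith f (suc n)))
  (unique-conv arc (λ { refl → refl , refl }) trees (invTreesWith f) n
    (λ i → unique-treesWith (suc i) i) (unique-invTreesWith f)
    (λ {i} {j} p q → trans (sym (∈-treesWith⁻ (suc i) i p)) (∈-treesWith⁻ (suc j) j q)))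
  (λ (t∈₁ , t∈₂) → apart t∈₁ t∈₂)
  where
  apart : ∀ {t} → t ∈ map fix (invTreesWith f (suc n)) → t ∈ conv arc trees (invTreesWith f) n → ⊥
  apart t∈₁ t∈₂ with ∈-map⁻ fix t∈₁ | ∈-conv⁻ arc trees (invTreesWith f) n t∈₂
  ... | _ , _ , refl | _ , _ , _ , _ , _ , _ , _ , ()

-- Counting involutions by matching them with trees

module _ {A B : Set} {_~_ : A → B → Set} where
  private
    Separated : List A → Set
    Separated = AllPairs (λ x x′ → ∀ y → x ~ y → x′ ~ y → ⊥)

    lookup-separated : ∀ {xs y} → Separated xs → ∀ i j → lookup xs i ~ y → lookup xs j ~ y → i ≡ j
    lookup-separated (px ∷ pxs) Fin.zero    Fin.zero    p q = refl
    lookup-separated (px ∷ pxs) Fin.zero    (Fin.suc j) p q = ⊥-elim (All.lookup px (∈-lookup j) _ p q)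
    lookup-separated (px ∷ pxs) (Fin.suc i) Fin.zero    p q = ⊥-elim (All.lookup px (∈-lookup i) _ q p)
    lookup-separated (px ∷ pxs) (Fin.suc i) (Fin.suc j) p q = cong Fin.suc (lookup-separated pxs i j p q)

  -- Maps on `Fin n` are compared only up to `_≗_`, so a relation takes the place of a bijection:
  -- separated elements have different partners, and the index of a partner is an injection.
  matching⇒≤ : ∀ {xs ys} → AllPairs (λ x x′ → ∀ y → x ~ y → x′ ~ y → ⊥) xs →
               (∀ {x} → x ∈ xs → ∃ λ y → y ∈ ys × x ~ y) → length xs ≤ length ys
  matching⇒≤ {xs} {ys} sep match = Fin.injective⇒≤ {f = λ i → Any.index (y∈ i)} λ {i} {j} eq →
    lookup-separated sep i j
      (subst (lookup xs i ~_) (lookup-index (y∈ i)) (x~y i))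
      (subst (lookup xs j ~_) (trans (lookup-index (y∈ j)) (cong (lookup ys) (sym eq))) (x~y j))
    where
    y∈ : ∀ i → proj₁ (match (∈-lookup i)) ∈ ys
    y∈ i = proj₁ (proj₂ (match (∈-lookup i)))
    x~y : ∀ i → lookup xs i ~ proj₁ (match (∈-lookup i))
    x~y i = proj₂ (proj₂ (match (∈-lookup i)))

FinPlot-cong : ∀ {n} {α β : Fin n → Fin n} → α ≗ β → FinPlot α ≅ FinPlot β
FinPlot-cong α≗β = record
  { to   = record { fun = λ i → i ; mono₁ = λ _ _ p → p
                  ; mono₂ = λ i j → subst₂ Fin._<_ (α≗β i) (α≗β j) }
  ; from = record { fun = λ i → i ; mono₁ = λ _ _ p → p
                  ; mono₂ = λ i j → subst₂ Fin._<_ (sym (α≗β i)) (sym (α≗β j)) }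
  ; invˡ = λ _ → refl ; invʳ = λ _ → refl }

funToFin-cong : ∀ {m n} {f g : Fin m → Fin n} → f ≗ g → Fin.funToFin f ≡ Fin.funToFin g
funToFin-cong {zero}  eq = refl
funToFin-cong {suc m} eq = cong₂ Fin.combine (eq Fin.zero) (funToFin-cong (eq ∘ Fin.suc))

endomaps-unique : ∀ n → AllPairs (λ f g → ¬ f ≗ g) (endomaps n)
endomaps-unique n = AllPairs.map⁺ (AllPairs.map
  (λ i≢j eq → i≢j (trans (sym (Fin.funToFin-finToFin {n} {n} _))
    (trans (funToFin-cong eq) (Fin.funToFin-finToFin {n} {n} _))))
  (Unique.allFin⁺ (n ℕ.^ n)))

∈-endomaps : ∀ {n} (f : Fin n → Fin n) → ∃ λ g → g ∈ endomaps n × g ≗ f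
∈-endomaps {n} f = Fin.finToFun (Fin.funToFin f)
                 , ∈-map⁺ Fin.finToFun (∈-allFin (Fin.funToFin f)) , Fin.finToFun-funToFin f

module _ {k} (ρ : Permutation′ k) where
  private
    ρᴮ : Biposet
    ρᴮ = FinPlot (ρ ⟨$⟩ʳ_)

  occurs? : ∀ t → Dec (ρᴮ ≼ ⟦ t ⟧ⁱ)
  occurs? t = map′
    (λ c → ≼-trans (contains⇒≼ c) (from (involution-≅ t)))
    (λ f → ≼⇒contains (permutation-inj ρ) (≼-trans f (to (involution-≅ t))))
    (contains? (involution t) (ρ ⟨$⟩ʳ_))

  private
    _~_ : ∀ {n} → (Fin n → Fin n) → InvTree → Set
    α ~ t = Involutive _≡_ α × ⟦ t ⟧ⁱ ≅ FinPlot α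

    avoiding⇒tree : ∀ {n} {α : Fin n → Fin n} → AvoidingInvolution ρ α →
                    ∃ λ t → size t ≡ n × ¬ (ρᴮ ≼ ⟦ t ⟧ⁱ) × α ~ t
    avoiding⇒tree {α = α} (αα , av132 , avρ) with involution⇒tree α αα (avoids⇒Av132 av132)
    ... | t , iso = t , size-unique t iso
                  , (λ f → avρ (≼⇒contains (permutation-inj ρ) (≼-trans f (to iso)))) , αα , iso

    tree⇒avoiding : ∀ t → ¬ (ρᴮ ≼ ⟦ t ⟧ⁱ) → ∃ λ α → α ∈ endomaps (size t) × AvoidingInvolution ρ α × α ~ t
    tree⇒avoiding t ¬ρ with ∈-endomaps (involution t)
    ... | α , α∈ , α≗ = α , α∈ , (αα , Av132⇒avoids (≼-Av132 (from iso) (inv-Av132 t))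
                                     , λ c → ¬ρ (≼-trans (contains⇒≼ c) (from iso))) , αα , iso
      where
      αα : Involutive _≡_ α
      αα i = trans (α≗ (α i)) (trans (cong (involution t) (α≗ i)) (involution-involutive t i))
      iso : ⟦ t ⟧ⁱ ≅ FinPlot α
      iso = ≅-trans (involution-≅ t) (FinPlot-cong (sym ∘ α≗))

  -- One relation gives both inequalities: `plot-determines` separates the involutions related to a
  -- tree, and `inv-rigid` the trees related to an involution.
  I≡trees : ∀ n → I ρ n ≡ length (filter (¬? ∘ occurs?) (invTrees n))
  I≡trees n = ℕ.≤-antisym
    (matching⇒≤ {_~_ = _~_}
      (AllPairs.filter⁺ (avoidingInvolution? ρ) (AllPairs.map
        (λ α≇β _ (αα , f) (ββ , g) → α≇β (plot-determines αα ββ (≅-trans (≅-sym f) g))) (endomaps-unique n)))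
      (λ α∈ → let t , size≡ , ¬ρ , α~t =
                      avoiding⇒tree (proj₂ (∈-filter⁻ (avoidingInvolution? ρ) {xs = endomaps n} α∈))
              in t , ∈-filter⁺ (¬? ∘ occurs?) (∈-invTrees t size≡) ¬ρ , α~t))
    (matching⇒≤ {_~_ = λ t α → α ~ t}
      (AllPairs.filter⁺ (¬? ∘ occurs?) (AllPairs.map
        (λ s≢t _ (_ , f) (_ , g) → s≢t (inv-rigid _ _ (≅-trans f (≅-sym g)))) (unique-invTreesWith (suc n) n)))
      (λ t∈ → let t∈′ , ¬ρ = ∈-filter⁻ (¬? ∘ occurs?) {xs = invTrees n} t∈ in matched _ t∈′ ¬ρ))
    where
    ∈-invTrees : ∀ {n} t → size t ≡ n → t ∈ invTrees n
    ∈-invTrees t refl = ∈-invTreesWith⁺ _ t ℕ.≤-refl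
    matched : ∀ t → t ∈ invTrees n → ¬ (ρᴮ ≼ ⟦ t ⟧ⁱ) →
              ∃ λ α → α ∈ filter (avoidingInvolution? ρ) (endomaps n) × α ~ t
    matched t t∈ ¬ρ with ∈-invTreesWith⁻ (suc n) n t∈
    ... | refl = let α , α∈ , avα , α~t = tree⇒avoiding t ¬ρ
                 in α , ∈-filter⁺ (avoidingInvolution? ρ) α∈ avα , α~t

-- The ring of power series

infixl 6 _⊞_
infix  8 ⊟_

_⊞_ : Series → Series → Series
(f ⊞ g) n = f n ℤ.+ g n

⊟_ : Series → Series
(⊟ f) n = ℤ.- f n

const : ℤ → Series
const a zero    = a
const a (suc _) = 0ℤ

x̂ : Series
x̂ 1 = 1ℤ
x̂ _ = 0ℤ

const-∗ : ∀ a f n → (const a ∗ f) n ≡ a ℤ.* f n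
const-∗ a f zero    = refl
const-∗ a f (suc n) = trans (cong (ℤ._+_ (a ℤ.* f (suc n))) (∗-zeroˡ f n)) (ℤ.+-identityʳ _)

x̂-∗-zero : ∀ f → (x̂ ∗ f) 0 ≡ 0ℤ
x̂-∗-zero f = ℤ.*-zeroˡ (f 0)

x̂-∗-suc : ∀ f n → (x̂ ∗ f) (suc n) ≡ f n
x̂-∗-suc f n = trans (∗-shiftˡ x̂ f refl n)
  (trans (∗-cong {g = f} x̂∘suc (λ _ → refl) n) (trans (const-∗ 1ℤ f n) (ℤ.*-identityˡ _)))
  where
  x̂∘suc : x̂ ∘ suc ≗ const 1ℤ
  x̂∘suc zero    = refl
  x̂∘suc (suc n) = refl

∗-distribʳ : ∀ f g h → (f ⊞ g) ∗ h ≗ (f ∗ h) ⊞ (g ∗ h)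
∗-distribʳ f g h zero    = ℤ.*-distribʳ-+ (h 0) (f 0) (g 0)
∗-distribʳ f g h (suc n) = trans
  (cong (ℤ._+_ ((f 0 ℤ.+ g 0) ℤ.* h (suc n))) (∗-distribʳ (f ∘ suc) (g ∘ suc) h n))
  (regroup (f 0) (g 0) (h (suc n)) (((f ∘ suc) ∗ h) n) (((g ∘ suc) ∗ h) n))
  where
  regroup : ∀ a b c d e → (a ℤ.+ b) ℤ.* c ℤ.+ (d ℤ.+ e) ≡ (a ℤ.* c ℤ.+ d) ℤ.+ (b ℤ.* c ℤ.+ e)
  regroup = ℤ-Solver.solve-∀

∗-scaleˡ : ∀ a f g n → ((λ i → a ℤ.* f i) ∗ g) n ≡ a ℤ.* (f ∗ g) n
∗-scaleˡ a f g zero    = ℤ.*-assoc a (f 0) (g 0)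
∗-scaleˡ a f g (suc n) = trans (cong (ℤ._+_ (a ℤ.* f 0 ℤ.* g (suc n))) (∗-scaleˡ a (f ∘ suc) g n))
  (regroup a (f 0) (g (suc n)) (((f ∘ suc) ∗ g) n))
  where
  regroup : ∀ a b c d → a ℤ.* b ℤ.* c ℤ.+ a ℤ.* d ≡ a ℤ.* (b ℤ.* c ℤ.+ d)
  regroup = ℤ-Solver.solve-∀

∗-assoc : ∀ f g h → (f ∗ g) ∗ h ≗ f ∗ (g ∗ h)
∗-assoc f g h zero    = ℤ.*-assoc (f 0) (g 0) (h 0)
∗-assoc f g h (suc n) = begin
  f 0 ℤ.* g 0 ℤ.* h (suc n) ℤ.+ (((f ∗ g) ∘ suc) ∗ h) n
    ≡⟨ cong (ℤ._+_ (f 0 ℤ.* g 0 ℤ.* h (suc n))) (∗-distribʳ (λ i → f 0 ℤ.* g (suc i)) ((f ∘ suc) ∗ g) h n) ⟩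
  f 0 ℤ.* g 0 ℤ.* h (suc n) ℤ.+ (((λ i → f 0 ℤ.* g (suc i)) ∗ h) n ℤ.+ (((f ∘ suc) ∗ g) ∗ h) n)
    ≡⟨ cong₂ (λ u v → f 0 ℤ.* g 0 ℤ.* h (suc n) ℤ.+ (u ℤ.+ v))
         (∗-scaleˡ (f 0) (g ∘ suc) h n) (∗-assoc (f ∘ suc) g h n) ⟩
  f 0 ℤ.* g 0 ℤ.* h (suc n) ℤ.+ (f 0 ℤ.* ((g ∘ suc) ∗ h) n ℤ.+ ((f ∘ suc) ∗ (g ∗ h)) n)
    ≡⟨ regroup (f 0) (g 0) (h (suc n)) _ _ ⟩
  f 0 ℤ.* (g 0 ℤ.* h (suc n) ℤ.+ ((g ∘ suc) ∗ h) n) ℤ.+ ((f ∘ suc) ∗ (g ∗ h)) n ∎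
  where
  open ≡-Reasoning
  regroup : ∀ a b c d e → a ℤ.* b ℤ.* c ℤ.+ (a ℤ.* d ℤ.+ e) ≡ a ℤ.* (b ℤ.* c ℤ.+ d) ℤ.+ e
  regroup = ℤ-Solver.solve-∀

-- The product is defined by peeling its left factor; peeling the right factor as well makes
-- commutativity an induction.
∗-peelʳ : ∀ f g n → (f ∗ g) (suc n) ≡ (f ∗ (g ∘ suc)) n ℤ.+ f (suc n) ℤ.* g 0
∗-peelʳ f g zero    = refl
∗-peelʳ f g (suc n) = trans (cong (ℤ._+_ (f 0 ℤ.* g (2 + n))) (∗-peelʳ (f ∘ suc) g n))
  (sym (ℤ.+-assoc (f 0 ℤ.* g (2 + n)) _ _))

∗-comm : ∀ f g → f ∗ g ≗ g ∗ f
∗-comm f g zero    = ℤ.*-comm (f 0) (g 0)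
∗-comm f g (suc n) = begin
  f 0 ℤ.* g (suc n) ℤ.+ ((f ∘ suc) ∗ g) n  ≡⟨ ℤ.+-comm (f 0 ℤ.* g (suc n)) _ ⟩
  ((f ∘ suc) ∗ g) n ℤ.+ f 0 ℤ.* g (suc n)  ≡⟨ cong₂ ℤ._+_ (∗-comm (f ∘ suc) g n) (ℤ.*-comm (f 0) _) ⟩
  (g ∗ (f ∘ suc)) n ℤ.+ g (suc n) ℤ.* f 0  ≡⟨ ∗-peelʳ g f n ⟨
  (g ∗ f) (suc n)                          ∎
  where open ≡-Reasoning

∗-identityˡ : ∀ f → const 1ℤ ∗ f ≗ f
∗-identityˡ f n = trans (const-∗ 1ℤ f n) (ℤ.*-identityˡ (f n))

seriesRing : CommutativeRing 0ℓ 0ℓ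
seriesRing = record
  { Carrier = Series ; _≈_ = _≗_ ; _+_ = _⊞_ ; _*_ = _∗_ ; -_ = ⊟_ ; 0# = const 0ℤ ; 1# = const 1ℤ
  ; isCommutativeRing = record
    { isRing = record
      { +-isAbelianGroup = record
        { isGroup = record
          { isMonoid = record
            { isSemigroup = record
              { isMagma = record
                { isEquivalence = record
                  { refl = λ _ → refl ; sym = λ p n → sym (p n) ; trans = λ p q n → trans (p n) (q n) }
                ; ∙-cong = λ p q n → cong₂ ℤ._+_ (p n) (q n) }
              ; assoc = λ f g h n → ℤ.+-assoc (f n) (g n) (h n) }
            ; identity = (λ f n → trans (cong (ℤ._+ f n) (const-0 n)) (ℤ.+-identityˡ (f n)))
                       , (λ f n → trans (cong (ℤ._+_ (f n)) (const-0 n)) (ℤ.+-identityʳ (f n))) }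
          ; inverse = (λ f n → trans (ℤ.+-inverseˡ (f n)) (sym (const-0 n)))
                    , (λ f n → trans (ℤ.+-inverseʳ (f n)) (sym (const-0 n)))
          ; ⁻¹-cong = λ p n → cong ℤ.-_ (p n) }
        ; comm = λ f g n → ℤ.+-comm (f n) (g n) }
      ; *-cong = ∗-cong
      ; *-assoc = ∗-assoc
      ; *-identity = ∗-identityˡ , λ f n → trans (∗-comm f (const 1ℤ) n) (∗-identityˡ f n)
      ; distrib = (λ f g h n → trans (∗-comm f (g ⊞ h) n) (trans (∗-distribʳ g h f n)
                     (cong₂ ℤ._+_ (∗-comm g f n) (∗-comm h f n))))
                , (λ f g h → ∗-distribʳ g h f) }
    ; *-comm = ∗-comm } }
  where
  const-0 : ∀ n → const 0ℤ n ≡ 0ℤ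
  const-0 zero    = refl
  const-0 (suc n) = refl

private
  -- The solver computes with integer coefficients, whose equality is decidable, unlike that of
  -- series.
  const-morphism : (CommutativeRing.rawRing ℤ.+-*-commutativeRing)
                   -Raw-AlmostCommutative⟶ fromCommutativeRing seriesRing
  const-morphism = record
    { ⟦_⟧    = const
    ; +-homo = λ { a b zero → refl ; a b (suc n) → refl }
    ; *-homo = λ { a b zero → refl ; a b (suc n) → sym (trans (const-∗ a (const b) (suc n)) (ℤ.*-zeroʳ a)) }
    ; -‿homo = λ { a zero → refl ; a (suc n) → refl }
    ; 0-homo = λ _ → refl
    ; 1-homo = λ _ → refl }

  const-≟ : ∀ a b → Maybe (const a ≗ const b)
  const-≟ a b = Maybe.map (λ { refl _ → refl }) (dec⇒maybe (a ℤ.≟ b))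

module SeriesSolver =
  Algebra.Solver.Ring (CommutativeRing.rawRing ℤ.+-*-commutativeRing)
    (fromCommutativeRing seriesRing) const-morphism const-≟

open SeriesSolver using (Polynomial; solve; con; _:=_; _:+_; _:*_; _:-_; :-_)

-- Continued fractions

infixl 6 _⊝_

_⊝_ : Series → Series → Series
f ⊝ g = f ⊞ (⊟ g)

1ˢ : Series
1ˢ = const 1ℤ

-- Series over ℤ have no zero divisors: a coefficient at which `u` and `v` differ would make
-- `d ∗ (u ⊝ v)` nonzero.
∗-cancelˡ : ∀ d {u v} → NonZeroSeries d → d ∗ u ≗ d ∗ v → u ≗ v
∗-cancelˡ d {u} {v} (i , dᵢ≢0) eq n with u n ℤ.≟ v n
... | yes p = p
... | no ¬p =
  let k , nz = ∗-nonZero d (u ⊝ v) i n dᵢ≢0 (λ e → ¬p (ℤ.i-j≡0⇒i≡j (u n) (v n) e))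
  in contradiction (trans (expand d u v k)
       (trans (cong (λ z → z ℤ.- (d ∗ v) k) (eq k)) (ℤ.+-inverseʳ ((d ∗ v) k)))) nz
  where
  expand : ∀ d u v → d ∗ (u ⊝ v) ≗ (d ∗ u) ⊝ (d ∗ v)
  expand = solve 3 (λ d u v → d :* (u :- v) := d :* u :- d :* v) (λ _ → refl)

-- To derive A ≗ B from hypotheses Lᵢ ≗ Rᵢ it suffices to exhibit cofactors
-- with A - B = Σ cᵢ (Lᵢ - Rᵢ); below, the latter is stated without subtraction.
private
  cancel-+ : ∀ {A B u v : Series} → u ≗ v → A ⊞ u ≗ B ⊞ v → A ≗ B
  cancel-+ {A} {B} {u} {v} u≗v eq n =
    ∙-cancelʳ (v n) (A n) (B n) (trans (cong (ℤ._+_ (A n)) (sym (u≗v n))) (eq n))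

combine₁ : ∀ {A B L R} c → L ≗ R → A ⊞ c ∗ R ≗ B ⊞ c ∗ L → A ≗ B
combine₁ c p = cancel-+ (∗-cong {c} (λ _ → refl) (λ n → sym (p n)))

combine₂ : ∀ {A B L₁ R₁ L₂ R₂} c₁ c₂ → L₁ ≗ R₁ → L₂ ≗ R₂ →
           A ⊞ (c₁ ∗ R₁ ⊞ c₂ ∗ R₂) ≗ B ⊞ (c₁ ∗ L₁ ⊞ c₂ ∗ L₂) → A ≗ B
combine₂ c₁ c₂ p₁ p₂ = cancel-+ (λ n → cong₂ ℤ._+_
  (∗-cong {c₁} (λ _ → refl) (λ n → sym (p₁ n)) n) (∗-cong {c₂} (λ _ → refl) (λ n → sym (p₂ n)) n))

combine₃ : ∀ {A B L₁ R₁ L₂ R₂ L₃ R₃} c₁ c₂ c₃ → L₁ ≗ R₁ → L₂ ≗ R₂ → L₃ ≗ R₃ →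
           A ⊞ (c₁ ∗ R₁ ⊞ c₂ ∗ R₂ ⊞ c₃ ∗ R₃) ≗ B ⊞ (c₁ ∗ L₁ ⊞ c₂ ∗ L₂ ⊞ c₃ ∗ L₃) → A ≗ B
combine₃ c₁ c₂ c₃ p₁ p₂ p₃ = cancel-+ (λ n → cong₂ ℤ._+_ (cong₂ ℤ._+_
  (∗-cong {c₁} (λ _ → refl) (λ n → sym (p₁ n)) n) (∗-cong {c₂} (λ _ → refl) (λ n → sym (p₂ n)) n))
  (∗-cong {c₃} (λ _ → refl) (λ n → sym (p₃ n)) n))

record HasUnitConstant (d : Series) : Set where
  constructor unit
  field constant : d 0 ≡ 1ℤ

unitConstant⇒nonZero : ∀ {d} → HasUnitConstant d → NonZeroSeries d
unitConstant⇒nonZero (unit d₀) = 0 , λ d₀≡0 → contradiction (trans (sym d₀) d₀≡0) (λ ())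

unitConstant-⊝ : ∀ {d z} f → HasUnitConstant d → z 0 ≡ 0ℤ → HasUnitConstant (d ⊝ z ∗ f)
unitConstant-⊝ {d} {z} f (unit d₀) z₀ = unit eq
  where
  eq : (d ⊝ z ∗ f) 0 ≡ 1ℤ
  eq rewrite d₀ | z₀ | ℤ.*-zeroˡ (f 0) = refl

unitConstant-∗ : ∀ {d e} → HasUnitConstant d → HasUnitConstant e → HasUnitConstant (d ∗ e)
unitConstant-∗ (unit d₀) (unit e₀) = unit (cong₂ ℤ._*_ d₀ e₀)

1ˢ-unit : HasUnitConstant 1ˢ
1ˢ-unit = unit refl

x² : Series
x² = x̂ ∗ x̂

𝟏 : ∀ {n} → Polynomial n
𝟏 = con 1ℤ

-- r k plays the role of R_k(x²): r (k + 1) = 1 / (1 - x² r k).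
module Continuants (r : ℕ → Series) (r-zero : r 0 ≗ const 0ℤ)
  (r-suc : ∀ k → r (suc k) ≗ 1ˢ ⊞ x² ∗ (r k ∗ r (suc k))) where

  r-inverse : ∀ k → r (suc k) ∗ (1ˢ ⊝ x² ∗ r k) ≗ 1ˢ
  r-inverse k = combine₁ 1ˢ (r-suc k)
    (solve 3 (λ y R R′ → R′ :* (𝟏 :- y :* R) :+ 𝟏 :* (𝟏 :+ y :* (R :* R′)) := 𝟏 :+ 𝟏 :* R′)
      (λ _ → refl) x² (r k) (r (suc k)))

  -- With r_k = P_{k-1}/P_k this amounts to two instances of U_{m+n} = U_m U_n - U_{m-1} U_{n-1}.
  -- The induction moves one unit from `p` to `j`: the instance for `p` and `suc j`, multiplied by
  -- r_{p+1} (1 - x² r_j), becomes the one for `suc p` and `j` once the inverses are cleared.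
  r-addition : ∀ p j → r (suc (j + p)) ∗ ((1ˢ ⊝ x² ∗ r j) ⊝ x² ∗ r p) ≗ 1ˢ ⊝ x² ∗ (r j ∗ r p)
  r-addition zero j rewrite ℕ.+-identityʳ j = combine₂ 1ˢ (x² ∗ (r j ⊝ r (suc j))) (r-inverse j) r-zero
    (solve 4 (λ y s R Z →
      s :* ((𝟏 :- y :* R) :- y :* Z) :+ (𝟏 :* 𝟏 :+ (y :* (R :- s)) :* con 0ℤ)
      := (𝟏 :- y :* (R :* Z)) :+ (𝟏 :* (s :* (𝟏 :- y :* R)) :+ (y :* (R :- s)) :* Z))
      (λ _ → refl) x² (r (suc j)) (r j) (r 0))
  r-addition (suc p) j rewrite ℕ.+-suc j p = combine₃
    (rₚ₊₁ ∗ (1ˢ ⊝ x² ∗ r j)) (x² ∗ (rₚ₊₁ ∗ (s ⊝ r p))) (1ˢ ⊝ s ∗ (1ˢ ⊝ x² ∗ r j))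
    (r-addition p (suc j)) (r-inverse j) (r-inverse p)
    (solve 6 (λ y s R R′ P P′ →
      s :* ((𝟏 :- y :* R) :- y :* P′)
      :+ ((P′ :* (𝟏 :- y :* R)) :* (𝟏 :- y :* (R′ :* P)) :+ (y :* (P′ :* (s :- P))) :* 𝟏
         :+ (𝟏 :- s :* (𝟏 :- y :* R)) :* 𝟏)
      := (𝟏 :- y :* (R :* P′))
      :+ ((P′ :* (𝟏 :- y :* R)) :* (s :* ((𝟏 :- y :* R′) :- y :* P))
         :+ (y :* (P′ :* (s :- P))) :* (R′ :* (𝟏 :- y :* R))
         :+ (𝟏 :- s :* (𝟏 :- y :* R)) :* (P′ :* (𝟏 :- y :* P))))
      (λ _ → refl) x² s (r j) (r (suc j)) (r p) rₚ₊₁)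
    where
    s = r (suc (suc (j + p)))
    rₚ₊₁ = r (suc p)

  r-unique₁ : ∀ k S → S ≗ 1ˢ ⊞ x² ∗ (r k ∗ S) → S ≗ r (suc k)
  r-unique₁ k S eq = combine₂ (r (suc k)) (⊟ S) eq (r-inverse k)
    (solve 4 (λ y S r r′ →
      S :+ (r′ :* (𝟏 :+ y :* (r :* S)) :+ (:- S) :* 𝟏)
      := r′ :+ (r′ :* S :+ (:- S) :* (r′ :* (𝟏 :- y :* r))))
      (λ _ → refl) x² S (r k) (r (suc k)))

  -- The recurrence obtained by splitting off the largest entry when the pattern
  -- is the skew sum of two indecomposables.
  r-unique : ∀ j p S → S ≗ 1ˢ ⊞ x² ∗ (r j ∗ S) ⊞ x² ∗ ((S ⊝ r j) ∗ r p) → S ≗ r (suc (j + p))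
  r-unique j p S eq = ∗-cancelˡ ((1ˢ ⊝ x² ∗ r j) ⊝ x² ∗ r p)
    (unitConstant⇒nonZero (unitConstant-⊝ (r p) (unitConstant-⊝ (r j) 1ˢ-unit refl) refl))
    (combine₂ 1ˢ (⊟ 1ˢ) eq (r-addition p j)
      (solve 5 (λ y S K M T → ((𝟏 :- y :* K) :- y :* M) :* S
          :+ (𝟏 :* (𝟏 :+ y :* (K :* S) :+ y :* ((S :- K) :* M)) :+ (:- 𝟏) :* (𝟏 :- y :* (K :* M)))
        := ((𝟏 :- y :* K) :- y :* M) :* T
          :+ (𝟏 :* S :+ (:- 𝟏) :* (T :* ((𝟏 :- y :* K) :- y :* M))))
        (λ _ → refl) x² S (r j) (r p) (r (suc (j + p)))))

  module _ (J : ℕ → Series) (J-zero : J 0 ≗ const 0ℤ)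
    (J-suc : ∀ k → J (suc k) ≗ 1ˢ ⊞ x̂ ∗ J k ⊞ x² ∗ (r k ∗ J (suc k))) where

    J-step : ∀ k → J (suc k) ≗ r (suc k) ∗ (1ˢ ⊞ x̂ ∗ J k)
    J-step k = combine₂ (r (suc k)) (⊟ J (suc k)) (J-suc k) (r-inverse k)
      (solve 5 (λ x r r′ J J′ → let y = x :* x in
        J′ :+ (r′ :* (𝟏 :+ x :* J :+ y :* (r :* J′)) :+ (:- J′) :* 𝟏)
        := r′ :* (𝟏 :+ x :* J) :+ (r′ :* J′ :+ (:- J′) :* (r′ :* (𝟏 :- y :* r))))
        (λ _ → refl) x̂ (r k) (r (suc k)) (J k) (J (suc k)))

    -- Two applications of `J-step` lead from index 2l to 2l + 2. The series r_{2l+1} and r_{2l+2}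
    -- that enter are expressed by r_l and r_{l+1} through the addition formula, at the price of the
    -- denominators `D₁` and `D₂`.
    J-even : ∀ l → J (l + l) ∗ (1ˢ ⊝ x̂ ∗ r l) ≗ r l
    J-even zero = combine₂ (1ˢ ⊝ x̂ ∗ r 0) (⊟ 1ˢ) J-zero r-zero
      (solve 3 (λ x r J →
        J :* (𝟏 :- x :* r) :+ ((𝟏 :- x :* r) :* con 0ℤ :+ (:- 𝟏) :* con 0ℤ)
        := r :+ ((𝟏 :- x :* r) :* J :+ (:- 𝟏) :* r))
        (λ _ → refl) x̂ (r 0) (J 0))
    J-even (suc l) rewrite ℕ.+-suc l l = ∗-cancelˡ (D₁ ∗ D₂)
      (unitConstant⇒nonZero (unitConstant-∗ D₁-unit D₂-unit))
      (combine₂ V 1ˢ J₂D₁D₂ UWV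
        (solve 7 (λ J₂ D₁ D₂ V U W r′ →
          D₁ :* D₂ :* (J₂ :* V) :+ (V :* (U :* W) :+ 𝟏 :* (r′ :* (D₁ :* D₂)))
          := D₁ :* D₂ :* r′ :+ (V :* (J₂ :* (D₁ :* D₂)) :+ 𝟏 :* (U :* (W :* V))))
          (λ _ → refl) J₂ D₁ D₂ V U W r′))
      where
      r₀ = r l
      r′ = r (suc l)
      A  = r (suc (l + l))
      B  = r (suc (suc (l + l)))
      J₀ = J (l + l)
      J₁ = J (suc (l + l))
      J₂ = J (suc (suc (l + l)))
      E  = 1ˢ ⊝ x̂ ∗ r₀
      q  = 1ˢ ⊝ x² ∗ r₀
      D₁ = q ⊝ x² ∗ r₀
      D₂ = (1ˢ ⊝ x² ∗ r′) ⊝ x² ∗ r₀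
      U  = 1ˢ ⊝ x² ∗ (r′ ∗ r₀)
      V  = 1ˢ ⊝ x̂ ∗ r′
      W  = q ⊞ x̂

      E-unit : HasUnitConstant E
      E-unit = unitConstant-⊝ r₀ 1ˢ-unit refl
      q-unit : HasUnitConstant q
      q-unit = unitConstant-⊝ r₀ 1ˢ-unit refl
      D₁-unit : HasUnitConstant D₁
      D₁-unit = unitConstant-⊝ r₀ q-unit refl
      D₂-unit : HasUnitConstant D₂
      D₂-unit = unitConstant-⊝ r₀ (unitConstant-⊝ r′ 1ˢ-unit refl) refl

      -- The induction hypothesis `J₀ ∗ E ≗ r₀` says that 1 + x J₀ is the inverse of `E`.
      J₁E : J₁ ∗ E ≗ A
      J₁E = combine₂ E (A ∗ x̂) (J-step (l + l)) (J-even l)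
        (solve 5 (λ x r J A J₁ → let E = 𝟏 :- x :* r in
          J₁ :* E :+ (E :* (A :* (𝟏 :+ x :* J)) :+ (A :* x) :* r)
          := A :+ (E :* J₁ :+ (A :* x) :* (J :* E)))
          (λ _ → refl) x̂ r₀ J₀ A J₁)

      -- With equal indices the addition formula gives A D₁ = 1 - x² r₀², which has the factor E = 1
      -- - x r₀.
      J₂D₁ : J₂ ∗ D₁ ≗ B ∗ W
      J₂D₁ = ∗-cancelˡ E (unitConstant⇒nonZero E-unit)
        (combine₃ (E ∗ D₁) (D₁ ∗ (B ∗ x̂)) (B ∗ x̂)
          (J-step (suc (l + l))) J₁E (r-addition l l)
          (solve 6 (λ x r A B J₁ J₂ →
            let y = x :* x ; E = 𝟏 :- x :* r ; q = 𝟏 :- y :* r ; D₁ = q :- y :* r in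
            E :* (J₂ :* D₁)
            :+ ((E :* D₁) :* (B :* (𝟏 :+ x :* J₁)) :+ (D₁ :* (B :* x)) :* A :+ (B :* x) :* (𝟏 :- y :* (r :* r)))
            := E :* (B :* (q :+ x))
            :+ ((E :* D₁) :* J₂ :+ (D₁ :* (B :* x)) :* (J₁ :* E) :+ (B :* x) :* (A :* D₁)))
            (λ _ → refl) x̂ r₀ A B J₁ J₂))

      J₂D₁D₂ : J₂ ∗ (D₁ ∗ D₂) ≗ U ∗ W
      J₂D₁D₂ = combine₂ D₂ W J₂D₁ (r-addition l (suc l))
        (solve 6 (λ J₂ D₁ D₂ B U W →
          J₂ :* (D₁ :* D₂) :+ (D₂ :* (B :* W) :+ W :* U)
          := U :* W :+ (D₂ :* (J₂ :* D₁) :+ W :* (B :* D₂)))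
          (λ _ → refl) J₂ D₁ D₂ B U W)

      r′q : r′ ∗ q ≗ 1ˢ
      r′q = r-inverse l

      qU : q ∗ U ≗ D₁
      qU = combine₁ (⊟ (x² ∗ r₀)) r′q
        (solve 3 (λ y r r′ → let q = 𝟏 :- y :* r in
          q :* (𝟏 :- y :* (r′ :* r)) :+ (:- (y :* r)) :* 𝟏
          := (q :- y :* r) :+ (:- (y :* r)) :* (r′ :* q))
          (λ _ → refl) x² r₀ r′)

      qV : q ∗ V ≗ q ⊝ x̂
      qV = combine₁ (⊟ x̂) r′q
        (solve 3 (λ x q r′ →
          q :* (𝟏 :- x :* r′) :+ (:- x) :* 𝟏 := (q :- x) :+ (:- x) :* (r′ :* q))
          (λ _ → refl) x̂ q r′)

      qD₂ : q ∗ D₂ ≗ q ∗ q ⊝ x²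
      qD₂ = combine₁ (⊟ x²) r′q
        (solve 3 (λ y r r′ → let q = 𝟏 :- y :* r in
          q :* ((𝟏 :- y :* r′) :- y :* r) :+ (:- y) :* 𝟏 := (q :* q :- y) :+ (:- y) :* (r′ :* q))
          (λ _ → refl) x² r₀ r′)

      -- Since r′ is the inverse of `q`, multiplying by q² leaves D₁ (q + x) (q - x); the other side
      -- produces the same difference of squares through q D₂.
      q²UWV : (q ∗ q) ∗ (U ∗ (W ∗ V)) ≗ D₁ ∗ (q ∗ q ⊝ x²)
      q²UWV = combine₂ (W ∗ (q ∗ V)) (W ∗ D₁) qU qV
        (solve 5 (λ x q U V D₁ →
          q :* q :* (U :* ((q :+ x) :* V)) :+ (((q :+ x) :* (q :* V)) :* D₁ :+ ((q :+ x) :* D₁) :* (q :- x))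
          := D₁ :* (q :* q :- x :* x)
          :+ (((q :+ x) :* (q :* V)) :* (q :* U) :+ ((q :+ x) :* D₁) :* (q :* V)))
          (λ _ → refl) x̂ q U V D₁)

      q²rD₁D₂ : (q ∗ q) ∗ (r′ ∗ (D₁ ∗ D₂)) ≗ D₁ ∗ (q ∗ q ⊝ x²)
      q²rD₁D₂ = combine₂ (D₁ ∗ (q ∗ D₂)) D₁ r′q qD₂
        (solve 5 (λ y q r′ D₁ D₂ →
          q :* q :* (r′ :* (D₁ :* D₂)) :+ ((D₁ :* (q :* D₂)) :* 𝟏 :+ D₁ :* (q :* q :- y))
          := D₁ :* (q :* q :- y) :+ ((D₁ :* (q :* D₂)) :* (r′ :* q) :+ D₁ :* (q :* D₂)))
          (λ _ → refl) x² q r′ D₁ D₂)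

      UWV : U ∗ (W ∗ V) ≗ r′ ∗ (D₁ ∗ D₂)
      UWV = ∗-cancelˡ (q ∗ q) (unitConstant⇒nonZero (unitConstant-∗ q-unit q-unit))
        (λ n → trans (q²UWV n) (sym (q²rD₁D₂ n)))

  -- As 1 - x² r_k is the inverse of r_{k+1}, the hypothesis says that F (1/r_{k+1} - x) = 1.
  quotient-r : ∀ k F → F ≗ 1ˢ ⊞ x̂ ∗ F ⊞ x² ∗ (r k ∗ F) → F ∗ (1ˢ ⊝ x̂ ∗ r (suc k)) ≗ r (suc k)
  quotient-r k F eq = combine₂ (r (suc k)) (⊟ F) eq (r-inverse k)
    (solve 4 (λ x F r r′ → let y = x :* x in
      F :* (𝟏 :- x :* r′) :+ (r′ :* (𝟏 :+ x :* F :+ y :* (r :* F)) :+ (:- F) :* 𝟏)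
      := r′ :+ (r′ :* F :+ (:- F) :* (r′ :* (𝟏 :- y :* r))))
      (λ _ → refl) x̂ F (r k) (r (suc k)))

  -- P k is x^k U_k(1 / 2x).
  P : ℕ → Series
  P zero          = 1ˢ
  P (suc zero)    = 1ˢ
  P (suc (suc k)) = P (suc k) ⊝ x² ∗ P k

  -- The `P k` are the continuants of the fraction: one level of it corresponds to one step of their
  -- three-term recurrence.
  P-r : ∀ k → P (suc k) ∗ r (suc k) ≗ P k
  P-r zero = combine₂ 1ˢ (x² ∗ r 1) (r-suc 0) r-zero
    (solve 3 (λ y r₀ r₁ →
      𝟏 :* r₁ :+ (𝟏 :* (𝟏 :+ y :* (r₀ :* r₁)) :+ (y :* r₁) :* con 0ℤ)
      := 𝟏 :+ (𝟏 :* r₁ :+ (y :* r₁) :* r₀))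
      (λ _ → refl) x² (r 0) (r 1))
  P-r (suc k) = combine₂ (P (suc k)) (x² ∗ r (suc (suc k))) (r-inverse (suc k)) (P-r k)
    (solve 5 (λ y P₀ P₁ r₁ r₂ →
      (P₁ :- y :* P₀) :* r₂ :+ (P₁ :* 𝟏 :+ (y :* r₂) :* P₀)
      := P₁ :+ (P₁ :* (r₂ :* (𝟏 :- y :* r₁)) :+ (y :* r₂) :* (P₁ :* r₁)))
      (λ _ → refl) x² (P k) (P (suc k)) (r (suc k)) (r (suc (suc k))))

  P-unit : ∀ k → HasUnitConstant (P k)
  P-unit zero          = 1ˢ-unit
  P-unit (suc zero)    = 1ˢ-unit
  P-unit (suc (suc k)) = unitConstant-⊝ (P k) (P-unit (suc k)) refl

  quotient-P : ∀ k F → F ∗ (1ˢ ⊝ x̂ ∗ r (suc k)) ≗ r (suc k) → F ∗ (P (suc k) ⊝ x̂ ∗ P k) ≗ P k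
  quotient-P k F eq = combine₂ (P (suc k)) (1ˢ ⊞ F ∗ x̂) eq (P-r k)
    (solve 5 (λ x F r P₀ P₁ →
      F :* (P₁ :- x :* P₀) :+ (P₁ :* r :+ (𝟏 :+ F :* x) :* P₀)
      := P₀ :+ (P₁ :* (F :* (𝟏 :- x :* r)) :+ (𝟏 :+ F :* x) :* (P₁ :* r)))
      (λ _ → refl) x̂ F (r (suc k)) (P k) (P (suc k)))

-- Expansion of rational functions

-- `p` equals N/D among fractions of power series. Any such N and D will do, so fractions can be
-- reduced after each operation instead of tracking the unreduced polynomials of `RatFun`.
record Represents (p : RatFun) (N D : Series) : Set where
  constructor rep
  field
    nonZero : NonZeroSeries D
    cross   : coeff (num p) ∗ D ≗ N ∗ coeff (den p)

open Represents

∗-nz : ∀ {f g} → NonZeroSeries f → NonZeroSeries g → NonZeroSeries (f ∗ g)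
∗-nz {f} {g} (i , fᵢ) (j , gⱼ) = ∗-nonZero f g i j fᵢ gⱼ

rep-cancel : ∀ {p N D N′ D′} → NonZeroSeries D′ → N ∗ D′ ≗ N′ ∗ D → Represents p N D → Represents p N′ D′
rep-cancel {p} {N} {D} {N′} {D′} nz′ eq (rep nz c) = rep nz′ (∗-cancelˡ D nz
  (combine₂ D′ d c eq
    (solve 6 (λ n d N D N′ D′ →
      D :* (n :* D′) :+ (D′ :* (N :* d) :+ d :* (N′ :* D))
      := D :* (N′ :* d) :+ (D′ :* (n :* D) :+ d :* (N :* D′)))
      (λ _ → refl) n d N D N′ D′)))
  where
  n = coeff (num p)
  d = coeff (den p)

rep-+ : ∀ {p q N D N′ D′} → Represents p N D → Represents q N′ D′ →
        Represents (p +ʳ q) (N ∗ D′ ⊞ N′ ∗ D) (D ∗ D′)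
rep-+ {p} {q} {N} {D} {N′} {D′} (rep nz c) (rep nz′ c′) = rep (∗-nz nz nz′)
  λ i → trans (∗-cong {g = D ∗ D′} num-eq (λ _ → refl) i)
       (trans (main i) (sym (∗-cong {N ∗ D′ ⊞ N′ ∗ D} (λ _ → refl) (coeff-* (den p) (den q)) i)))
  where
  n = coeff (num p)
  d = coeff (den p)
  n′ = coeff (num q)
  d′ = coeff (den q)
  num-eq : coeff (num p *ₚ den q +ₚ num q *ₚ den p) ≗ n ∗ d′ ⊞ n′ ∗ d
  num-eq i = trans (coeff-+ (num p *ₚ den q) (num q *ₚ den p) i)
    (cong₂ ℤ._+_ (coeff-* (num p) (den q) i) (coeff-* (num q) (den p) i))
  main : (n ∗ d′ ⊞ n′ ∗ d) ∗ (D ∗ D′) ≗ (N ∗ D′ ⊞ N′ ∗ D) ∗ (d ∗ d′)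
  main = combine₂ (d′ ∗ D′) (d ∗ D) c c′
    (solve 8 (λ n d n′ d′ N D N′ D′ →
      (n :* d′ :+ n′ :* d) :* (D :* D′) :+ ((d′ :* D′) :* (N :* d) :+ (d :* D) :* (N′ :* d′))
      := (N :* D′ :+ N′ :* D) :* (d :* d′) :+ ((d′ :* D′) :* (n :* D) :+ (d :* D) :* (n′ :* D′)))
      (λ _ → refl) n d n′ d′ N D N′ D′)

rep-* : ∀ {p q N D N′ D′} → Represents p N D → Represents q N′ D′ →
        Represents (p *ʳ q) (N ∗ N′) (D ∗ D′)
rep-* {p} {q} {N} {D} {N′} {D′} (rep nz c) (rep nz′ c′) = rep (∗-nz nz nz′)
  λ i → trans (∗-cong {g = D ∗ D′} (coeff-* (num p) (num q)) (λ _ → refl) i)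
       (trans (main i) (sym (∗-cong {N ∗ N′} (λ _ → refl) (coeff-* (den p) (den q)) i)))
  where
  n = coeff (num p)
  d = coeff (den p)
  n′ = coeff (num q)
  d′ = coeff (den q)
  main : (n ∗ n′) ∗ (D ∗ D′) ≗ (N ∗ N′) ∗ (d ∗ d′)
  main = combine₂ (n′ ∗ D′) (N ∗ d) c c′
    (solve 8 (λ n d n′ d′ N D N′ D′ →
      (n :* n′) :* (D :* D′) :+ ((n′ :* D′) :* (N :* d) :+ (N :* d) :* (N′ :* d′))
      := (N :* N′) :* (d :* d′) :+ ((n′ :* D′) :* (n :* D) :+ (N :* d) :* (n′ :* D′)))
      (λ _ → refl) n d n′ d′ N D N′ D′)

coeff-neg : ∀ p n → coeff (-ₚ p) n ≡ ℤ.- coeff p n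
coeff-neg []      n       = refl
coeff-neg (a ∷ p) zero    = refl
coeff-neg (a ∷ p) (suc n) = coeff-neg p n

rep-neg : ∀ {p N D} → Represents p N D → Represents (-ʳ p) (⊟ N) D
rep-neg {p} {N} {D} (rep nz c) = rep nz λ i →
  trans (∗-cong {g = D} (coeff-neg (num p)) (λ _ → refl) i) (main i)
  where
  n = coeff (num p)
  d = coeff (den p)
  main : (⊟ n) ∗ D ≗ (⊟ N) ∗ d
  main = combine₁ (⊟ 1ˢ) c
    (solve 4 (λ n d N D → (:- n) :* D :+ (:- 𝟏) :* (N :* d) := (:- N) :* d :+ (:- 𝟏) :* (n :* D))
      (λ _ → refl) n d N D)

rep-inv : ∀ {p N D} → NonZeroSeries N → Represents p N D → Represents (p ⁻¹ʳ) D N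
rep-inv {p} {N} {D} nzN (rep nz c) with nonZeroPoly? (num p)
... | yes nzn = rep nzN λ i → trans (∗-comm (coeff (den p)) N i)
                  (trans (sym (c i)) (∗-comm (coeff (num p)) D i))
-- A zero numerator would make `N ∗ coeff (den p)` vanish, although both factors are nonzero; so the
-- convention 0⁻¹ = 0 never applies.
... | no ¬nzn with ∗-nz nzN (den-nz p)
...   | i , nz′ = contradiction (trans (sym (c i)) (trans (∗-cong {g = D} vanish (λ _ → refl) i) (∗-zeroˡ D i))) nz′
  where
  vanish : ∀ j → coeff (num p) j ≡ 0ℤ
  vanish j with coeff (num p) j ℤ.≟ 0ℤ
  ... | yes e = e
  ... | no ne = contradiction (j , ne) ¬nzn

rep-/ : ∀ {p q N D N′ D′} → NonZeroSeries N′ → Represents p N D → Represents q N′ D′ →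
        Represents (p /ʳ q) (N ∗ D′) (D ∗ N′)
rep-/ nz p q = rep-* p (rep-inv nz q)

1ˢ-nz : NonZeroSeries 1ˢ
1ˢ-nz = 0 , λ ()

x̂-nz : NonZeroSeries x̂
x̂-nz = 1 , λ ()

rep-1 : Represents 1ʳ 1ˢ 1ˢ
rep-1 = rep 1ˢ-nz (∗-comm (coeff (1ℤ ∷ [])) 1ˢ)

rep-X : Represents X x̂ 1ˢ
rep-X = rep 1ˢ-nz λ i → trans (∗-cong {g = 1ˢ} coeff-X (λ _ → refl) i)
                              (∗-cong {x̂} (λ _ → refl) (λ { zero → refl ; (suc _) → refl }) i)
  where
  coeff-X : coeff (0ℤ ∷ 1ℤ ∷ []) ≗ x̂
  coeff-X zero          = refl
  coeff-X (suc zero)    = refl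
  coeff-X (suc (suc n)) = refl

2ˢ : Series
2ˢ = 1ˢ ⊞ 1ˢ

rep-2 : Represents 2ʳ 2ˢ 1ˢ
rep-2 = rep-cancel 1ˢ-nz (solve 0 ((𝟏 :* 𝟏 :+ 𝟏 :* 𝟏) :* 𝟏 := (𝟏 :+ 𝟏) :* (𝟏 :* 𝟏)) (λ _ → refl))
          (rep-+ rep-1 rep-1)

-- t = 1 / 2√x at √x = X.
t : RatFun
t = 1ʳ /ʳ (2ʳ *ʳ X)

rep-2t : Represents (2ʳ *ʳ t) 1ˢ x̂
rep-2t = rep-cancel x̂-nz
  (solve 1 (λ x → (𝟏 :+ 𝟏) :* (𝟏 :* (𝟏 :* 𝟏)) :* x := 𝟏 :* (𝟏 :* (𝟏 :* ((𝟏 :+ 𝟏) :* x)))) (λ _ → refl) x̂)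
  (rep-* rep-2 (rep-/ (∗-nz {2ˢ} {x̂} (0 , λ ()) x̂-nz) rep-1 (rep-* rep-2 rep-X)))

module _ (r : ℕ → Series) (r-zero : r 0 ≗ const 0ℤ)
  (r-suc : ∀ k → r (suc k) ≗ 1ˢ ⊞ x² ∗ (r k ∗ r (suc k))) where
  open Continuants r r-zero r-suc
  open Chebyshev ratFunRawRing using (U)

  private
    x^ : ℕ → Series
    x^ zero    = 1ˢ
    x^ (suc k) = x̂ ∗ x^ k

    x^-nz : ∀ k → NonZeroSeries (x^ k)
    x^-nz zero    = 1ˢ-nz
    x^-nz (suc k) = ∗-nz x̂-nz (x^-nz k)

    P-nz : ∀ k → NonZeroSeries (P k)
    P-nz k = unitConstant⇒nonZero (P-unit k)

  rep-U : ∀ k → Represents (U k t) (P k) (x^ k)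
  rep-U zero          = rep-1
  rep-U (suc zero)    = rep-cancel (x^-nz 1)
    (solve 1 (λ x → 𝟏 :* (x :* 𝟏) := 𝟏 :* x) (λ _ → refl) x̂) rep-2t
  rep-U (suc (suc k)) = rep-cancel (x^-nz (suc (suc k)))
    (solve 4 (λ x P₀ P₁ w →
      ((𝟏 :* P₁) :* w :+ (:- P₀) :* (x :* (x :* w))) :* (x :* (x :* w))
      := (P₁ :- x :* x :* P₀) :* ((x :* (x :* w)) :* w))
      (λ _ → refl) x̂ (P k) (P (suc k)) (x^ k))
    (rep-+ (rep-* rep-2t (rep-U (suc k))) (rep-neg (rep-U k)))

  -- The factor 2t = 1/x makes up for the different powers of x below `P k` and `P (suc k)`.
  rep-R : ∀ k → Represents (R (suc k) X² √X²) (P k) (P (suc k))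
  rep-R k = rep-cancel (P-nz (suc k))
    (solve 4 (λ x P₀ P₁ w →
      ((𝟏 :* P₀) :* (x :* w)) :* P₁ := P₀ :* ((x :* w) :* P₁))
      (λ _ → refl) x̂ (P k) (P (suc k)) (x^ k))
    (rep-/ (P-nz (suc k)) (rep-* rep-2t (rep-U k)) (rep-U (suc k)))

  denominator-nz : ∀ k → NonZeroSeries (P (suc k) ⊝ x̂ ∗ P k)
  denominator-nz k = unitConstant⇒nonZero (unitConstant-⊝ (P k) (P-unit (suc k)) refl)

  rep-quotient : ∀ k → Represents (R (suc k) X² √X² /ʳ (1ʳ -ʳ X *ʳ R (suc k) X² √X²))
                                  (P k) (P (suc k) ⊝ x̂ ∗ P k)
  rep-quotient k = rep-cancel (denominator-nz k)
    (solve 3 (λ x P₀ P₁ → (P₀ :* P₁) :* (P₁ :- x :* P₀) := P₀ :* (P₁ :* (P₁ :- x :* P₀)))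
      (λ _ → refl) x̂ (P k) (P (suc k)))
    (rep-/ (denominator-nz k) (rep-R k)
      (rep-cancel (P-nz (suc k))
        (solve 3 (λ x P₀ P₁ →
          (𝟏 :* (𝟏 :* P₁) :+ (:- (x :* P₀)) :* 𝟏) :* P₁ := (P₁ :- x :* P₀) :* (𝟏 :* (𝟏 :* P₁)))
          (λ _ → refl) x̂ (P k) (P (suc k)))
        (rep-+ rep-1 (rep-neg (rep-* rep-X (rep-R k))))))

  -- `F` and `Q` are both the fraction `P k` over `D`, so `d ∗ F` and `n` agree after multiplication
  -- by `D`.
  expansion : ∀ k F → F ∗ (1ˢ ⊝ x̂ ∗ r (suc k)) ≗ r (suc k) →
              F IsExpansionOf (R (suc k) X² √X² /ʳ (1ʳ -ʳ X *ʳ R (suc k) X² √X²))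
  expansion k F eq = ∗-cancelˡ D (denominator-nz k)
    (combine₂ d (⊟ 1ˢ) (quotient-P k F eq) (cross (rep-quotient k))
      (solve 5 (λ n d D N F →
        D :* (d :* F) :+ (d :* N :+ (:- 𝟏) :* (N :* d))
        := D :* n :+ (d :* (F :* D) :+ (:- 𝟏) :* (n :* D)))
        (λ _ → refl) n d D (P k) F))
    where
    D = P (suc k) ⊝ x̂ ∗ P k
    Q = R (suc k) X² √X² /ʳ (1ʳ -ʳ X *ʳ R (suc k) X² √X²)
    n = coeff (num Q)
    d = coeff (den Q)

-- Counting by patterns

data Pattern : Set where
  ∅    : Pattern
  top  : Pattern → Pattern
  twin : Pattern → Pattern → Pattern

⟦_⟧ᵖ : Pattern → Biposet
⟦ ∅ ⟧ᵖ        = 𝟘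
⟦ top p ⟧ᵖ    = ⟦ p ⟧ᵖ ⊕ 𝟙
⟦ twin p q ⟧ᵖ = (⟦ p ⟧ᵖ ⊕ 𝟙) ⊖ (⟦ q ⟧ᵖ ⊕ 𝟙)

-- The number of points, bracketed to match the index `suc (j + p)` of `r-unique` with
-- `suc (order q)` for `p`.
order : Pattern → ℕ
order ∅          = 0
order (top p)    = suc (order p)
order (twin p q) = suc (order p + suc (order q))

chain : ℕ → Pattern
chain zero    = ∅
chain (suc k) = top (chain k)

private
  ⊕𝟙-left : ∀ {K A B} → K ≼ A → K ⊕ 𝟙 ≼ (A ⊕ 𝟙) ⊖ B
  ⊕𝟙-left f = ≼-trans (⊕-mono f ≼-refl) (emb ⊖-left)

  into-left : ∀ {X A B} → X ≼ A → X ≼ (A ⊕ 𝟙) ⊖ B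
  into-left f = ≼-trans f (≼-trans (emb ⊕-left) (emb ⊖-left))

  into-right : ∀ {X A B} → X ≼ B → X ≼ A ⊖ B
  into-right f = ≼-trans f (emb ⊖-right)

  twin-occurs : ∀ {K M A B} → let X = (K ⊕ 𝟙) ⊖ (M ⊕ 𝟙) in
                X ≼ (A ⊕ 𝟙) ⊖ B → X ≼ A ⊎ X ≼ B ⊎ (K ≼ A × M ⊕ 𝟙 ≼ B)
  twin-occurs f = Sum.map twin≼⊕𝟙 (Sum.map₂ (λ (g , h) → ⊕𝟙-cancel g , h)) (twin≼⊖ f)

occursᵗ? : ∀ p t → Dec (⟦ p ⟧ᵖ ≼ ⟦ t ⟧ᵗ)
occursᵗ? ∅          t          = yes 𝟘-least
occursᵗ? (top p)    leaf       = no λ f → fun f (inj₂ tt)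
occursᵗ? (twin p q) leaf       = no λ f → fun f (inj₂ (inj₂ tt))
occursᵗ? (top p)    (node L R) = map′ [ ⊕𝟙-left , into-right ]
  (λ f → Sum.map₁ ⊕𝟙-cancel (⊕𝟙≼⊖ f)) (occursᵗ? p L ⊎-dec occursᵗ? (top p) R)
occursᵗ? (twin p q) (node L R) = map′
  [ into-left , [ into-right , (λ (f , g) → ⊖-mono (⊕-mono f ≼-refl) g) ] ]
  twin-occurs
  (occursᵗ? (twin p q) L ⊎-dec (occursᵗ? (twin p q) R ⊎-dec (occursᵗ? p L ×-dec occursᵗ? (top q) R)))

avoid : ∀ {A : Set} → Dec A → ℤ
avoid (yes _) = 0ℤ
avoid (no  _) = 1ℤ

avoid-cong : ∀ {A B : Set} → (A → B) → (B → A) → (a? : Dec A) (b? : Dec B) → avoid a? ≡ avoid b?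
avoid-cong f g (yes a) (yes b) = refl
avoid-cong f g (yes a) (no ¬b) = contradiction (f a) ¬b
avoid-cong f g (no ¬a) (yes b) = contradiction (g b) ¬a
avoid-cong f g (no ¬a) (no ¬b) = refl

avoid-no : ∀ {A : Set} → ¬ A → (a? : Dec A) → avoid a? ≡ 1ℤ
avoid-no ¬a (yes a) = contradiction a ¬a
avoid-no ¬a (no _)  = refl

avoid-⊎ : ∀ {A B : Set} (a? : Dec A) (b? : Dec B) → avoid (a? ⊎-dec b?) ≡ avoid a? ℤ.* avoid b?
avoid-⊎ (yes _) b?      = sym (ℤ.*-zeroˡ (avoid b?))
avoid-⊎ (no _)  (yes _) = refl
avoid-⊎ (no _)  (no _)  = refl

-- The split is on whether the first half occurs in the left subtree (`A`). If not, the right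
-- subtree has to avoid the twin (`Y`). If so, the left subtree still has to avoid the twin (`X`)
-- and the right one even its second half (`B`).
avoid-twin : ∀ {X Y A B : Set} → (X → A) → (Y → B) →
  (x? : Dec X) (y? : Dec Y) (a? : Dec A) (b? : Dec B) → avoid (x? ⊎-dec (y? ⊎-dec (a? ×-dec b?)))
  ≡ avoid a? ℤ.* avoid y? ℤ.+ (avoid x? ℤ.- avoid a?) ℤ.* avoid b?
avoid-twin f g (yes x) _       (no ¬a) _       = contradiction (f x) ¬a
avoid-twin f g _       (yes y) _       (no ¬b) = contradiction (g y) ¬b
avoid-twin f g (yes _) (yes _) (yes _) (yes _) = refl
avoid-twin f g (yes _) (no _)  (yes _) (yes _) = refl
avoid-twin f g (yes _) (no _)  (yes _) (no _)  = refl
avoid-twin f g (no _)  (yes _) (yes _) (yes _) = refl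
avoid-twin f g (no _)  (yes _) (no _)  (yes _) = refl
avoid-twin f g (no _)  (no _)  (yes _) (yes _) = refl
avoid-twin f g (no _)  (no _)  (yes _) (no _)  = refl
avoid-twin f g (no _)  (no _)  (no _)  (yes _) = refl
avoid-twin f g (no _)  (no _)  (no _)  (no _)  = refl

χ : Pattern → Tree → ℤ
χ p t = avoid (occursᵗ? p t)

χ-top : ∀ p L R → χ (top p) (node L R) ≡ χ p L ℤ.* χ (top p) R
χ-top p L R = trans
  (avoid-cong (λ f → Sum.map₁ ⊕𝟙-cancel (⊕𝟙≼⊖ f)) [ ⊕𝟙-left , into-right ] _
    (occursᵗ? p L ⊎-dec occursᵗ? (top p) R))
  (avoid-⊎ (occursᵗ? p L) (occursᵗ? (top p) R))

χ-twin : ∀ p q L R → χ (twin p q) (node L R)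
         ≡ χ p L ℤ.* χ (twin p q) R ℤ.+ (χ (twin p q) L ℤ.- χ p L) ℤ.* χ (top q) R
χ-twin p q L R = trans
  (avoid-cong twin-occurs [ into-left , [ into-right , (λ (f , g) → ⊖-mono (⊕-mono f ≼-refl) g) ] ] _
    (occursᵗ? (twin p q) L ⊎-dec (occursᵗ? (twin p q) R ⊎-dec (occursᵗ? p L ×-dec occursᵗ? (top q) R))))
  (avoid-twin (≼-trans (≼-trans (emb ⊕-left) (emb ⊖-left))) (≼-trans (emb ⊖-right))
    (occursᵗ? (twin p q) L) (occursᵗ? (twin p q) R) (occursᵗ? p L) (occursᵗ? (top q) R))

-- Sums over lists and their generating functions

total : ∀ {A : Set} → (A → ℤ) → List A → ℤ
total φ []       = 0ℤ
total φ (a ∷ as) = φ a ℤ.+ total φ as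

module _ {A : Set} where
  total-cong : ∀ {φ ψ : A → ℤ} → φ ≗ ψ → ∀ as → total φ as ≡ total ψ as
  total-cong eq []       = refl
  total-cong eq (a ∷ as) = cong₂ ℤ._+_ (eq a) (total-cong eq as)

  total-0 : ∀ as → total {A} (λ _ → 0ℤ) as ≡ 0ℤ
  total-0 []       = refl
  total-0 (a ∷ as) = trans (ℤ.+-identityˡ _) (total-0 as)

  total-++ : ∀ (φ : A → ℤ) as bs → total φ (as ++ bs) ≡ total φ as ℤ.+ total φ bs
  total-++ φ []       bs = sym (ℤ.+-identityˡ _)
  total-++ φ (a ∷ as) bs = trans (cong (ℤ._+_ (φ a)) (total-++ φ as bs)) (sym (ℤ.+-assoc (φ a) _ _))

  total-map : ∀ {B : Set} (φ : B → ℤ) (f : A → B) as → total φ (map f as) ≡ total (φ ∘ f) as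
  total-map φ f []       = refl
  total-map φ f (a ∷ as) = cong (ℤ._+_ (φ (f a))) (total-map φ f as)

  total-- : ∀ (φ ψ : A → ℤ) as → total (λ a → φ a ℤ.- ψ a) as ≡ total φ as ℤ.- total ψ as
  total-- φ ψ []       = refl
  total-- φ ψ (a ∷ as) = trans (cong (ℤ._+_ (φ a ℤ.- ψ a)) (total-- φ ψ as))
    (regroup (φ a) (ψ a) (total φ as) (total ψ as))
    where
    regroup : ∀ a b c d → (a ℤ.- b) ℤ.+ (c ℤ.- d) ≡ (a ℤ.+ c) ℤ.- (b ℤ.+ d)
    regroup = ℤ-Solver.solve-∀

  total-linear : ∀ k l (φ ψ : A → ℤ) as →
                 total (λ a → k ℤ.* φ a ℤ.+ l ℤ.* ψ a) as ≡ k ℤ.* total φ as ℤ.+ l ℤ.* total ψ as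
  total-linear k l φ ψ []       = sym (cong₂ ℤ._+_ (ℤ.*-zeroʳ k) (ℤ.*-zeroʳ l))
  total-linear k l φ ψ (a ∷ as) = trans (cong (ℤ._+_ (k ℤ.* φ a ℤ.+ l ℤ.* ψ a)) (total-linear k l φ ψ as))
    (regroup k l (φ a) (ψ a) (total φ as) (total ψ as))
    where
    regroup : ∀ k l a b c d → (k ℤ.* a ℤ.+ l ℤ.* b) ℤ.+ (k ℤ.* c ℤ.+ l ℤ.* d)
                              ≡ k ℤ.* (a ℤ.+ c) ℤ.+ l ℤ.* (b ℤ.+ d)
    regroup = ℤ-Solver.solve-∀

  total-avoid : ∀ {P : A → Set} (P? : Decidable P) as →
                ℤ.+ length (filter (¬? ∘ P?) as) ≡ total (avoid ∘ P?) as
  total-avoid P? []       = refl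
  total-avoid P? (a ∷ as) with P? a
  ... | yes _ = trans (total-avoid P? as) (sym (ℤ.+-identityˡ _))
  ... | no  _ = cong (ℤ._+_ 1ℤ) (total-avoid P? as)

Total[_] : ∀ {A : Set} → (A → ℤ) → (ℕ → List A) → Series
Total[ φ ] as n = total φ (as n)

module _ {A B C : Set} {f : A → B → C} {φ : C → ℤ} {α γ : A → ℤ} {β δ : B → ℤ}
         (φ-f : ∀ a b → φ (f a b) ≡ α a ℤ.* β b ℤ.+ γ a ℤ.* δ b) where
  total-product : ∀ as bs → total φ (cartesianProductWith f as bs)
                            ≡ total α as ℤ.* total β bs ℤ.+ total γ as ℤ.* total δ bs
  total-product []       bs = refl
  total-product (a ∷ as) bs = begin
    total φ (map (f a) bs ++ cartesianProductWith f as bs)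
      ≡⟨ total-++ φ (map (f a) bs) _ ⟩
    total φ (map (f a) bs) ℤ.+ total φ (cartesianProductWith f as bs)
      ≡⟨ cong₂ ℤ._+_ (trans (total-map φ (f a) bs)
           (trans (total-cong (φ-f a) bs) (total-linear (α a) (γ a) β δ bs))) (total-product as bs) ⟩
    α a ℤ.* total β bs ℤ.+ γ a ℤ.* total δ bs ℤ.+ (total α as ℤ.* total β bs ℤ.+ total γ as ℤ.* total δ bs)
      ≡⟨ regroup (α a) (γ a) (total α as) (total γ as) (total β bs) (total δ bs) ⟩
    (α a ℤ.+ total α as) ℤ.* total β bs ℤ.+ (γ a ℤ.+ total γ as) ℤ.* total δ bs ∎
    where
    open ≡-Reasoning
    regroup : ∀ a c s t b d → a ℤ.* b ℤ.+ c ℤ.* d ℤ.+ (s ℤ.* b ℤ.+ t ℤ.* d)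
                              ≡ (a ℤ.+ s) ℤ.* b ℤ.+ (c ℤ.+ t) ℤ.* d
    regroup = ℤ-Solver.solve-∀

  total-conv₂ : ∀ as bs → Total[ φ ] (conv f as bs)
                ≗ (Total[ α ] as ∗ Total[ β ] bs) ⊞ (Total[ γ ] as ∗ Total[ δ ] bs)
  total-conv₂ as bs zero    = total-product (as 0) (bs 0)
  total-conv₂ as bs (suc n) = begin
    total φ (cartesianProductWith f (as 0) (bs (suc n)) ++ conv f (as ∘ suc) bs n)
      ≡⟨ total-++ φ (cartesianProductWith f (as 0) (bs (suc n))) _ ⟩
    total φ (cartesianProductWith f (as 0) (bs (suc n))) ℤ.+ total φ (conv f (as ∘ suc) bs n)
      ≡⟨ cong₂ ℤ._+_ (total-product (as 0) (bs (suc n))) (total-conv₂ (as ∘ suc) bs n) ⟩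
    a ℤ.+ c ℤ.+ ((Total[ α ] (as ∘ suc) ∗ Total[ β ] bs) n ℤ.+ (Total[ γ ] (as ∘ suc) ∗ Total[ δ ] bs) n)
      ≡⟨ regroup a c _ _ ⟩
    a ℤ.+ (Total[ α ] (as ∘ suc) ∗ Total[ β ] bs) n ℤ.+ (c ℤ.+ (Total[ γ ] (as ∘ suc) ∗ Total[ δ ] bs) n) ∎
    where
    open ≡-Reasoning
    a = total α (as 0) ℤ.* total β (bs (suc n))
    c = total γ (as 0) ℤ.* total δ (bs (suc n))
    regroup : ∀ a c s t → a ℤ.+ c ℤ.+ (s ℤ.+ t) ≡ a ℤ.+ s ℤ.+ (c ℤ.+ t)
    regroup = ℤ-Solver.solve-∀

total-conv : ∀ {A B C : Set} {f : A → B → C} {φ : C → ℤ} {α : A → ℤ} {β : B → ℤ} →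
             (∀ a b → φ (f a b) ≡ α a ℤ.* β b) →
             ∀ as bs → Total[ φ ] (conv f as bs) ≗ Total[ α ] as ∗ Total[ β ] bs
total-conv {α = α} {β} φ-f as bs n = trans
  (total-conv₂ {γ = λ _ → 0ℤ} {δ = λ _ → 0ℤ} (λ a b → trans (φ-f a b) (sym (ℤ.+-identityʳ _))) as bs n)
  (trans (cong (ℤ._+_ ((Total[ α ] as ∗ Total[ β ] bs) n))
      (trans (∗-cong {g = Total[ (λ _ → 0ℤ) ] bs} (λ i → total-0 (as i)) (λ _ → refl) n) (∗-zeroˡ _ n)))
    (ℤ.+-identityʳ _))

x²-∗ : ∀ f → x² ∗ f ≗ x̂ ∗ (x̂ ∗ f)
x²-∗ = ∗-assoc x̂ x̂

shift : ∀ {F G H : Series} → F 0 ≡ 1ℤ → F 1 ≡ G 0 → (∀ n → F (2 + n) ≡ G (suc n) ℤ.+ H n) →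
        F ≗ 1ˢ ⊞ x̂ ∗ G ⊞ x² ∗ H
shift {F} {G} {H} F₀ F₁ F₂ zero = trans F₀
  (sym (cong₂ (λ a b → 1ℤ ℤ.+ a ℤ.+ b) (x̂-∗-zero G) (trans (x²-∗ H 0) (x̂-∗-zero (x̂ ∗ H)))))
shift {F} {G} {H} F₀ F₁ F₂ (suc zero) = trans F₁ (trans (sym (trans (ℤ.+-identityʳ _) (ℤ.+-identityˡ (G 0))))
  (sym (cong₂ (λ a b → 0ℤ ℤ.+ a ℤ.+ b) (x̂-∗-suc G 0)
    (trans (x²-∗ H 1) (trans (x̂-∗-suc (x̂ ∗ H) 0) (x̂-∗-zero H))))))
shift {F} {G} {H} F₀ F₁ F₂ (suc (suc n)) = trans (F₂ n)
  (trans (cong (λ a → a ℤ.+ H n) (sym (ℤ.+-identityˡ (G (suc n)))))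
  (sym (cong₂ (λ a b → 0ℤ ℤ.+ a ℤ.+ b) (x̂-∗-suc G (suc n))
    (trans (x²-∗ H (2 + n)) (trans (x̂-∗-suc (x̂ ∗ H) (suc n)) (x̂-∗-suc H n))))))

shift₂ : ∀ {F H : Series} → F 0 ≡ 1ℤ → F 1 ≡ 0ℤ → (∀ n → F (2 + n) ≡ H n) → F ≗ 1ˢ ⊞ x² ∗ H
shift₂ {F} {H} F₀ F₁ F₂ n = trans
  (shift {F} {const 0ℤ} {H} F₀ F₁ (λ n → trans (F₂ n) (sym (ℤ.+-identityˡ _))) n)
  (solve 2 (λ x H → 𝟏 :+ x :* con 0ℤ :+ x :* x :* H := 𝟏 :+ x :* x :* H) (λ _ → refl) x̂ H n)

treeSeries : Pattern → Series
treeSeries p = Total[ χ p ] trees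

treeSeries-∅ : treeSeries ∅ ≗ const 0ℤ
treeSeries-∅ zero    = refl
treeSeries-∅ (suc n) = total-0 (trees (suc n))

treeSeries-top : ∀ p → treeSeries (top p) ≗ 1ˢ ⊞ x² ∗ (treeSeries p ∗ treeSeries (top p))
treeSeries-top p = shift₂ refl refl λ n →
  trans (cong (total (χ (top p))) (trees-step n)) (total-conv (χ-top p) trees trees n)

-- The increasing patterns serve as the reference family, because their recurrence is that of
-- R_k(x²); the doubled weight of trees supplies the argument x².
r : ℕ → Series
r k = treeSeries (chain k)

open Continuants r treeSeries-∅ (λ k → treeSeries-top (chain k)) public

treeSeries-twin : ∀ p q → let S = treeSeries (twin p q) ; K = treeSeries p in
                  S ≗ 1ˢ ⊞ x² ∗ ((K ∗ S) ⊞ ((S ⊝ K) ∗ treeSeries (top q)))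
treeSeries-twin p q = shift₂ refl refl λ n →
  trans (cong (total (χ (twin p q))) (trees-step n))
  (trans (total-conv₂ {γ = λ t → χ (twin p q) t ℤ.- χ p t} (χ-twin p q) trees trees n)
    (cong (ℤ._+_ ((treeSeries p ∗ treeSeries (twin p q)) n))
      (∗-cong {g = treeSeries (top q)} (λ i → total-- (χ (twin p q)) (χ p) (trees i)) (λ _ → refl) n)))

treeSeries-top≗r : ∀ p k → treeSeries p ≗ r k → treeSeries (top p) ≗ r (suc k)
treeSeries-top≗r p k eq = r-unique₁ k (treeSeries (top p)) λ n → trans (treeSeries-top p n)
  (cong (ℤ._+_ (1ˢ n)) (∗-cong {x²} (λ _ → refl) (∗-cong {g = treeSeries (top p)} eq (λ _ → refl)) n))

treeSeries≗r : ∀ p → treeSeries p ≗ r (order p)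
treeSeries≗r ∅ n        = refl
treeSeries≗r (top p)    = treeSeries-top≗r p (order p) (treeSeries≗r p)
treeSeries≗r (twin p q) = r-unique (order p) (suc (order q)) S λ n → trans (treeSeries-twin p q n)
  (trans (cong (ℤ._+_ (1ˢ n)) (∗-cong {x²} (λ _ → refl) (λ i → cong₂ ℤ._+_
      (∗-cong {g = S} (treeSeries≗r p) (λ _ → refl) i)
      (∗-cong (λ j → cong (λ z → S j ℤ.- z) (treeSeries≗r p j)) (treeSeries-top≗r q (order q) (treeSeries≗r q)) i)) n))
    (solve 4 (λ y S K M → 𝟏 :+ y :* (K :* S :+ (S :- K) :* M) := 𝟏 :+ y :* (K :* S) :+ y :* ((S :- K) :* M))
      (λ _ → refl) x² S (r (order p)) (r (suc (order q))) n))
  where S = treeSeries (twin p q)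

-- Generating functions of involutions avoiding a pattern

invSeries : ∀ {Y : Biposet} → (∀ t → Dec (Y ≼ ⟦ t ⟧ⁱ)) → Series
invSeries occurs = Total[ avoid ∘ occurs ] invTrees

module _ {Y Z : Biposet} {χʸ : Tree → ℤ}
  (y? : ∀ t → Dec (Y ≼ ⟦ t ⟧ⁱ)) (z? : ∀ t → Dec (Z ≼ ⟦ t ⟧ⁱ))
  (at-ε   : ¬ (Y ≼ 𝟘))
  (at-fix : ∀ b → avoid (y? (fix b)) ≡ avoid (z? b))
  (at-arc : ∀ g b → avoid (y? (arc g b)) ≡ χʸ g ℤ.* avoid (y? b)) where

  -- `Z` is what remains to be avoided when a final largest entry is removed: the pattern itself for
  -- a double wedge, the increasing pattern with one point less for a chain.
  invSeries-rec : invSeries y? ≗ 1ˢ ⊞ x̂ ∗ invSeries z? ⊞ x² ∗ (Total[ χʸ ] trees ∗ invSeries y?)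
  invSeries-rec = shift
    (cong (λ a → a ℤ.+ 0ℤ) (avoid-no at-ε (y? ε)))
    (cong (λ a → a ℤ.+ 0ℤ) (at-fix ε))
    λ n → trans (cong (total (avoid ∘ y?)) (invTrees-step n))
      (trans (total-++ (avoid ∘ y?) (map fix (invTrees (suc n))) _)
        (cong₂ ℤ._+_
          (trans (total-map (avoid ∘ y?) fix (invTrees (suc n))) (total-cong at-fix (invTrees (suc n))))
          (total-conv at-arc trees invTrees n)))

-- A pattern (K ⊕ 1) ⊖ (Kᵀ ⊕ 1) can only be created by an arc g whose left part contains K.
module _ {Y : Biposet} (K : Pattern) (Y≈ : Y ≈ᴮ (⟦ K ⟧ᵖ ⊕ 𝟙) ⊖ (⟦ K ⟧ᵖ ᵀ ⊕ 𝟙))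
         (y? : ∀ t → Dec (Y ≼ ⟦ t ⟧ⁱ)) where
  private
    in-fix : ∀ {B} → Y ≼ B ⊕ 𝟙 → Y ≼ B
    in-fix f = ≼-trans (proj₁ Y≈) (twin≼⊕𝟙 (≼-trans (proj₂ Y≈) f))

    transposed : ∀ {G} → ⟦ K ⟧ᵖ ᵀ ⊕ 𝟙 ≼ G ᵀ ⊕ 𝟙 → ⟦ K ⟧ᵖ ≼ G
    transposed f = ᵀ-mono (⊕𝟙-cancel f)

    -- Unless the whole pattern lies in β, one of its halves lies in γ, n or in γ⁻¹, j. Removing the
    -- corner leaves `K` in γ, in the second case after transposing.
    in-arc : ∀ {G B} → Y ≼ ((G ⊕ 𝟙) ⊖ B) ⊖ (G ᵀ ⊕ 𝟙) → ⟦ K ⟧ᵖ ≼ G ⊎ Y ≼ B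
    in-arc f with twin≼⊖ (≼-trans (proj₂ Y≈) f)
    ... | inj₂ (inj₁ g)       = inj₁ (transposed (≼-trans (emb ⊖-right) g))
    ... | inj₂ (inj₂ (_ , g)) = inj₁ (transposed g)
    ... | inj₁ g with twin≼⊖ g
    ...   | inj₁ h              = inj₁ (⊕𝟙-cancel (≼-trans (emb ⊖-left) h))
    ...   | inj₂ (inj₁ h)       = inj₂ (≼-trans (proj₁ Y≈) h)
    ...   | inj₂ (inj₂ (h , _)) = inj₁ (⊕𝟙-cancel h)

    -- One copy of `K` in γ is enough: its mirror image in γ⁻¹ supplies the second half of the
    -- pattern.
    to-arc : ∀ {G B} → ⟦ K ⟧ᵖ ≼ G ⊎ Y ≼ B → Y ≼ ((G ⊕ 𝟙) ⊖ B) ⊖ (G ᵀ ⊕ 𝟙)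
    to-arc (inj₁ f) = ≼-trans (proj₁ Y≈)
      (⊖-mono (≼-trans (⊕-mono f ≼-refl) (emb ⊖-left)) (⊕-mono (ᵀ-mono f) ≼-refl))
    to-arc (inj₂ f) = ≼-trans f (≼-trans (emb ⊖-right) (emb ⊖-left))

  doubleWedge-quotient : let r′ = r (suc (order K)) in invSeries y? ∗ (1ˢ ⊝ x̂ ∗ r′) ≗ r′
  doubleWedge-quotient = quotient-r (order K) (invSeries y?) λ n → trans
    (invSeries-rec {χʸ = χ K} y? y?
      (λ f → fun (≼-trans (proj₂ Y≈) f) (inj₂ (inj₂ tt)))
      (λ b → avoid-cong in-fix (λ f → ≼-trans f (emb ⊕-left)) (y? (fix b)) (y? b))
      (λ g b → trans (avoid-cong in-arc to-arc (y? (arc g b)) (occursᵗ? K g ⊎-dec y? b))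
                     (avoid-⊎ (occursᵗ? K g) (y? b))) n)
    (cong (ℤ._+_ ((1ˢ ⊞ x̂ ∗ invSeries y?) n)) (∗-cong {x²} (λ _ → refl)
      (∗-cong {g = invSeries y?} (treeSeries≗r K) (λ _ → refl)) n))

-- Lets an increasing sequence in γ⁻¹ be read as one in γ.
chain-ᵀ : ∀ k → ⟦ chain k ⟧ᵖ ≼ ⟦ chain k ⟧ᵖ ᵀ
chain-ᵀ zero    = 𝟘-least
chain-ᵀ (suc k) = ⊕-mono (chain-ᵀ k) ≼-refl

private
  chain-in-arc : ∀ k {G B} → ⟦ chain (suc k) ⟧ᵖ ≼ ((G ⊕ 𝟙) ⊖ B) ⊖ (G ᵀ ⊕ 𝟙) →
                 ⟦ chain k ⟧ᵖ ≼ G ⊎ ⟦ chain (suc k) ⟧ᵖ ≼ B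
  chain-in-arc k f with ⊕𝟙≼⊖ f
  ... | inj₂ g = inj₁ (≼-trans (chain-ᵀ k) (ᵀ-mono (⊕𝟙-cancel g)))
  ... | inj₁ g = Sum.map₁ ⊕𝟙-cancel (⊕𝟙≼⊖ g)

  chain-to-arc : ∀ k {G B} → ⟦ chain k ⟧ᵖ ≼ G ⊎ ⟦ chain (suc k) ⟧ᵖ ≼ B →
                 ⟦ chain (suc k) ⟧ᵖ ≼ ((G ⊕ 𝟙) ⊖ B) ⊖ (G ᵀ ⊕ 𝟙)
  chain-to-arc k (inj₁ f) = ≼-trans (⊕𝟙-left f) (emb ⊖-left)
  chain-to-arc k (inj₂ f) = ≼-trans f (≼-trans (emb ⊖-right) (emb ⊖-left))

chain-occurs? : ∀ k t → Dec (⟦ chain k ⟧ᵖ ≼ ⟦ t ⟧ⁱ)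
chain-occurs? zero    t         = yes 𝟘-least
chain-occurs? (suc k) ε         = no λ f → fun f (inj₂ tt)
chain-occurs? (suc k) (fix b)   = map′ (λ f → ⊕-mono f ≼-refl) ⊕𝟙-cancel (chain-occurs? k b)
chain-occurs? (suc k) (arc g b) =
  map′ (chain-to-arc k) (chain-in-arc k) (occursᵗ? (chain k) g ⊎-dec chain-occurs? (suc k) b)

chainSeries : ℕ → Series
chainSeries k = invSeries (chain-occurs? k)

chain-quotient : ∀ l → chainSeries (l + l) ∗ (1ˢ ⊝ x̂ ∗ r l) ≗ r l
chain-quotient = J-even chainSeries
  (λ { zero → refl ; (suc n) → total-0 (invTrees (suc n)) })
  λ k → invSeries-rec {χʸ = χ (chain k)} (chain-occurs? (suc k)) (chain-occurs? k)
    (λ f → fun f (inj₂ tt))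
    (λ b → avoid-cong ⊕𝟙-cancel (λ f → ⊕-mono f ≼-refl) (chain-occurs? (suc k) (fix b)) (chain-occurs? k b))
    (λ g b → trans
      (avoid-cong (chain-in-arc k) (chain-to-arc k) (chain-occurs? (suc k) (arc g b))
        (occursᵗ? (chain k) g ⊎-dec chain-occurs? (suc k) b))
      (avoid-⊎ (occursᵗ? (chain k) g) (chain-occurs? (suc k) b)))

-- Wedge words

data Index : List ℕ → Set where
  first : ∀ {x w} → Index (x ∷ w)
  next  : ∀ {x w} → Index w → Index (x ∷ w)

position : ∀ {w} → Index w → ℕ
position first    = 0
position (next i) = suc (position i)

entry : ∀ {w} → Index w → ℕ
entry (first {x}) = x
entry (next i)    = entry i

entry∈ : ∀ {w} (i : Index w) → entry i ∈ w
entry∈ first    = here refl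
entry∈ (next i) = there (entry∈ i)

position<length : ∀ {w} (i : Index w) → position i < length w
position<length first    = s≤s z≤n
position<length (next i) = s≤s (position<length i)

Word : List ℕ → Biposet
Word w = record
  { Carrier = Index w ; Pos = λ i j → position i < position j ; Val = λ i j → entry i < entry j }

Below : List ℕ → List ℕ → Set
Below u v = ∀ {x y} → x ∈ u → y ∈ v → x < y

left : ∀ {u} v → Index u → Index (u ++ v)
left v first    = first
left v (next i) = next (left v i)

right : ∀ u {v} → Index v → Index (u ++ v)
right []      j = j
right (x ∷ u) j = next (right u j)

splitᵂ : ∀ u {v} → Index (u ++ v) → Index u ⊎ Index v
splitᵂ []      k        = inj₂ k
splitᵂ (x ∷ u) first    = inj₁ first
splitᵂ (x ∷ u) (next k) = Sum.map₁ next (splitᵂ u k)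

position-left : ∀ {u} v (i : Index u) → position (left v i) ≡ position i
position-left v first    = refl
position-left v (next i) = cong suc (position-left v i)

position-right : ∀ u {v} (j : Index v) → position (right u j) ≡ length u + position j
position-right []      j = refl
position-right (x ∷ u) j = cong suc (position-right u j)

entry-left : ∀ {u} v (i : Index u) → entry (left v i) ≡ entry i
entry-left v first    = refl
entry-left v (next i) = entry-left v i

entry-right : ∀ u {v} (j : Index v) → entry (right u j) ≡ entry j
entry-right []      j = refl
entry-right (x ∷ u) j = entry-right u j

join-split : ∀ u v k → [ left v , right u ] (splitᵂ u {v} k) ≡ k
join-split []      v k        = refl
join-split (x ∷ u) v first    = refl
join-split (x ∷ u) v (next k) with splitᵂ u {v} k | join-split u v k
... | inj₁ i | eq = cong next eq
... | inj₂ j | eq = cong next eq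

module _ (u v : List ℕ) where
  private
    joinᵂ : Index u ⊎ Index v → Index (u ++ v)
    joinᵂ (inj₁ i) = left v i
    joinᵂ (inj₂ j) = right u j

    position′ entry′ : Index u ⊎ Index v → ℕ
    position′ (inj₁ i) = position i
    position′ (inj₂ j) = length u + position j
    entry′ (inj₁ i) = entry i
    entry′ (inj₂ j) = entry j

    position-join : ∀ x → position (joinᵂ x) ≡ position′ x
    position-join (inj₁ i) = position-left v i
    position-join (inj₂ j) = position-right u j

    entry-join : ∀ x → entry (joinᵂ x) ≡ entry′ x
    entry-join (inj₁ i) = entry-left v i
    entry-join (inj₂ j) = entry-right u j

    join-split′ : ∀ k → joinᵂ (splitᵂ u k) ≡ k
    join-split′ k with splitᵂ u k | join-split u v k
    ... | inj₁ i | eq = eq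
    ... | inj₂ j | eq = eq

    position-split : ∀ k → position′ (splitᵂ u k) ≡ position k
    position-split k = trans (sym (position-join (splitᵂ u k))) (cong position (join-split′ k))

    entry-split : ∀ k → entry′ (splitᵂ u k) ≡ entry k
    entry-split k = trans (sym (entry-join (splitᵂ u k))) (cong entry (join-split′ k))

    pos⇒ : ∀ x y → position′ x < position′ y → Pos (Word u ⊕ Word v) x y
    pos⇒ (inj₁ i) (inj₁ i′) p = p
    pos⇒ (inj₁ i) (inj₂ j)  p = tt
    pos⇒ (inj₂ j) (inj₁ i)  p =
      ℕ.<⇒≱ p (ℕ.≤-trans (ℕ.<⇒≤ (position<length i)) (ℕ.m≤m+n (length u) (position j)))
    pos⇒ (inj₂ j) (inj₂ j′) p = ℕ.+-cancelˡ-< (length u) _ _ p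

    pos⇐ : ∀ x y → Pos (Word u ⊕ Word v) x y → position′ x < position′ y
    pos⇐ (inj₁ i) (inj₁ i′) p = p
    pos⇐ (inj₁ i) (inj₂ j)  p = ℕ.<-≤-trans (position<length i) (ℕ.m≤m+n (length u) (position j))
    pos⇐ (inj₂ j) (inj₂ j′) p = ℕ.+-monoʳ-< (length u) p

  word-⊖ : Below v u → Word (u ++ v) ≈ᴮ Word u ⊖ Word v
  word-⊖ v<u =
      record { fun = splitᵂ u
             ; mono₁ = λ x y p → pos⇒ (splitᵂ u x) (splitᵂ u y)
                 (subst₂ _<_ (sym (position-split x)) (sym (position-split y)) p)
             ; mono₂ = λ x y p → val⇒ (splitᵂ u x) (splitᵂ u y)
                 (subst₂ _<_ (sym (entry-split x)) (sym (entry-split y)) p) }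
    , record { fun = joinᵂ
             ; mono₁ = λ x y p → subst₂ _<_ (sym (position-join x)) (sym (position-join y)) (pos⇐ x y p)
             ; mono₂ = λ x y p → subst₂ _<_ (sym (entry-join x)) (sym (entry-join y)) (val⇐ x y p) }
    where
    val⇒ : ∀ x y → entry′ x < entry′ y → Val (Word u ⊖ Word v) x y
    val⇒ (inj₁ i) (inj₁ i′) p = p
    val⇒ (inj₁ i) (inj₂ j)  p = ℕ.<-asym p (v<u (entry∈ j) (entry∈ i))
    val⇒ (inj₂ j) (inj₁ i)  p = tt
    val⇒ (inj₂ j) (inj₂ j′) p = p
    val⇐ : ∀ x y → Val (Word u ⊖ Word v) x y → entry′ x < entry′ y
    val⇐ (inj₁ i) (inj₁ i′) p = p
    val⇐ (inj₂ j) (inj₁ i)  p = v<u (entry∈ j) (entry∈ i)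
    val⇐ (inj₂ j) (inj₂ j′) p = p

  word-⊕ : Below u v → Word (u ++ v) ≈ᴮ Word u ⊕ Word v
  word-⊕ u<v =
      record { fun = splitᵂ u
             ; mono₁ = λ x y p → pos⇒ (splitᵂ u x) (splitᵂ u y)
                 (subst₂ _<_ (sym (position-split x)) (sym (position-split y)) p)
             ; mono₂ = λ x y p → val⇒ (splitᵂ u x) (splitᵂ u y)
                 (subst₂ _<_ (sym (entry-split x)) (sym (entry-split y)) p) }
    , record { fun = joinᵂ
             ; mono₁ = λ x y p → subst₂ _<_ (sym (position-join x)) (sym (position-join y)) (pos⇐ x y p)
             ; mono₂ = λ x y p → subst₂ _<_ (sym (entry-join x)) (sym (entry-join y)) (val⇐ x y p) }
    where
    val⇒ : ∀ x y → entry′ x < entry′ y → Val (Word u ⊕ Word v) x y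
    val⇒ (inj₁ i) (inj₁ i′) p = p
    val⇒ (inj₁ i) (inj₂ j)  p = tt
    val⇒ (inj₂ j) (inj₁ i)  p = ℕ.<-asym p (u<v (entry∈ i) (entry∈ j))
    val⇒ (inj₂ j) (inj₂ j′) p = p
    val⇐ : ∀ x y → Val (Word u ⊕ Word v) x y → entry′ x < entry′ y
    val⇐ (inj₁ i) (inj₁ i′) p = p
    val⇐ (inj₁ i) (inj₂ j)  p = u<v (entry∈ i) (entry∈ j)
    val⇐ (inj₂ j) (inj₂ j′) p = p

word-cong : ∀ {u v} → u ≡ v → Word u ≈ᴮ Word v
word-cong refl = ≈ᴮ-refl

word-singleton : ∀ z → Word (z ∷ []) ≈ᴮ 𝟙
word-singleton z = record { fun = λ _ → tt ; mono₁ = λ { first first () }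
                          ; mono₂ = λ { first first p → ℕ.<-irrefl refl p } }
                 , record { fun = λ _ → first ; mono₁ = λ _ _ () ; mono₂ = λ _ _ () }

word-∷ʳ : ∀ u z → Below u (z ∷ []) → Word (u ∷ʳ z) ≈ᴮ Word u ⊕ 𝟙
word-∷ʳ u z u<z = ≈ᴮ-trans (word-⊕ u (z ∷ []) u<z) (⊕-cong ≈ᴮ-refl (word-singleton z))

word-twin : ∀ u z v z′ → Below u (z ∷ []) → Below v (z′ ∷ []) → Below (v ∷ʳ z′) (u ∷ʳ z) →
            Word ((u ∷ʳ z) ++ (v ∷ʳ z′)) ≈ᴮ (Word u ⊕ 𝟙) ⊖ (Word v ⊕ 𝟙)
word-twin u z v z′ u<z v<z′ below = ≈ᴮ-trans (word-⊖ (u ∷ʳ z) (v ∷ʳ z′) below)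
  (⊖-cong (word-∷ʳ u z u<z) (word-∷ʳ v z′ v<z′))

interval-∷ʳ : ∀ a k → interval a (suc k) ≡ interval a k ∷ʳ (a + suc k)
interval-∷ʳ a k = sym (applyUpTo-∷ʳ (λ i → a + suc i) k)

∈-interval⁻ : ∀ a k {x} → x ∈ interval a k → a < x × x < a + suc k
∈-interval⁻ a k x∈ with ∈-applyUpTo⁻ (λ i → a + suc i) x∈
... | i , i<k , refl = ℕ.m<m+n a (s≤s z≤n) , ℕ.+-monoʳ-< a (s≤s i<k)

word-interval : ∀ a k → Word (interval a k) ≈ᴮ ⟦ chain k ⟧ᵖ
word-interval a zero    = record { fun = λ () ; mono₁ = λ () ; mono₂ = λ () } , 𝟘-least
word-interval a (suc k) = ≈ᴮ-trans (word-cong (interval-∷ʳ a k))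
  (≈ᴮ-trans (word-∷ʳ (interval a k) (a + suc k) λ { x∈ (here refl) → proj₂ (∈-interval⁻ a k x∈) })
            (⊕-cong (word-interval a k) ≈ᴮ-refl))

order-chain : ∀ k → order (chain k) ≡ k
order-chain zero    = refl
order-chain (suc k) = cong suc (order-chain k)

record IsPattern (w : List ℕ) : Set where
  field
    shape       : Pattern
    order-shape : order shape ≡ length w
    word≈shape  : Word w ≈ᴮ ⟦ shape ⟧ᵖ

open IsPattern

length-∷ʳ : ∀ (u : List ℕ) z → length (u ∷ʳ z) ≡ suc (length u)
length-∷ʳ u z = trans (length-++ u) (ℕ.+-comm (length u) 1)

pattern-∷ʳ : ∀ {u} z → IsPattern u → Below u (z ∷ []) → IsPattern (u ∷ʳ z)
pattern-∷ʳ {u} z p u<z = record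
  { shape       = top (shape p)
  ; order-shape = trans (cong suc (order-shape p)) (sym (length-∷ʳ u z))
  ; word≈shape  = ≈ᴮ-trans (word-∷ʳ u z u<z) (⊕-cong (word≈shape p) ≈ᴮ-refl) }

-- Each new entry exceeds everything before it and therefore adds a `top`.
pattern-++ : ∀ {u} τ → IsPattern u → AllPairs _<_ τ → Below u τ → IsPattern (u ++ τ)
pattern-++ {u} []      p _          _   = subst IsPattern (sym (++-identityʳ u)) p
pattern-++ {u} (z ∷ τ) p (z< ∷ inc) u<τ = subst IsPattern (++-assoc u (z ∷ []) τ)
  (pattern-++ τ (pattern-∷ʳ z p (λ { x∈ (here refl) → u<τ x∈ (here refl) })) inc below)
  where
  below : Below (u ∷ʳ z) τ
  below x∈ y∈ with ∈-++⁻ u x∈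
  ... | inj₁ x∈u         = u<τ x∈u (there y∈)
  ... | inj₂ (here refl) = All.lookup z< y∈

-- An increasing run τ followed by a nonempty lower interval: the last entry of τ
-- and the interval turn the pattern into a twin.
pattern-block : ∀ {u} τ a k → τ ≢ [] → IsPattern u → AllPairs _<_ τ → Below u τ →
                Below (interval a k) u → Below (interval a k) τ → IsPattern (u ++ (τ ++ interval a k))
pattern-block τ a zero τ≢[] p inc u<τ _ _ =
  subst (λ w → IsPattern (_ ++ w)) (sym (++-identityʳ τ)) (pattern-++ τ p inc u<τ)
pattern-block {u} τ a (suc k) τ≢[] p inc u<τ ρ<u ρ<τ with initLast τ
... | []      = contradiction refl τ≢[]
... | τ′ ∷ʳ′ z = subst IsPattern rearrange (record
  { shape       = twin (shape q) (chain k)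
  ; order-shape = trans
      (cong₂ (λ m n → suc (m + suc n)) (order-shape q) (trans (order-chain k) (sym (length-interval k))))
      (sym (trans (length-++ (u′ ∷ʳ z)) (cong₂ _+_ (length-∷ʳ u′ z) (length-∷ʳ (interval a k) (a + suc k)))))
  ; word≈shape  = ≈ᴮ-trans
      (word-twin u′ z (interval a k) (a + suc k) u′<z
        (λ { x∈ (here refl) → proj₂ (∈-interval⁻ a k x∈) }) below)
      (⊖-cong (⊕-cong (word≈shape q) ≈ᴮ-refl) (⊕-cong (word-interval a k) ≈ᴮ-refl)) })
  where
  u′ = u ++ τ′
  length-interval : ∀ k → length (interval a k) ≡ k
  length-interval k = length-applyUpTo (λ i → a + suc i) k
  τ′-inc : AllPairs _<_ τ′ × Below τ′ (z ∷ [])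
  τ′-inc = go τ′ inc
    where
    go : ∀ τ′ → AllPairs _<_ (τ′ ∷ʳ z) → AllPairs _<_ τ′ × Below τ′ (z ∷ [])
    go []       _          = [] , λ ()
    go (x ∷ τ′) (x< ∷ inc) =
      let inc′ , below = go τ′ inc in
      All.tabulate (λ y∈ → All.lookup x< (∈-++⁺ˡ y∈)) ∷ inc′ , λ where
        (here refl) (here refl) → All.lookup x< (∈-++⁺ʳ τ′ (here refl))
        (there y∈)  z∈          → below y∈ z∈
  q : IsPattern u′
  q = pattern-++ τ′ p (proj₁ τ′-inc) (λ x∈ y∈ → u<τ x∈ (∈-++⁺ˡ y∈))
  u′<z : Below u′ (z ∷ [])
  u′<z x∈ (here refl) with ∈-++⁻ u x∈
  ... | inj₁ x∈u  = u<τ x∈u (∈-++⁺ʳ τ′ (here refl))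
  ... | inj₂ x∈τ′ = proj₂ τ′-inc x∈τ′ (here refl)
  below : Below (interval a k ∷ʳ (a + suc k)) (u′ ∷ʳ z)
  below x∈ y∈ = go (subst (_ ∈_) (sym (interval-∷ʳ a k)) x∈) (∈-++⁻ u (subst (_ ∈_) (++-assoc u τ′ (z ∷ [])) y∈))
    where
    go : ∀ {x y} → x ∈ interval a (suc k) → y ∈ u ⊎ y ∈ τ′ ∷ʳ z → x < y
    go x∈ (inj₁ y∈) = ρ<u x∈ y∈
    go x∈ (inj₂ y∈) = ρ<τ x∈ y∈
  rearrange : (u′ ∷ʳ z) ++ (interval a k ∷ʳ (a + suc k)) ≡ u ++ ((τ′ ∷ʳ z) ++ interval a (suc k))
  rearrange = trans (cong₂ _++_ (++-assoc u τ′ (z ∷ [])) (sym (interval-∷ʳ a k))) (++-assoc u (τ′ ∷ʳ z) _)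

-- The prefix `u` holds the blocks already read. The invariant is that all τ-entries to come lie
-- above it and all ρ-entries to come lie below it; the decreasing order of the layers preserves the
-- second half.
pattern-blocks : ∀ {u} (blocks : List (List ℕ × List ℕ)) → IsPattern u →
  let τs = map proj₁ blocks ; ρs = map proj₂ blocks in
  All (λ (τ , _) → τ ≢ []) blocks → AllPairs _<_ (concat τs) →
  All IsInterval ρs → AllPairs _AllAbove_ ρs →
  Below u (concat τs) → Below (concat ρs) u → Below (concat ρs) (concat τs) →
  IsPattern (u ++ concatMap (λ (τ , ρ) → τ ++ ρ) blocks)
pattern-blocks {u} [] p _ _ _ _ _ _ _ = subst IsPattern (sym (++-identityʳ u)) p
pattern-blocks {u} ((τ , ρ) ∷ blocks) p (τ≢[] ∷ ne) inc ((a , ρ≡) ∷ int) (ρ> ∷ desc) u<τ ρ<u ρ<τ =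
  subst IsPattern (++-assoc u (τ ++ ρ) _) (pattern-blocks blocks
    (subst (λ w → IsPattern (u ++ (τ ++ w))) (sym ρ≡) (pattern-block τ a (length ρ) τ≢[] p
      (proj₁ inc′) (λ x∈ y∈ → u<τ x∈ (∈-++⁺ˡ y∈))
      (λ x∈ y∈ → ρ<u (∈-++⁺ˡ (subst (_ ∈_) (sym ρ≡) x∈)) y∈)
      (λ x∈ y∈ → ρ<τ (∈-++⁺ˡ (subst (_ ∈_) (sym ρ≡) x∈)) (∈-++⁺ˡ y∈))))
    ne (proj₁ (proj₂ inc′)) int desc u′<τ ρ<u′ (λ x∈ y∈ → ρ<τ (∈-++⁺ʳ ρ x∈) (∈-++⁺ʳ τ y∈)))
  where
  τs = concat (map proj₁ blocks)
  ρs = map proj₂ blocks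
  inc′ : AllPairs _<_ τ × AllPairs _<_ τs × Below τ τs
  inc′ = go τ inc
    where
    go : ∀ τ → AllPairs _<_ (τ ++ τs) → AllPairs _<_ τ × AllPairs _<_ τs × Below τ τs
    go []      inc        = [] , inc , λ ()
    go (x ∷ τ) (x< ∷ inc) =
      let inc₁ , inc₂ , below = go τ inc in
      All.tabulate (λ y∈ → All.lookup x< (∈-++⁺ˡ y∈)) ∷ inc₁ , inc₂ , λ where
        (here refl) y∈ → All.lookup x< (∈-++⁺ʳ τ y∈)
        (there x∈)  y∈ → below x∈ y∈
  u′<τ : Below (u ++ (τ ++ ρ)) τs
  u′<τ x∈ y∈ with ∈-++⁻ u x∈
  ... | inj₁ x∈u = u<τ x∈u (∈-++⁺ʳ τ y∈)
  ... | inj₂ x∈′ with ∈-++⁻ τ x∈′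
  ...   | inj₁ x∈τ = proj₂ (proj₂ inc′) x∈τ y∈
  ...   | inj₂ x∈ρ = ρ<τ (∈-++⁺ˡ x∈ρ) (∈-++⁺ʳ τ y∈)
  ρ-above : ∀ {x y} ρs → All (ρ AllAbove_) ρs → x ∈ concat ρs → y ∈ ρ → x < y
  ρ-above (ρ′ ∷ ρs) (ρ>ρ′ ∷ ρ>) x∈ y∈ with ∈-++⁻ ρ′ x∈
  ... | inj₁ x∈ρ′ = All.lookup (All.lookup ρ>ρ′ y∈) x∈ρ′
  ... | inj₂ x∈ρs = ρ-above ρs ρ> x∈ρs y∈
  ρ<u′ : Below (concat ρs) (u ++ (τ ++ ρ))
  ρ<u′ x∈ y∈ with ∈-++⁻ u y∈
  ... | inj₁ y∈u = ρ<u (∈-++⁺ʳ ρ x∈) y∈u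
  ... | inj₂ y∈′ with ∈-++⁻ τ y∈′
  ...   | inj₁ y∈τ = ρ<τ (∈-++⁺ʳ ρ x∈) (∈-++⁺ˡ y∈τ)
  ...   | inj₂ y∈ρ = ρ-above ρs ρ> x∈ y∈ρ

interval-increasing : ∀ a k → AllPairs _<_ (interval a k)
interval-increasing a k = AllPairs.applyUpTo⁺₁ (λ i → a + suc i) k (λ i<j _ → ℕ.+-monoʳ-< a (s≤s i<j))

wedge⇒pattern : ∀ {m} (σ : Permutation′ m) → Wedge σ → IsPattern (oneLine σ)
wedge⇒pattern {m} σ w = subst IsPattern (sym decomposes)
  (pattern-blocks blocks
    (record { shape = ∅ ; order-shape = refl ; word≈shape = word-interval 0 0 })
    τ-nonempty (subst (AllPairs _<_) (sym τ-entries) (interval-increasing s (m ℕ.∸ s)))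
    (proj₁ (proj₂ ρ-layered)) (proj₂ (proj₂ ρ-layered))
    (λ ()) (λ _ ())
    λ x∈ y∈ → ℕ.≤-<-trans (ℕ.s≤s⁻¹ (proj₂ (∈-interval⁻ 0 s (∈-resp-↭ (proj₁ ρ-layered) x∈))))
                           (proj₁ (∈-interval⁻ s (m ℕ.∸ s) (subst (_ ∈_) τ-entries y∈))))
  where open Wedge w

-- Words of permutations and of their inverses

at : ∀ {n} (g : Fin n → ℕ) → Fin n → Index (tabulate g)
at g Fin.zero    = first
at g (Fin.suc i) = next (at (g ∘ Fin.suc) i)

at⁻¹ : ∀ {n} (g : Fin n → ℕ) → Index (tabulate g) → Fin n
at⁻¹ {suc n} g first    = Fin.zero
at⁻¹ {suc n} g (next k) = Fin.suc (at⁻¹ (g ∘ Fin.suc) k)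

position-at : ∀ {n} (g : Fin n → ℕ) i → position (at g i) ≡ Fin.toℕ i
position-at g Fin.zero    = refl
position-at g (Fin.suc i) = cong suc (position-at (g ∘ Fin.suc) i)

entry-at : ∀ {n} (g : Fin n → ℕ) i → entry (at g i) ≡ g i
entry-at g Fin.zero    = refl
entry-at g (Fin.suc i) = entry-at (g ∘ Fin.suc) i

at-at⁻¹ : ∀ {n} (g : Fin n → ℕ) k → at g (at⁻¹ g k) ≡ k
at-at⁻¹ {suc n} g first    = refl
at-at⁻¹ {suc n} g (next k) = cong next (at-at⁻¹ (g ∘ Fin.suc) k)

word-tabulate : ∀ {n} {α : Fin n → Fin n} (g : Fin n → ℕ) →
  (∀ i j → α i Fin.< α j → g i < g j) → (∀ i j → g i < g j → α i Fin.< α j) →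
  Word (tabulate g) ≈ᴮ FinPlot α
word-tabulate g mono reflect =
    record { fun = at⁻¹ g
           ; mono₁ = λ k l → subst₂ _<_ (position⁻¹ k) (position⁻¹ l)
           ; mono₂ = λ k l p → reflect _ _ (subst₂ _<_ (entry⁻¹ k) (entry⁻¹ l) p) }
  , record { fun = at g
           ; mono₁ = λ i j → subst₂ _<_ (sym (position-at g i)) (sym (position-at g j))
           ; mono₂ = λ i j p → subst₂ _<_ (sym (entry-at g i)) (sym (entry-at g j)) (mono i j p) }
  where
  position⁻¹ : ∀ k → position k ≡ Fin.toℕ (at⁻¹ g k)
  position⁻¹ k = trans (cong position (sym (at-at⁻¹ g k))) (position-at g (at⁻¹ g k))
  entry⁻¹ : ∀ k → entry k ≡ g (at⁻¹ g k)
  entry⁻¹ k = trans (cong entry (sym (at-at⁻¹ g k))) (entry-at g (at⁻¹ g k))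

word-oneLine : ∀ {n} (π : Permutation′ n) → Word (oneLine π) ≈ᴮ FinPlot (π ⟨$⟩ʳ_)
word-oneLine π = word-tabulate _ (λ _ _ p → s≤s p) (λ _ _ p → ℕ.s≤s⁻¹ p)

word-⊹ : ∀ {n} (π : Permutation′ n) l → Word (oneLine π ⊹ l) ≈ᴮ FinPlot (π ⟨$⟩ʳ_)
word-⊹ π l = ≈ᴮ-trans (word-cong (map-tabulate _ (_+ l)))
  (word-tabulate _ (λ i j p → ℕ.+-monoˡ-< l (s≤s p)) (λ i j p → ℕ.s≤s⁻¹ (ℕ.+-cancelʳ-< l _ _ p)))

flip-ᵀ : ∀ {n} (π : Permutation′ n) → FinPlot (Perm.flip π ⟨$⟩ʳ_) ≈ᴮ FinPlot (π ⟨$⟩ʳ_) ᵀ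
flip-ᵀ π = record { fun = π ⟨$⟩ˡ_ ; mono₁ = λ i j → subst₂ Fin._<_ (sym (inverseʳ π)) (sym (inverseʳ π))
                  ; mono₂ = λ _ _ p → p }
         , record { fun = π ⟨$⟩ʳ_ ; mono₁ = λ _ _ p → p
                  ; mono₂ = λ i j → subst₂ Fin._<_ (sym (inverseˡ π)) (sym (inverseˡ π)) }

⊖-ᵀ : ∀ A B → (A ⊖ B) ᵀ ≈ᴮ B ᵀ ⊖ A ᵀ
⊖-ᵀ A B =
    record { fun = Sum.swap
           ; mono₁ = λ { (inj₁ _) (inj₁ _) p → p ; (inj₂ _) (inj₁ _) p → p ; (inj₂ _) (inj₂ _) p → p }
           ; mono₂ = λ { (inj₁ _) (inj₁ _) p → p ; (inj₁ _) (inj₂ _) p → p ; (inj₂ _) (inj₂ _) p → p } }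
  , record { fun = Sum.swap
           ; mono₁ = λ { (inj₁ _) (inj₁ _) p → p ; (inj₁ _) (inj₂ _) p → p ; (inj₂ _) (inj₂ _) p → p }
           ; mono₂ = λ { (inj₁ _) (inj₁ _) p → p ; (inj₂ _) (inj₁ _) p → p ; (inj₂ _) (inj₂ _) p → p } }

-- Inversion exchanges the two summands of a skew sum. Closure under inversion covers the double
-- wedges that begin with σ⁻¹.
transposeᵖ : Pattern → Pattern
transposeᵖ ∅          = ∅
transposeᵖ (top p)    = top (transposeᵖ p)
transposeᵖ (twin p q) = twin (transposeᵖ q) (transposeᵖ p)

transposeᵖ-ᵀ : ∀ p → ⟦ transposeᵖ p ⟧ᵖ ≈ᴮ ⟦ p ⟧ᵖ ᵀ
transposeᵖ-ᵀ ∅          = ≈ᴮ-refl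
transposeᵖ-ᵀ (top p)    = ⊕-cong (transposeᵖ-ᵀ p) ≈ᴮ-refl
transposeᵖ-ᵀ (twin p q) = ≈ᴮ-trans
  (⊖-cong (⊕-cong (transposeᵖ-ᵀ q) ≈ᴮ-refl) (⊕-cong (transposeᵖ-ᵀ p) ≈ᴮ-refl))
  (≈ᴮ-sym (⊖-ᵀ (⟦ p ⟧ᵖ ⊕ 𝟙) (⟦ q ⟧ᵖ ⊕ 𝟙)))

order-transposeᵖ : ∀ p → order (transposeᵖ p) ≡ order p
order-transposeᵖ ∅          = refl
order-transposeᵖ (top p)    = cong suc (order-transposeᵖ p)
order-transposeᵖ (twin p q) = cong suc (trans
  (cong₂ (λ a b → a + suc b) (order-transposeᵖ q) (order-transposeᵖ p))
  (trans (ℕ.+-suc (order q) (order p)) (trans (cong suc (ℕ.+-comm (order q) (order p)))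
    (sym (ℕ.+-suc (order p) (order q))))))

∈-oneLine⁻ : ∀ {n} (π : Permutation′ n) {x} → x ∈ oneLine π → 0 < x × x < suc n
∈-oneLine⁻ π x∈ with ∈-tabulate⁻ x∈
... | i , refl = s≤s z≤n , s≤s (Fin.toℕ<n (π ⟨$⟩ʳ i))

-- The entries 2l and l are the corners of the two halves, and the value l separates them: the
-- second half stays at or below it, the first half above it.
word-doubleWedge : ∀ {m} (π ρ : Permutation′ m) → let l = suc m in
  Word ((oneLine π ⊹ l) ++ (2 * l ∷ []) ++ oneLine ρ ++ (l ∷ [])) ≈ᴮ
  (FinPlot (π ⟨$⟩ʳ_) ⊕ 𝟙) ⊖ (FinPlot (ρ ⟨$⟩ʳ_) ⊕ 𝟙)
word-doubleWedge {m} π ρ = ≈ᴮ-trans (word-cong (sym (++-assoc (oneLine π ⊹ l) (2 * l ∷ []) _)))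
  (≈ᴮ-trans (word-twin (oneLine π ⊹ l) (2 * l) (oneLine ρ) l
      (λ { x∈ (here refl) → proj₂ (shifted x∈) }) (λ { x∈ (here refl) → proj₂ (∈-oneLine⁻ ρ x∈) }) below)
    (⊖-cong (⊕-cong (word-⊹ π l) ≈ᴮ-refl) (⊕-cong (word-oneLine ρ) ≈ᴮ-refl)))
  where
  l = suc m
  2l≡ : l + l ≡ 2 * l
  2l≡ = cong (l +_) (sym (ℕ.+-identityʳ l))
  shifted : ∀ {x} → x ∈ oneLine π ⊹ l → l < x × x < 2 * l
  shifted x∈ with ∈-map⁻ (_+ l) x∈
  ... | y , y∈ , refl = ℕ.m<n+m l (proj₁ (∈-oneLine⁻ π y∈))
                      , subst (y + l <_) 2l≡ (ℕ.+-monoˡ-< l (proj₂ (∈-oneLine⁻ π y∈)))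
  low : ∀ {x} → x ∈ oneLine ρ ∷ʳ l → x ≤ l
  low x∈ with ∈-++⁻ (oneLine ρ) x∈
  ... | inj₁ x∈ρ         = ℕ.<⇒≤ (proj₂ (∈-oneLine⁻ ρ x∈ρ))
  ... | inj₂ (here refl) = ℕ.≤-refl
  high : ∀ {x} → x ∈ (oneLine π ⊹ l) ∷ʳ (2 * l) → l < x
  high x∈ with ∈-++⁻ (oneLine π ⊹ l) x∈
  ... | inj₁ x∈π         = proj₁ (shifted x∈π)
  ... | inj₂ (here refl) = subst (l <_) 2l≡ (ℕ.m<m+n l (s≤s z≤n))
  below : Below (oneLine ρ ∷ʳ l) ((oneLine π ⊹ l) ∷ʳ (2 * l))
  below x∈ y∈ = ℕ.≤-<-trans (low x∈) (high y∈)

doubleWedge⇒pattern : ∀ {m} (τ : Permutation′ (2 * suc m)) → DoubleWedge (suc m) τ →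
  ∃ λ K → order K ≡ m × FinPlot (τ ⟨$⟩ʳ_) ≈ᴮ (⟦ K ⟧ᵖ ⊕ 𝟙) ⊖ (⟦ K ⟧ᵖ ᵀ ⊕ 𝟙)
doubleWedge⇒pattern {m} τ (σ , wedge , line) = go line
  where
  pat = wedge⇒pattern σ wedge
  order≡ : order (shape pat) ≡ m
  order≡ = trans (order-shape pat) (length-tabulate _)
  σ≈ : FinPlot (σ ⟨$⟩ʳ_) ≈ᴮ ⟦ shape pat ⟧ᵖ
  σ≈ = ≈ᴮ-trans (≈ᴮ-sym (word-oneLine σ)) (word≈shape pat)
  σ⁻¹≈ : FinPlot (Perm.flip σ ⟨$⟩ʳ_) ≈ᴮ ⟦ shape pat ⟧ᵖ ᵀ
  σ⁻¹≈ = ≈ᴮ-trans (flip-ᵀ σ) (ᵀ-cong σ≈)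
  go : _ → _
  -- Here σ⁻¹ comes first, so `K` is the transposed shape of σ and σ itself plays the part of its
  -- inverse.
  go (inj₁ eq) = transposeᵖ (shape pat) , trans (order-transposeᵖ (shape pat)) order≡ ,
    ≈ᴮ-trans (≈ᴮ-sym (word-oneLine τ)) (≈ᴮ-trans (word-cong eq)
      (≈ᴮ-trans (word-doubleWedge (Perm.flip σ) σ)
        (⊖-cong (⊕-cong (≈ᴮ-trans σ⁻¹≈ (≈ᴮ-sym (transposeᵖ-ᵀ (shape pat)))) ≈ᴮ-refl)
                (⊕-cong (≈ᴮ-trans σ≈ (≈ᴮ-sym (ᵀ-cong (transposeᵖ-ᵀ (shape pat))))) ≈ᴮ-refl))))
  go (inj₂ eq) = shape pat , order≡ ,
    ≈ᴮ-trans (≈ᴮ-sym (word-oneLine τ)) (≈ᴮ-trans (word-cong eq)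
      (≈ᴮ-trans (word-doubleWedge σ (Perm.flip σ))
        (⊖-cong (⊕-cong σ≈ ≈ᴮ-refl) (⊕-cong σ⁻¹≈ ≈ᴮ-refl))))

-- The increasing pattern and the final equations

tabulate-toℕ : ∀ (f : ℕ → ℕ) k → tabulate {n = k} (f ∘ Fin.toℕ) ≡ applyUpTo f k
tabulate-toℕ f zero    = refl
tabulate-toℕ f (suc k) = cong (f 0 ∷_) (tabulate-toℕ (f ∘ suc) k)

id≈chain : ∀ k → FinPlot (Perm.id {k} ⟨$⟩ʳ_) ≈ᴮ ⟦ chain k ⟧ᵖ
id≈chain k = ≈ᴮ-trans (≈ᴮ-sym (word-oneLine Perm.id))
  (≈ᴮ-trans (word-cong (tabulate-toℕ suc k)) (word-interval 0 k))

genFun-I : ∀ {k} (ρ : Permutation′ k) → genFun (I ρ) ≗ invSeries (occurs? ρ)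
genFun-I ρ n = trans (cong ℤ.+_ (I≡trees ρ n)) (total-avoid (occurs? ρ) (invTrees n))

genFun-id : ∀ k → genFun (I (Perm.id {k})) ≗ chainSeries k
genFun-id k n = trans (genFun-I Perm.id n) (total-cong (λ t → avoid-cong
  (≼-trans (proj₂ (id≈chain k))) (≼-trans (proj₁ (id≈chain k)))
  (occurs? Perm.id t) (chain-occurs? k t)) (invTrees n))

genFun-id-quotient : ∀ l → genFun (I (Perm.id {2 * l})) ∗ (1ˢ ⊝ x̂ ∗ r l) ≗ r l
genFun-id-quotient l n = trans
  (∗-cong {g = 1ˢ ⊝ x̂ ∗ r l} (genFun-id (2 * l)) (λ _ → refl) n)
  (trans (cong (λ k → (chainSeries (l + k) ∗ (1ˢ ⊝ x̂ ∗ r l)) n) (ℕ.+-identityʳ l)) (chain-quotient l n))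

genFun-doubleWedge-quotient : ∀ m (τ : Permutation′ (2 * suc m)) → DoubleWedge (suc m) τ →
  genFun (I τ) ∗ (1ˢ ⊝ x̂ ∗ r (suc m)) ≗ r (suc m)
genFun-doubleWedge-quotient m τ dw =
  let K , order≡ , τ≈ = doubleWedge⇒pattern τ dw
  in subst (λ k → genFun (I τ) ∗ (1ˢ ⊝ x̂ ∗ r (suc k)) ≗ r (suc k)) order≡ λ n → trans
       (∗-cong {g = 1ˢ ⊝ x̂ ∗ r (suc (order K))} (genFun-I τ) (λ _ → refl) n)
       (doubleWedge-quotient K τ≈ (occurs? τ) n)

theorem2p15 : (l : ℕ) → 2 ≤ l →
    (τ : Permutation′ (2 * l)) → DoubleWedge l τ → Avoids (τ ⟨$⟩ʳ_) (p132 ⟨$⟩ʳ_) →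
    (genFun (I τ) ≗ genFun (I (id {2 * l}))) ×
    (genFun (I (id {2 * l})) IsExpansionOf (R l X² √X² /ʳ (1ʳ -ʳ X *ʳ R l X² √X²)))
theorem2p15 (suc m) _ τ dw _ =
    -- Both series solve the linear equation F (1 - x r_l) = r_l, whose coefficient has constant
    -- term 1.
    ∗-cancelˡ d (unitConstant⇒nonZero (unitConstant-⊝ (r (suc m)) 1ˢ-unit refl)) (λ n →
      trans (∗-comm d (genFun (I τ)) n) (trans (genFun-doubleWedge-quotient m τ dw n)
        (trans (sym (genFun-id-quotient (suc m) n)) (∗-comm (genFun (I (id {2 * suc m}))) d n))))
  , expansion r treeSeries-∅ (λ k → treeSeries-top (chain k)) m (genFun (I (id {2 * suc m})))
      (genFun-id-quotient (suc m))
  where d = 1ˢ ⊝ x̂ ∗ r (suc m)
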